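{- Consider the exact block systems described in the context, with $K_*$ defined by $\sigma(P,\mathcal S)=K_*q^{(d-1)/2}\sqrt{|P||\mathcal S|}$. (1) Fix $d\ge4$ and $C_1\ge1$. For all sufficiently large odd prime powers $q$, every nondegenerate quadratic space $(\mathbb F_q^d,Q)$ admits such a block system, i.e. a point set $P$ and a family $\mathcal S$ of distinct spheres of one fixed nonzero radius, such that $$\frac{4q}{K_*^2}\le|\mathcal S|\le C_1K_*q^{(d-1)/2},$$ while $\max_H\frac{|P\cap H|}{|P|}\to0$ as $q\to\infty$ (maximum over affine hyperplanes $H$), and the number $t$ of exact centered blocks tends to infinity. (2) Let $d=3$, fix an integer $t\ge3$, and assume $C_1>t/\sqrt2$. For all sufficiently large odd prime powers $q$, every nondegenerate ternary quadratic space over $\mathbb F_q$ admits such a block system with exactly $t$ blocks, one fixed nonzero radius, and $$\frac{4q}{K_*^2}\le|\mathcal S|=tq\le C_1K_*q,\qquad K_*=(1-q^{ -1})\sqrt2.$$ Each diagonal block carries exactly $1/t$ of the total surplus, $\sigma(A_z,\mathcal S_z)=\frac1t\sigma(P,\mathcal S)$, and all cross-block centered discrepancies $\sigma(A_b,\mathcal S_z)$, $b\ne z$, vanish. Consequently, for $d\ge4$, no lower bound $|P\cap H|\ge cK_*^{ -C}|P|$ for some affine hyperplane $H$, with fixed $c>0$ and $C<\infty$, can follow from fixed-scale surplus and the moderate window, even for one nonzero radius: for any fixed $c>0$, $C<\infty$, the systems in (1) satisfy $|P\cap H|<cK_*^{ -C}|P|$ for every affine hyperplane $H$ once $q$ is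 sufficiently large. For every fixed $\delta>0$, the examples in (1) also satisfy $|P\cap L|\le\delta|P|$ for every proper affine flat $L\subsetneq\mathbb F_q^d$ (hence for every affine totally singular flat) once $q$ is sufficiently large.
   Context: Put $\langle x,y\rangle_Q=\frac{Q(x+y)-Q(x)-Q(y)}2$, $v^{\perp_Q}=\{x:\langle x,v\rangle_Q=0\}$, and $S_Q(c,r)=\{x\in\mathbb F_q^d:Q(x-c)=r\}$; spheres are parametrized by pairs $(c,r)$, distinct spheres meaning distinct pairs. $\sigma(A,\mathcal T)=|\{(p,S)\in A\times\mathcal T:p\in S\}|-|A||\mathcal T|/q$. Block systems ($d\ge3$, $q$ odd, $Q$ nondegenerate on $\mathbb F_q^d$). Choose $v\ne0$ with $Q(v)=0$ and $w$ with $\langle w,v\rangle_Q=1$. Choose $R\in\mathbb F_q^\times$ represented by $Q$ on $v^{\perp_Q}$ and put $X_R=\{y\in v^{\perp_Q}:Q(y)=R\}$. Let $Z\subseteq\mathbb F_q$ be nonempty, $t=|Z|$ (the number of blocks). For $z\in Z$ put $c_z=zw$, $A_z=c_z+X_R$, $\mathcal S_z=\{S_Q(c_z+uv,R):u\in\mathbb F_q\}$, and $P=\bigsqcup_{z\in Z}A_z$, $\mathcal S=\bigsqcup_{z\in Z}\mathcal S_z$; thus all spheres of $\mathcal S$ have the same radius $R\ne0$. These are exact centered blocks: $\sigma(A_b,\mathcal S_z)=0$ for $b\ne z$ and $\sigma(P,\mathcal S)=\sum_z\sigma(A_z,\mathcal S_z)$. An affine flat is totally singular if $Q$ vanishes on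 its direction space. The "moderate window" with constant $C_1$ and parameter $K$ is $\frac{4|P|}{K^2q^{d-1}}\le|\mathcal S|\le C_1Kq^{(d-1)/2}$; "fixed-scale surplus" is $\sigma(P,\mathcal S)\ge Kq^{(d-1)/2}\sqrt{|P||\mathcal S|}$. -}

module Defs where

open import Algebra.Bundles using (CommutativeRing)
open import Algebra.Morphism.Structures using (module RingMorphisms)
open import Algebra.Structures using (IsCommutativeRing)
open import Data.Fin.Base using (Fin)
import Data.Fin.Properties as Fin
open import Data.Integer.Base using (+_)
import Data.Integer.Base as ℤ
open import Data.List.Base using (List; []; _∷_; [_]; length; map; filter; foldr; tabulate; cartesianProduct; cartesianProductWith)
open import Data.List.Extrema.Nat using (max)
open import Data.List.Membership.Propositional using (find; lose) renaming (_∈_ to _∈ˡ_)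
open import Data.List.Membership.Propositional.Properties using (∈-tabulate⁺; ∈-cartesianProduct⁺; ∈-cartesianProductWith⁺)
open import Data.List.Relation.Unary.All using ([])
open import Data.List.Relation.Unary.AllPairs using ([]; _∷_)
open import Data.List.Relation.Unary.Any using (any?; here)
open import Data.List.Relation.Unary.Unique.Propositional using (Unique)
import Data.List.Relation.Unary.Unique.Propositional.Properties as Unique
open import Data.Nat.Base using (ℕ; zero; suc; NonZero; _≤_; _∸_)
import Data.Nat.Base as ℕ
open import Data.Nat.Divisibility using (_∣_)
open import Data.Nat.Primality using (Prime)
import Data.Nat.Properties as ℕ
open import Data.Product using (Σ; ∃; ∃-syntax; ∃₂; _×_; _,_; proj₁; proj₂)
open import Data.Product.Properties using () renaming (≡-dec to ×-≡-dec)
open import Data.Rational.Base using (ℚ; 0ℚ)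
import Data.Rational.Base as ℚ
import Data.Rational.Properties as ℚ
open import Data.Sum.Base using (_⊎_)
open import Data.Vec.Base using (Vec; []; _∷_; zipWith; replicate) renaming (map to mapⱽ; foldr′ to foldrⱽ)
open import Data.Vec.Properties using (∷-injective) renaming (≡-dec to Vec-≡-dec)
open import Function.Bundles using (_↔_; Inverse)
open import Function.Properties.Inverse using (↔⇒↣)
open import Level using (Level; 0ℓ) renaming (suc to lsuc)
open import Relation.Binary.Definitions using (DecidableEquality)
open import Relation.Binary.PropositionalEquality using (_≡_; _≢_; refl; sym; trans; cong; subst)
open import Relation.Binary.Structures using (IsStrictPartialOrder)
open import Relation.Nullary.Decidable using (Dec; map′; _×-dec_; ¬?; via-injection)
open import Relation.Nullary.Negation using (¬_)
open import Relation.Unary using (Pred; Decidable)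

-- The real numbers, axiomatically: a Cauchy-complete Archimedean ordered field,
-- with square roots and real powers of positive reals given by their
-- characteristic laws.  These axioms determine ℝ and its operations up to
-- isomorphism.  The order is axiomatised constructively (cotransitivity in place
-- of trichotomy), so Bishop's reals are also a model.
record RealNumbers : Set₁ where
  infix  4 _<ᴿ_ _≤ᴿ_
  infixl 6 _-ᴿ_
  infixl 7 _/ᴿ_ _*⁺_
  infixr 8 _^ᴿ_

  field
    commutativeRing : CommutativeRing 0ℓ 0ℓ

  open CommutativeRing commutativeRing public
    using (rawRing)
    renaming ( Carrier to ℝ; _≈_ to _≈ᴿ_; _+_ to _+ᴿ_; _*_ to _*ᴿ_; -_ to -ᴿ_
             ; 0# to 0ᴿ; 1# to 1ᴿ; refl to ≈-refl)

  _-ᴿ_ : ℝ → ℝ → ℝ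
  x -ᴿ y = x +ᴿ (-ᴿ y)

  field
    _<ᴿ_   : ℝ → ℝ → Set

  _≤ᴿ_ : ℝ → ℝ → Set
  x ≤ᴿ y = ¬ (y <ᴿ x)

  ℝ⁺ : Set
  ℝ⁺ = Σ ℝ (0ᴿ <ᴿ_)

  value : ℝ⁺ → ℝ
  value = proj₁

  field
    isStrictPartialOrder : IsStrictPartialOrder _≈ᴿ_ _<ᴿ_
    <-cotransitive       : ∀ {x y} → x <ᴿ y → ∀ z → x <ᴿ z ⊎ z <ᴿ y
    <-tight              : ∀ {x y} → x ≤ᴿ y → y ≤ᴿ x → x ≈ᴿ y
    +-mono-<             : ∀ {x y} z → x <ᴿ y → x +ᴿ z <ᴿ y +ᴿ z
    *-positive           : ∀ {x y} → 0ᴿ <ᴿ x → 0ᴿ <ᴿ y → 0ᴿ <ᴿ x *ᴿ y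

    inv       : ℝ⁺ → ℝ
    *-inverse : ∀ x → value x *ᴿ inv x ≈ᴿ 1ᴿ

    ι                    : ℚ → ℝ
    ι-isRingHomomorphism : RingMorphisms.IsRingHomomorphism ℚ.+-*-rawRing rawRing ι
    ι-mono-<             : ∀ {r s} → r ℚ.< s → ι r <ᴿ ι s
    ℚ-dense              : ∀ {x y} → x <ᴿ y → ∃[ r ] x <ᴿ ι r × ι r <ᴿ y

    complete : (x : ℕ → ℝ) →
      (∀ (ε : ℝ⁺) → ∃[ N ] ∀ m n → N ≤ m → N ≤ n → x m -ᴿ x n <ᴿ value ε) →
      ∃[ l ] ∀ (ε : ℝ⁺) → ∃[ N ] ∀ n → N ≤ n →
        x n -ᴿ l <ᴿ value ε × l -ᴿ x n <ᴿ value ε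

    √        : (x : ℝ) → 0ᴿ ≤ᴿ x → ℝ
    √-nonneg : ∀ x 0≤x → 0ᴿ ≤ᴿ √ x 0≤x
    √-square : ∀ x 0≤x → √ x 0≤x *ᴿ √ x 0≤x ≈ᴿ x
    √-pos    : ∀ x 0≤x → 0ᴿ <ᴿ x → 0ᴿ <ᴿ √ x 0≤x

    _^ᴿ_       : ℝ⁺ → ℝ → ℝ⁺
    ^-cong     : ∀ {x y a b} → value x ≈ᴿ value y → a ≈ᴿ b → value (x ^ᴿ a) ≈ᴿ value (y ^ᴿ b)
    ^-identity : ∀ x → value (x ^ᴿ 1ᴿ) ≈ᴿ value x
    ^-+        : ∀ x a b → value (x ^ᴿ (a +ᴿ b)) ≈ᴿ value (x ^ᴿ a) *ᴿ value (x ^ᴿ b)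
    ^-*        : ∀ x y z a → value z ≈ᴿ value x *ᴿ value y →
                 value (z ^ᴿ a) ≈ᴿ value (x ^ᴿ a) *ᴿ value (y ^ᴿ a)
    ^-mono     : ∀ x {a b} → 1ᴿ ≤ᴿ value x → a ≤ᴿ b → value (x ^ᴿ a) ≤ᴿ value (x ^ᴿ b)

  open IsStrictPartialOrder isStrictPartialOrder public
    using (<-resp-≈) renaming (irrefl to <-irrefl; trans to <-trans)
  open RingMorphisms.IsRingHomomorphism ι-isRingHomomorphism public
    using () renaming (0#-homo to ι-0)

  _/ᴿ_ : ℝ → ℝ⁺ → ℝ
  x /ᴿ y = x *ᴿ inv y

  _*⁺_ : ℝ⁺ → ℝ⁺ → ℝ⁺
  (x , 0<x) *⁺ (y , 0<y) = x *ᴿ y , *-positive 0<x 0<y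

  fromℕ : ℕ → ℝ
  fromℕ n = ι (+ n ℚ./ 1)

  fromℕ-pos : ∀ n .{{_ : NonZero n}} → 0ᴿ <ᴿ fromℕ n
  fromℕ-pos (suc n) = proj₂ <-resp-≈ ι-0
    (ι-mono-< (ℚ.positive⁻¹ _ {{ℚ.normalize-pos (suc n) 1}}))

  fromℕ-nonneg : ∀ n → 0ᴿ ≤ᴿ fromℕ n
  fromℕ-nonneg zero    n<0 = <-irrefl ≈-refl (proj₂ <-resp-≈ ι-0 n<0)
  fromℕ-nonneg (suc n) n<0 = <-irrefl ≈-refl (<-trans n<0 (fromℕ-pos (suc n)))

  fromℕ⁺ : (n : ℕ) .{{_ : NonZero n}} → ℝ⁺
  fromℕ⁺ n = fromℕ n , fromℕ-pos n

  √ℕ : ℕ → ℝ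
  √ℕ n = √ (fromℕ n) (fromℕ-nonneg n)

  √ℕ⁺ : (n : ℕ) .{{_ : NonZero n}} → ℝ⁺
  √ℕ⁺ n = √ℕ n , √-pos (fromℕ n) (fromℕ-nonneg n) (fromℕ-pos n)

  -- q ^ ((d - 1) / 2)
  halfPower : (q d : ℕ) .{{_ : NonZero q}} → ℝ
  halfPower q d = value (fromℕ⁺ q ^ᴿ ι ((+ d ℤ.- ℤ.1ℤ) ℚ./ 2))

open RealNumbers {{...}} public
  using ( ℝ; ℝ⁺; value; 1ᴿ; _≈ᴿ_; _<ᴿ_; _≤ᴿ_; _-ᴿ_; -ᴿ_; _*ᴿ_; _*⁺_; _/ᴿ_; _^ᴿ_; inv; ι
        ; fromℕ; fromℕ⁺; √ℕ; √ℕ⁺; halfPower)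

record Finite (X : Set) : Set where
  field
    elements : List X
    complete : ∀ x → x ∈ˡ elements
    unique   : Unique elements
    _≟_      : DecidableEquality X

open Finite {{...}} public using (elements; _≟_)

instance
  finite-Vec : ∀ {X n} → {{Finite X}} → Finite (Vec X n)
  finite-Vec {X} {n} {{fin}} = record
    { elements = elems n
    ; complete = complete′
    ; unique   = unique′ n
    ; _≟_      = Vec-≡-dec (Finite._≟_ fin)
    }
    where
    elems : ∀ n → List (Vec X n)
    elems zero    = [ [] ]
    elems (suc n) = cartesianProductWith _∷_ (Finite.elements fin) (elems n)

    complete′ : ∀ {n} (xs : Vec X n) → xs ∈ˡ elems n
    complete′ []       = here refl
    complete′ (x ∷ xs) = ∈-cartesianProductWith⁺ _∷_ (Finite.complete fin x) (complete′ xs)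

    unique′ : ∀ n → Unique (elems n)
    unique′ zero    = [] ∷ []
    unique′ (suc n) = Unique.cartesianProductWith⁺ _∷_ ∷-injective (Finite.unique fin) (unique′ n)

  finite-× : ∀ {X Y} → {{Finite X}} → {{Finite Y}} → Finite (X × Y)
  finite-× {{fx}} {{fy}} = record
    { elements = cartesianProduct (Finite.elements fx) (Finite.elements fy)
    ; complete = λ { (x , y) → ∈-cartesianProduct⁺ (Finite.complete fx x) (Finite.complete fy y) }
    ; unique   = Unique.cartesianProduct⁺ (Finite.unique fx) (Finite.unique fy)
    ; _≟_      = ×-≡-dec (Finite._≟_ fx) (Finite._≟_ fy)
    }

∃? : ∀ {X} {{_ : Finite X}} {P : Pred X 0ℓ} → Decidable P → Dec (∃ P)
∃? {{fin}} P? = map′ (λ p → let (x , _ , px) = find p in x , px)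
                     (λ { (x , px) → lose (Finite.complete fin x) px })
                     (any? P? elements)

-- Subsets of finite types are decidable predicates, so that they have a cardinality.
infix 4 _∈_ _∉_ _∈?_
infixr 7 _∩_

record Subset (X : Set) : Set₁ where
  constructor ⟨_∣_⟩
  field
    member  : Pred X 0ℓ
    member? : Decidable member

_∈_ _∉_ : ∀ {X} → X → Subset X → Set
x ∈ A = Subset.member A x
x ∉ A = ¬ (x ∈ A)

_∈?_ : ∀ {X} (x : X) (A : Subset X) → Dec (x ∈ A)
x ∈? A = Subset.member? A x

_∩_ : ∀ {X} → Subset X → Subset X → Subset X
A ∩ B = ⟨ (λ x → x ∈ A × x ∈ B) ∣ (λ x → (x ∈? A) ×-dec (x ∈? B)) ⟩

Disjoint : ∀ {X} → Subset X → Subset X → Set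
Disjoint A B = ∀ x → x ∈ A → x ∉ B

∣_∣ : ∀ {X} {{_ : Finite X}} → Subset X → ℕ
∣ A ∣ = length (filter (_∈? A) elements)

∑[_]_ : ∀ {X} {{_ : Finite X}} → Subset X → (X → ℚ) → ℚ
∑[ A ] f = foldr ℚ._+_ 0ℚ (map f (filter (_∈? A) elements))

record FiniteField (q : ℕ) : Set₁ where
  infixl 6 _+_ _-_
  infixl 7 _*_
  field
    Carrier           : Set
    _+_ _*_           : Carrier → Carrier → Carrier
    -_ _⁻¹            : Carrier → Carrier
    0# 1#             : Carrier
    isCommutativeRing : IsCommutativeRing _≡_ _+_ _*_ -_ 0# 1#
    0≢1               : 0# ≢ 1#
    -- no condition on the junk value 0# ⁻¹
    *-inverseʳ        : ∀ x → x ≢ 0# → x * (x ⁻¹) ≡ 1#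
    enumeration       : Carrier ↔ Fin q

  _-_ : Carrier → Carrier → Carrier
  x - y = x + (- y)

  open Inverse enumeration using (to; from; strictlyInverseʳ; strictlyInverseˡ)

  nonZero : NonZero q
  nonZero = Fin.nonZeroIndex (to 0#)

  instance
    finite : Finite Carrier
    finite = record
      { elements = tabulate from
      ; complete = λ x → subst (_∈ˡ tabulate from) (strictlyInverseʳ x) (∈-tabulate⁺ (to x))
      ; unique   = Unique.tabulate⁺ λ {i} {j} eq →
                     trans (sym (strictlyInverseˡ i)) (trans (cong to eq) (strictlyInverseˡ j))
      ; _≟_      = via-injection (↔⇒↣ enumeration) Fin._≟_
      }

module Vectors {q} (𝔽 : FiniteField q) where
  open FiniteField 𝔽

  infixl 6 _+ⱽ_ _-ⱽ_
  infixr 7 _·_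

  _+ⱽ_ _-ⱽ_ : ∀ {d} → Vec Carrier d → Vec Carrier d → Vec Carrier d
  _+ⱽ_ = zipWith _+_
  _-ⱽ_ = zipWith _-_

  _·_ : ∀ {d} → Carrier → Vec Carrier d → Vec Carrier d
  a · x = mapⱽ (a *_) x

  0ⱽ : ∀ {d} → Vec Carrier d
  0ⱽ = replicate _ 0#

  dot : ∀ {d} → Vec Carrier d → Vec Carrier d → Carrier
  dot x y = foldrⱽ _+_ 0# (zipWith _*_ x y)

  polar : ∀ {d} → (Vec Carrier d → Carrier) → Vec Carrier d → Vec Carrier d → Carrier
  polar Q x y = Q (x +ⱽ y) - Q x - Q y

-- Only used for odd q, where 1 + 1 is invertible.
record QuadraticSpace (q d : ℕ) : Set₁ where
  field
    𝔽 : FiniteField q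

  open FiniteField 𝔽
  open Vectors 𝔽

  Point : Set
  Point = Vec Carrier d

  field
    Q           : Point → Carrier
    homogeneous : ∀ a x → Q (a · x) ≡ a * a * Q x
    polar-+     : ∀ x y z → polar Q (x +ⱽ y) z ≡ polar Q x z + polar Q y z
    polar-·     : ∀ a x y → polar Q (a · x) y ≡ a * polar Q x y

  ⟪_,_⟫ : Point → Point → Carrier
  ⟪ x , y ⟫ = polar Q x y * ((1# + 1#) ⁻¹)

  field
    nondegenerate : ∀ x → (∀ y → ⟪ x , y ⟫ ≡ 0#) → x ≡ 0ⱽ

module Geometry {q d} (V : QuadraticSpace q d) where
  open QuadraticSpace V public
  open FiniteField 𝔽 public
  open Vectors 𝔽 public

  Sphere : Set
  Sphere = Point × Carrier

  centre : Sphere → Point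
  centre = proj₁

  radius : Sphere → Carrier
  radius = proj₂

  incident : Subset Point → Subset Sphere → Subset (Point × Sphere)
  incident A T =
    ⟨ (λ (p , s) → (p ∈ A × s ∈ T) × Q (p -ⱽ centre s) ≡ radius s)
    ∣ (λ (p , s) → ((p ∈? A) ×-dec (s ∈? T)) ×-dec (Q (p -ⱽ centre s) ≟ radius s)) ⟩

  σ : Subset Point → Subset Sphere → ℚ
  σ A T = (+ ∣ incident A T ∣ ℚ./ 1) ℚ.- (ℚ._/_ (+ (∣ A ∣ ℕ.* ∣ T ∣)) q {{nonZero}})

  OneNonzeroRadius : Subset Sphere → Set
  OneNonzeroRadius T = ∃[ r ] r ≢ 0# × (∀ s → s ∈ T → radius s ≡ r)

  -- {x : a · x = b}; an affine hyperplane when a ≢ 0ⱽ.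
  hyperplane : Point → Carrier → Subset Point
  hyperplane a b = ⟨ (λ x → dot a x ≡ b) ∣ (λ x → dot a x ≟ b) ⟩

  maxHyperplane : Subset Point → ℕ
  maxHyperplane P = max 0
    (map (λ (a , b) → ∣ P ∩ hyperplane a b ∣)
         (filter (λ (a , b) → ¬? (a ≟ 0ⱽ)) (elements {X = Point × Carrier})))

  record Flat : Set₁ where
    field
      base      : Point
      direction : Subset Point
      0-closed  : 0ⱽ ∈ direction
      +-closed  : ∀ x y → x ∈ direction → y ∈ direction → x +ⱽ y ∈ direction
      ·-closed  : ∀ a x → x ∈ direction → a · x ∈ direction

    points : Subset Point
    points = ⟨ (λ x → x -ⱽ base ∈ direction) ∣ (λ x → x -ⱽ base ∈? direction) ⟩

    Proper : Set
    Proper = ∃[ x ] x ∉ points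

    TotallySingular : Set
    TotallySingular = ∀ x → x ∈ direction → Q x ≡ 0#

record BlockSystem {q d} (V : QuadraticSpace q d) : Set₁ where
  open Geometry V
  field
    v w         : Point
    v≢0         : v ≢ 0ⱽ
    Qv≡0        : Q v ≡ 0#
    ⟪w,v⟫≡1     : ⟪ w , v ⟫ ≡ 1#
    R           : Carrier
    R≢0         : R ≢ 0#
    represented : ∃[ y ] ⟪ y , v ⟫ ≡ 0# × Q y ≡ R
    Z           : Subset Carrier
    Z-nonempty  : ∃[ z ] z ∈ Z

  X_R : Subset Point
  X_R = ⟨ (λ y → ⟪ y , v ⟫ ≡ 0# × Q y ≡ R) ∣ (λ y → (⟪ y , v ⟫ ≟ 0#) ×-dec (Q y ≟ R)) ⟩

  c : Carrier → Point
  c z = z · w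

  A : Carrier → Subset Point
  A z = ⟨ (λ x → x -ⱽ c z ∈ X_R) ∣ (λ x → x -ⱽ c z ∈? X_R) ⟩

  𝒮[_] : Carrier → Subset Sphere
  𝒮[ z ] = ⟨ (λ s → ∃[ u ] s ≡ (c z +ⱽ u · v , R)) ∣ (λ s → ∃? λ u → s ≟ (c z +ⱽ u · v , R)) ⟩

  P : Subset Point
  P = ⟨ (λ x → ∃[ z ] z ∈ Z × x ∈ A z) ∣ (λ x → ∃? λ z → (z ∈? Z) ×-dec (x ∈? A z)) ⟩

  𝒮 : Subset Sphere
  𝒮 = ⟨ (λ s → ∃[ z ] z ∈ Z × s ∈ 𝒮[ z ]) ∣ (λ s → ∃? λ z → (z ∈? Z) ×-dec (s ∈? 𝒮[ z ])) ⟩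

  blocks : ℕ
  blocks = ∣ Z ∣

  CrossBlocksVanish : Set
  CrossBlocksVanish = ∀ b z → b ∈ Z → z ∈ Z → b ≢ z → σ (A b) 𝒮[ z ] ≡ 0ℚ

  record ExactCentredBlocks : Set where
    field
      disjoint-A  : ∀ b z → b ∈ Z → z ∈ Z → b ≢ z → Disjoint (A b) (A z)
      disjoint-𝒮  : ∀ b z → b ∈ Z → z ∈ Z → b ≢ z → Disjoint 𝒮[ b ] 𝒮[ z ]
      cross-block : CrossBlocksVanish
      total       : σ P 𝒮 ≡ ∑[ Z ] λ z → σ (A z) 𝒮[ z ]

module Surplus {{𝓡 : RealNumbers}} {q d} (V : QuadraticSpace q d) where
  open Geometry V
  private instance
    q≢0 : NonZero q
    q≢0 = nonZero

  scale : Subset Point → Subset Sphere → ℝ⁺ → ℝ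
  scale P T K = value K *ᴿ halfPower q d *ᴿ √ℕ (∣ P ∣ ℕ.* ∣ T ∣)

  IsK* : Subset Point → Subset Sphere → ℝ⁺ → Set
  IsK* P T K = ι (σ P T) ≈ᴿ scale P T K

  FixedScaleSurplus : Subset Point → Subset Sphere → ℝ⁺ → Set
  FixedScaleSurplus P T K = scale P T K ≤ᴿ ι (σ P T)

  WindowUpper : ℝ → Subset Sphere → ℝ⁺ → Set
  WindowUpper C₁ T K = fromℕ ∣ T ∣ ≤ᴿ C₁ *ᴿ value K *ᴿ halfPower q d

  ModerateWindow : ℝ → Subset Point → Subset Sphere → ℝ⁺ → Set
  ModerateWindow C₁ P T K =
    (fromℕ (4 ℕ.* ∣ P ∣) /ᴿ (K *⁺ K *⁺ fromℕ⁺ (q ℕ.^ (d ∸ 1)) {{ℕ.m^n≢0 q (d ∸ 1)}}) ≤ᴿ fromℕ ∣ T ∣)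
    × WindowUpper C₁ T K

  threshold : ℝ⁺ → ℝ → ℝ⁺ → Subset Point → ℝ
  threshold c C K P = value c *ᴿ value (K ^ᴿ (-ᴿ C)) *ᴿ fromℕ ∣ P ∣

  -- "Fixed-scale surplus and the moderate window imply |P ∩ H| ≥ c K^(-C) |P| for
  -- some affine hyperplane H", over the given space and for a single nonzero radius.
  LowerBoundFollows : ℝ → ℝ⁺ → ℝ → Set₁
  LowerBoundFollows C₁ c C =
    (P : Subset Point) (T : Subset Sphere) (K : ℝ⁺) →
    OneNonzeroRadius T → FixedScaleSurplus P T K → ModerateWindow C₁ P T K →
    ∃₂ λ a b → a ≢ 0ⱽ × threshold c C K P ≤ᴿ fromℕ ∣ P ∩ hyperplane a b ∣

module Claims {{𝓡 : RealNumbers}} {q d} {V : QuadraticSpace q d} (B : BlockSystem V) where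
  open Geometry V
  open BlockSystem B hiding (c)
  open Surplus V
  private instance
    q≢0 : NonZero q
    q≢0 = nonZero

  StarConstant : ℝ⁺ → Set
  StarConstant K = IsK* P 𝒮 K

  WindowLower : ℝ⁺ → Set
  WindowLower K = fromℕ (4 ℕ.* q) /ᴿ (K *⁺ K) ≤ᴿ fromℕ ∣ 𝒮 ∣

  Window : ℝ → ℝ⁺ → Set
  Window C₁ K = WindowLower K × WindowUpper C₁ 𝒮 K

  OneRadius : Set
  OneRadius = OneNonzeroRadius 𝒮

  -- max_H |P ∩ H| / |P| < ε; P is nonempty by construction.
  MaxHyperplaneRatioBelow : ℝ⁺ → Set
  MaxHyperplaneRatioBelow ε = fromℕ (maxHyperplane P) <ᴿ value ε *ᴿ fromℕ ∣ P ∣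

  -- |P ∩ H| < c K^(-C) |P| for every affine hyperplane H
  HyperplanesBelow : ℝ⁺ → ℝ → ℝ⁺ → Set
  HyperplanesBelow c C K =
    ∀ a b → a ≢ 0ⱽ → fromℕ ∣ P ∩ hyperplane a b ∣ <ᴿ threshold c C K P

  ProperFlatsBelow : ℝ⁺ → Set₁
  ProperFlatsBelow δ = (L : Flat) → Flat.Proper L →
    fromℕ ∣ P ∩ Flat.points L ∣ ≤ᴿ value δ *ᴿ fromℕ ∣ P ∣

  TotallySingularFlatsBelow : ℝ⁺ → Set₁
  TotallySingularFlatsBelow δ = (L : Flat) → Flat.TotallySingular L →
    fromℕ ∣ P ∩ Flat.points L ∣ ≤ᴿ value δ *ᴿ fromℕ ∣ P ∣

  TernaryValue : ℝ⁺ → Set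
  TernaryValue K = value K ≈ᴿ (1ᴿ -ᴿ inv (fromℕ⁺ q)) *ᴿ √ℕ 2

  TernaryWindow : ℕ → ℝ → ℝ⁺ → Set
  TernaryWindow t C₁ K =
    WindowLower K × ∣ 𝒮 ∣ ≡ t ℕ.* q × fromℕ (t ℕ.* q) ≤ᴿ C₁ *ᴿ value K *ᴿ fromℕ q

  EqualShares : (t : ℕ) .{{_ : NonZero t}} → Set
  EqualShares t = ∀ z → z ∈ Z → σ (A z) 𝒮[ z ] ≡ (+ 1 ℚ./ t) ℚ.* σ P 𝒮

open BlockSystem public using (blocks; CrossBlocksVanish; ExactCentredBlocks)
open Claims public
open Surplus public using (LowerBoundFollows)

OddPrimePower : ℕ → Set
OddPrimePower q = ¬ (2 ∣ q) × ∃₂ λ p k → Prime p × 1 ≤ k × q ≡ p ℕ.^ k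

-- Φ V for every nondegenerate quadratic space of dimension d over a field whose
-- order q ≥ N is an odd prime power.
ForAllFrom : ∀ {a : Level} (d N : ℕ) → (∀ {q} → QuadraticSpace q d → Set a) → Set (lsuc 0ℓ Level.⊔ a)
ForAllFrom d N Φ = ∀ q → N ≤ q → OddPrimePower q → (V : QuadraticSpace q d) → Φ V

ForAllLarge : ∀ {a : Level} (d : ℕ) → (∀ {q} → QuadraticSpace q d → Set a) → Set (lsuc 0ℓ Level.⊔ a)
ForAllLarge d Φ = ∃[ N ] ForAllFrom d N Φ

-- A choice of block system in every nondegenerate quadratic space of dimension d
-- over F_q, for all sufficiently large odd prime powers q.
Family : ℕ → Set₁
Family d = ForAllLarge d BlockSystem

module _ {d} (𝓑 : Family d) where
  Always : (∀ {q} {V : QuadraticSpace q d} → BlockSystem V → Set) → Set₁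
  Always Φ = ∀ q q₀≤q opp V → Φ (proj₂ 𝓑 q q₀≤q opp V)

  Eventually : ∀ {a : Level} → (∀ {q} {V : QuadraticSpace q d} → BlockSystem V → Set a) →
               Set (lsuc 0ℓ Level.⊔ a)
  Eventually Φ = ∃[ N ] ∀ q q₀≤q opp V → N ≤ q → Φ (proj₂ 𝓑 q q₀≤q opp V)

{-# OPTIONS --safe #-}

-- For p = b w + y in the block A_b, Q (p − z w − u v) = Q (p − z w) − 2 u (b − z): for
-- b = z every incidence occurs, while for b ≠ z exactly one u solves the equation.  With
-- n = |X_R| this gives |P| = n t, |𝒮| = q t and σ(P, 𝒮) = n t (q − 1), whence
-- K_*² q^d = n (q − 1)².  For d ≥ 4 a pigeonhole over the radii provides R ≠ 0 with
-- n ≥ q^(d−2) / 2, and n ≤ 2 q^(d−2) because a line in an anisotropic direction meets a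
-- sphere at most twice; so 1/2 ≤ K_* ≤ 2, and t ≈ √q / 2 fits the window.
--
-- A proper flat L either is a level set of ⟨·, v⟩, and then meets one block only, or cuts
-- each hyperplane z w + v⊥ in a proper section.  On the latter the sphere has density at
-- most 2/q, unless the directions E of the section are totally singular and orthogonal to
-- the vector y from the centre to a point; then E is independent of three further
-- vectors, so E itself has codimension at least 3.  Altogether |P ∩ L| t ≤ 4 |P|.
--
-- For d = 3, X_R with R = Q y consists of the points a v ± y, so n = 2 q exactly.

module Submission where

open import Defs
open import Algebra.Bundles using (CommutativeRing)
import Algebra.Morphism.Structures
import Algebra.Properties.Ring
import Algebra.Properties.Semiring.Mult.TCOptimised
import Algebra.Solver.Ring
open import Algebra.Solver.Ring.AlmostCommutativeRing using (fromCommutativeRing; _-Raw-AlmostCommutative⟶_)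
open import Data.Empty using (⊥-elim)
open import Data.Fin.Base using (toℕ; Fin; zero; suc; fromℕ<; inject≤)
import Data.Fin.Properties as Fin
import Data.Integer.Base as ℤ
open import Data.Integer.Base using (ℤ)
import Data.Integer.Properties as ℤ
open import Data.List.Base using (List; []; _∷_; length; map; filter; foldr; allFin)
open import Data.List.Extrema.Nat using (max≤v⁺)
open import Data.List.Membership.Propositional using () renaming (_∈_ to _∈ˡ_)
open import Data.List.Membership.Propositional.Properties using (∈-filter⁺; ∈-filter⁻; ∈-allFin)
open import Data.List.Properties using (length-tabulate)
import Data.List.Relation.Unary.All as All
open import Data.List.Relation.Unary.All using ([]; _∷_)
import Data.List.Relation.Unary.All.Properties as All
open import Data.List.Relation.Unary.AllPairs using ([]; _∷_)
open import Data.List.Relation.Unary.Any using (here; there)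
open import Data.List.Relation.Unary.Unique.Propositional using (Unique)
import Data.List.Relation.Unary.Unique.Propositional.Properties as Unique
open import Data.Maybe.Base using (Maybe; just; nothing)
import Data.Nat.Base as ℕ
open import Data.Nat.Base using (ℕ; zero; suc; NonZero; _≤_; _<_; z≤n; s≤s; _∸_)
import Data.Nat.Coprimality as Coprime
import Data.Nat.DivMod as ℕ
open import Data.Nat.Divisibility using (_∣_; divides)
open import Data.Nat.ListAction using (sum)
import Data.Nat.Properties as ℕ
open import Data.Nat.Tactic.RingSolver using (solve-∀)
open import Data.Product using (Σ; Σ-syntax; ∃-syntax; ∃₂; _×_; _,_; proj₁; proj₂)
import Data.Rational.Base as ℚ
open import Data.Rational.Base using (ℚ; mkℚ; 0ℚ)
import Data.Rational.Properties as ℚ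
import Data.Rational.Unnormalised.Base as ℚᵘ
import Data.Rational.Unnormalised.Properties as ℚᵘ
open import Data.Sum.Base using (_⊎_; inj₁; inj₂)
open import Data.Unit.Base using (⊤; tt)
import Data.Vec.Base as Vec
open import Data.Vec.Base using (Vec; []; _∷_; lookup)
open import Data.Vec.Properties using (lookup-map; lookup-replicate; ∷-injectiveˡ; ∷-injectiveʳ)
open import Function.Base using (_∘_; id)
open import Function.Bundles using (Inverse)
open import Level using (0ℓ)
open import Relation.Binary.PropositionalEquality using (_≡_; _≢_; refl; sym; trans; cong; cong₂; subst; module ≡-Reasoning; subst₂)
import Relation.Binary.Reasoning.Setoid
open import Relation.Nullary.Decidable using (Dec; yes; no; _×-dec_; ¬?; decidable-stable)
open import Relation.Nullary.Negation using (¬_; contradiction)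

-- Counting in finite types

-- Linear algebra enters through counting: independence of directions is an injection into the
-- space, and codimension is read off from cardinalities. For d ≥ 4 no exact point count of a
-- quadric is needed; a factor two on either side is affordable because K_* only has to stay in a
-- fixed interval. The number of blocks is squeezed from two sides. A level set of ⟨·, v⟩ can hold a
-- whole block, 1/t of P, while c K_*^(-C) stays away from zero, so t must grow. The window with C₁
-- = 1 asks for q t ≤ K_* q^((d-1)/2), which for d = 4 and K_* = 1/2 is t ≤ √q / 2. For d = 3 the
-- upper window reads t ≤ C₁ K_*, so t cannot grow; K_* approaches √2 from below, hence the strict
-- C₁ > t/√2 and large q, and n must be exact because K_* itself is asked for. The order on the
-- reals is constructive and real powers are known by their laws alone. Bounds on K_* are therefore
-- squared: K_*² = a / b with natural numbers a and b, and they become inequalities in n, t and q.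

𝟙 : {P : Set} → Dec P → ℕ
𝟙 (yes _) = 1
𝟙 (no _)  = 0

𝟙-× : {P Q : Set} (p : Dec P) (q : Dec Q) → 𝟙 (p ×-dec q) ≡ 𝟙 p ℕ.* 𝟙 q
𝟙-× (yes _) (yes _) = refl
𝟙-× (yes _) (no _)  = refl
𝟙-× (no _)  (yes _) = refl
𝟙-× (no _)  (no _)  = refl

total : ∀ {X} {{_ : Finite X}} → (X → ℕ) → ℕ
total f = sum (map f elements)

module _ {X : Set} where
  sum-cong : ∀ {f g : X → ℕ} → (∀ x → f x ≡ g x) → ∀ xs → sum (map f xs) ≡ sum (map g xs)
  sum-cong f≗g []       = refl
  sum-cong f≗g (x ∷ xs) = cong₂ ℕ._+_ (f≗g x) (sum-cong f≗g xs)

  sum-mono : ∀ {f g : X → ℕ} → (∀ x → f x ≤ g x) → ∀ xs → sum (map f xs) ≤ sum (map g xs)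
  sum-mono f≤g []       = z≤n
  sum-mono f≤g (x ∷ xs) = ℕ.+-mono-≤ (f≤g x) (sum-mono f≤g xs)

  sum-+ : ∀ (f g : X → ℕ) xs → sum (map (λ x → f x ℕ.+ g x) xs) ≡ sum (map f xs) ℕ.+ sum (map g xs)
  sum-+ f g []       = refl
  sum-+ f g (x ∷ xs) rewrite sum-+ f g xs =
    interchange (f x) (g x) (sum (map f xs)) (sum (map g xs))
    where
    interchange : ∀ a b c d → (a ℕ.+ b) ℕ.+ (c ℕ.+ d) ≡ (a ℕ.+ c) ℕ.+ (b ℕ.+ d)
    interchange = solve-∀

  sum-* : ∀ k (f : X → ℕ) xs → sum (map (λ x → k ℕ.* f x) xs) ≡ k ℕ.* sum (map f xs)
  sum-* k f []       = sym (ℕ.*-zeroʳ k)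
  sum-* k f (x ∷ xs) rewrite sum-* k f xs = sym (ℕ.*-distribˡ-+ k (f x) _)

  sum-zero : ∀ (xs : List X) → sum (map (λ _ → 0) xs) ≡ 0
  sum-zero []       = refl
  sum-zero (x ∷ xs) = sum-zero xs

  length-filter-sum : ∀ {P : X → Set} (P? : ∀ x → Dec (P x)) xs →
                      length (filter P? xs) ≡ sum (map (𝟙 ∘ P?) xs)
  length-filter-sum P? []       = refl
  length-filter-sum P? (x ∷ xs) with P? x
  ... | yes _ = cong suc (length-filter-sum P? xs)
  ... | no  _ = length-filter-sum P? xs

module _ {X Y : Set} where
  sum-swap : ∀ (f : X → Y → ℕ) xs ys →
             sum (map (λ x → sum (map (f x) ys)) xs) ≡ sum (map (λ y → sum (map (λ x → f x y) xs)) ys)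
  sum-swap f []       ys = sym (sum-zero ys)
  sum-swap f (x ∷ xs) ys = trans (cong (sum (map (f x) ys) ℕ.+_) (sum-swap f xs ys))
    (sym (sum-+ (f x) (λ y → sum (map (λ x → f x y) xs)) ys))

module _ {X : Set} {{fin : Finite X}} where
  ∣∣≡total : (A : Subset X) → ∣ A ∣ ≡ total (λ x → 𝟙 (x ∈? A))
  ∣∣≡total A = length-filter-sum (_∈? A) elements

  total-* : ∀ k (f : X → ℕ) → total (λ x → k ℕ.* f x) ≡ k ℕ.* total f
  total-* k f = sum-* k f elements

  total-indicator : ∀ k (A : Subset X) → total (λ x → k ℕ.* 𝟙 (x ∈? A)) ≡ k ℕ.* ∣ A ∣
  total-indicator k A = trans (total-* k _) (cong (k ℕ.*_) (sym (∣∣≡total A)))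

  ⊆⇒∣∣≤ : (A B : Subset X) → (∀ x → x ∈ A → x ∈ B) → ∣ A ∣ ≤ ∣ B ∣
  ⊆⇒∣∣≤ A B A⊆B rewrite ∣∣≡total A | ∣∣≡total B = sum-mono 𝟙-mono elements
    where
    𝟙-mono : ∀ x → 𝟙 (x ∈? A) ≤ 𝟙 (x ∈? B)
    𝟙-mono x with x ∈? A | x ∈? B
    ... | no _    | _       = z≤n
    ... | yes _   | yes _   = ℕ.≤-refl
    ... | yes x∈A | no x∉B  = contradiction (A⊆B x x∈A) x∉B

  ≐⇒∣∣≡ : (A B : Subset X) → (∀ x → x ∈ A → x ∈ B) → (∀ x → x ∈ B → x ∈ A) → ∣ A ∣ ≡ ∣ B ∣
  ≐⇒∣∣≡ A B A⊆B B⊆A = ℕ.≤-antisym (⊆⇒∣∣≤ A B A⊆B) (⊆⇒∣∣≤ B A B⊆A)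

  member-filter : (A : Subset X) → ∀ {x} → x ∈ˡ filter (_∈? A) elements → x ∈ A
  member-filter A = proj₂ ∘ ∈-filter⁻ (_∈? A) {xs = elements}

  filter-unique : (A : Subset X) → Unique (filter (_∈? A) elements)
  filter-unique A = Unique.filter⁺ (_∈? A) (Finite.unique fin)

  ∅⇒∣∣≡0 : (A : Subset X) → (∀ x → x ∉ A) → ∣ A ∣ ≡ 0
  ∅⇒∣∣≡0 A A-empty with filter (_∈? A) elements | member-filter A
  ... | []    | _   = refl
  ... | x ∷ _ | mem = contradiction (mem (here refl)) (A-empty x)

  ∈⇒0<∣∣ : (A : Subset X) → ∀ {x} → x ∈ A → 0 < ∣ A ∣
  ∈⇒0<∣∣ A {x} x∈A with filter (_∈? A) elements | ∈-filter⁺ (_∈? A) (Finite.complete fin x) x∈A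
  ... | _ ∷ _ | _ = s≤s z≤n

  0<∣∣⇒∈ : (A : Subset X) → 0 < ∣ A ∣ → ∃[ x ] x ∈ A
  0<∣∣⇒∈ A 0<∣A∣ with filter (_∈? A) elements | member-filter A
  ... | x ∷ _ | mem = x , mem (here refl)

  ∣∣≤1 : (A : Subset X) → (∀ x y → x ∈ A → y ∈ A → x ≡ y) → ∣ A ∣ ≤ 1
  ∣∣≤1 A all≡ with filter (_∈? A) elements | member-filter A | filter-unique A
  ... | []        | _   | _                 = z≤n
  ... | _ ∷ []    | _   | _                 = ℕ.≤-refl
  ... | x ∷ y ∷ _ | mem | (x≢y ∷ _) ∷ _ =
    contradiction (all≡ x y (mem (here refl)) (mem (there (here refl)))) x≢y

  ∣∣≤2 : (A : Subset X) →
         (∀ x y z → x ∈ A → y ∈ A → z ∈ A → x ≢ y → x ≢ z → ¬ (y ≢ z)) → ∣ A ∣ ≤ 2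
  ∣∣≤2 A no-three with filter (_∈? A) elements | member-filter A | filter-unique A
  ... | []            | _   | _ = z≤n
  ... | _ ∷ []        | _   | _ = s≤s z≤n
  ... | _ ∷ _ ∷ []    | _   | _ = ℕ.≤-refl
  ... | x ∷ y ∷ z ∷ _ | mem | (x≢y ∷ x≢z ∷ _) ∷ (y≢z ∷ _) ∷ _ =
    ⊥-elim (no-three x y z (mem (here refl)) (mem (there (here refl)))
                     (mem (there (there (here refl)))) x≢y x≢z y≢z)

  2≤∣∣ : (A : Subset X) → ∀ {x y} → x ∈ A → y ∈ A → x ≢ y → 2 ≤ ∣ A ∣
  2≤∣∣ A {x} {y} x∈A y∈A x≢y = go (filter (_∈? A) elements)
    (∈-filter⁺ (_∈? A) (Finite.complete fin x) x∈A) (∈-filter⁺ (_∈? A) (Finite.complete fin y) y∈A)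
    where
    go : ∀ xs → x ∈ˡ xs → y ∈ˡ xs → 2 ≤ length xs
    go (_ ∷ [])    (here refl) (here refl) = contradiction refl x≢y
    go (_ ∷ _ ∷ _) _           _           = s≤s (s≤s z≤n)

  full : Subset X
  full = ⟨ (λ _ → ⊤) ∣ (λ _ → yes tt) ⟩

  total-δ : ∀ a → total (λ x → 𝟙 (a ≟ x)) ≡ 1
  total-δ a = trans (sym (∣∣≡total point)) (ℕ.≤-antisym
    (∣∣≤1 point λ x y a≡x a≡y → trans (sym a≡x) a≡y) (∈⇒0<∣∣ point refl))
    where
    point : Subset X
    point = ⟨ (a ≡_) ∣ (a ≟_) ⟩

  ∣full∣ : ∣ full ∣ ≡ length (elements {X})
  ∣full∣ = go (elements {X})
    where
    go : ∀ (xs : List X) → length (filter (_∈? full) xs) ≡ length xs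
    go []       = refl
    go (x ∷ xs) = cong suc (go xs)

module _ {X Y : Set} {{finX : Finite X}} {{finY : Finite Y}} where
  fibre : (A : Subset X) (f : X → Y) → Y → Subset X
  fibre A f y = ⟨ (λ x → x ∈ A × f x ≡ y) ∣ (λ x → (x ∈? A) ×-dec (f x ≟ y)) ⟩

  -- The indicators of f x = y sum to 1 over y; inserting this factor and exchanging the two sums
  -- produces the fibres.
  ∣∣≡∑fibres : (A : Subset X) (f : X → Y) → ∣ A ∣ ≡ total (λ y → ∣ fibre A f y ∣)
  ∣∣≡∑fibres A f = begin
    ∣ A ∣                                                   ≡⟨ ∣∣≡total A ⟩
    total (λ x → 𝟙 (x ∈? A))                                ≡⟨ sum-cong step elements ⟩
    total (λ x → total (λ y → 𝟙 (x ∈? fibre A f y)))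
      ≡⟨ sum-swap _ (elements {X}) (elements {Y}) ⟩
    total (λ y → total (λ x → 𝟙 (x ∈? fibre A f y)))
      ≡⟨ sum-cong (λ y → ∣∣≡total (fibre A f y)) elements ⟨
    total (λ y → ∣ fibre A f y ∣) ∎
    where
    open ≡-Reasoning
    step : ∀ x → 𝟙 (x ∈? A) ≡ total (λ y → 𝟙 (x ∈? fibre A f y))
    step x = begin
      𝟙 (x ∈? A)                               ≡⟨ ℕ.*-identityʳ _ ⟨
      𝟙 (x ∈? A) ℕ.* 1                         ≡⟨ cong (𝟙 (x ∈? A) ℕ.*_) (total-δ (f x)) ⟨
      𝟙 (x ∈? A) ℕ.* total (λ y → 𝟙 (f x ≟ y)) ≡⟨ total-* {Y} (𝟙 (x ∈? A)) _ ⟨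
      total (λ y → 𝟙 (x ∈? A) ℕ.* 𝟙 (f x ≟ y)) ≡⟨ sum-cong (λ y → 𝟙-× (x ∈? A) (f x ≟ y)) elements ⟨
      total (λ y → 𝟙 (x ∈? fibre A f y)) ∎

  module _ (A : Subset X) (B : Subset Y) (f : X → Y) (A→B : ∀ x → x ∈ A → f x ∈ B) where
    private
      empty-fibre : ∀ {y} → y ∉ B → ∣ fibre A f y ∣ ≡ 0
      empty-fibre y∉B = ∅⇒∣∣≡0 (fibre A f _) λ { x (x∈A , refl) → y∉B (A→B x x∈A) }

    fibres≤⇒∣∣≤ : ∀ k → (∀ y → y ∈ B → ∣ fibre A f y ∣ ≤ k) → ∣ A ∣ ≤ k ℕ.* ∣ B ∣
    fibres≤⇒∣∣≤ k ≤k = begin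
      ∣ A ∣                            ≡⟨ ∣∣≡∑fibres A f ⟩
      total (λ y → ∣ fibre A f y ∣)    ≤⟨ sum-mono bound elements ⟩
      total (λ y → k ℕ.* 𝟙 (y ∈? B))   ≡⟨ total-indicator k B ⟩
      k ℕ.* ∣ B ∣ ∎
      where
      open ℕ.≤-Reasoning
      bound : ∀ y → ∣ fibre A f y ∣ ≤ k ℕ.* 𝟙 (y ∈? B)
      bound y with y ∈? B
      ... | yes y∈B rewrite ℕ.*-identityʳ k = ≤k y y∈B
      ... | no  y∉B rewrite empty-fibre y∉B = z≤n

    fibres≡⇒∣∣≡ : ∀ k → (∀ y → y ∈ B → ∣ fibre A f y ∣ ≡ k) → ∣ A ∣ ≡ k ℕ.* ∣ B ∣
    fibres≡⇒∣∣≡ k ≡k = begin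
      ∣ A ∣                            ≡⟨ ∣∣≡∑fibres A f ⟩
      total (λ y → ∣ fibre A f y ∣)    ≡⟨ sum-cong exact elements ⟩
      total (λ y → k ℕ.* 𝟙 (y ∈? B))   ≡⟨ total-indicator k B ⟩
      k ℕ.* ∣ B ∣ ∎
      where
      open ≡-Reasoning
      exact : ∀ y → ∣ fibre A f y ∣ ≡ k ℕ.* 𝟙 (y ∈? B)
      exact y with y ∈? B
      ... | yes y∈B rewrite ℕ.*-identityʳ k = ≡k y y∈B
      ... | no  y∉B rewrite ℕ.*-zeroʳ k = empty-fibre y∉B

    injection⇒∣∣≤ : (∀ x y → x ∈ A → y ∈ A → f x ≡ f y → x ≡ y) → ∣ A ∣ ≤ ∣ B ∣
    injection⇒∣∣≤ inj = subst (∣ A ∣ ≤_) (ℕ.*-identityˡ _) (fibres≤⇒∣∣≤ 1 λ y _ →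
      ∣∣≤1 (fibre A f y) λ { x x′ (x∈A , fx≡y) (x′∈A , fx′≡y) → inj x x′ x∈A x′∈A (trans fx≡y (sym fx′≡y)) })

    bijection⇒∣∣≡ : (∀ x y → x ∈ A → y ∈ A → f x ≡ f y → x ≡ y) →
                    (∀ y → y ∈ B → ∃[ x ] x ∈ A × f x ≡ y) → ∣ A ∣ ≡ ∣ B ∣
    bijection⇒∣∣≡ inj surj = trans (fibres≡⇒∣∣≡ 1 λ y y∈B → ℕ.≤-antisym
      (∣∣≤1 (fibre A f y) λ { x x′ (x∈A , fx≡y) (x′∈A , fx′≡y) → inj x x′ x∈A x′∈A (trans fx≡y (sym fx′≡y)) })
      (∈⇒0<∣∣ (fibre A f y) (proj₂ (surj y y∈B)))) (ℕ.*-identityˡ _)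

  infixr 8 _⊗_
  _⊗_ : Subset X → Subset Y → Subset (X × Y)
  A ⊗ B = ⟨ (λ (x , y) → x ∈ A × y ∈ B) ∣ (λ (x , y) → (x ∈? A) ×-dec (y ∈? B)) ⟩

module _ {X Y : Set} {{finX : Finite X}} {{finY : Finite Y}} where
  ∣⊗∣ : (A : Subset X) (B : Subset Y) → ∣ A ⊗ B ∣ ≡ ∣ A ∣ ℕ.* ∣ B ∣
  ∣⊗∣ A B = trans (fibres≡⇒∣∣≡ (A ⊗ B) A proj₁ (λ _ → proj₁) ∣ B ∣ λ x x∈A →
      bijection⇒∣∣≡ (fibre (A ⊗ B) proj₁ x) B proj₂ (λ { _ ((_ , y∈B) , _) → y∈B })
        (λ { _ _ (_ , refl) (_ , refl) refl → refl })
        λ y y∈B → (x , y) , ((x∈A , y∈B) , refl) , refl)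
    (ℕ.*-comm ∣ B ∣ ∣ A ∣)

module _ {X : Set} {{fin : Finite X}} where
  private
    ∣∣+∣∣≡total : (A B : Subset X) → ∣ A ∣ ℕ.+ ∣ B ∣ ≡ total (λ x → 𝟙 (x ∈? A) ℕ.+ 𝟙 (x ∈? B))
    ∣∣+∣∣≡total A B = trans (cong₂ ℕ._+_ (∣∣≡total A) (∣∣≡total B)) (sym (sum-+ _ _ (elements {X})))

    ∣elements∣≡total : length (elements {X}) ≡ total {X} (λ _ → 1)
    ∣elements∣≡total = trans (sym (∣full∣ {X})) (∣∣≡total (full {X}))

  disjoint⇒∣∣+∣∣≤ : (A B : Subset X) → Disjoint A B → ∣ A ∣ ℕ.+ ∣ B ∣ ≤ length (elements {X})
  disjoint⇒∣∣+∣∣≤ A B A∩B=∅ rewrite ∣∣+∣∣≡total A B | ∣elements∣≡total = sum-mono ≤1 (elements {X})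
    where
    ≤1 : ∀ x → 𝟙 (x ∈? A) ℕ.+ 𝟙 (x ∈? B) ≤ 1
    ≤1 x with x ∈? A | x ∈? B
    ... | yes x∈A | yes x∈B = contradiction x∈B (A∩B=∅ x x∈A)
    ... | yes _   | no _    = ℕ.≤-refl
    ... | no _    | yes _   = ℕ.≤-refl
    ... | no _    | no _    = z≤n

  infix 9 _ᶜ
  _ᶜ : Subset X → Subset X
  A ᶜ = ⟨ _∉ A ∣ (λ x → ¬? (x ∈? A)) ⟩

  ∣∣+∣ᶜ∣ : (A : Subset X) → ∣ A ∣ ℕ.+ ∣ A ᶜ ∣ ≡ length (elements {X})
  ∣∣+∣ᶜ∣ A rewrite ∣∣+∣∣≡total A (A ᶜ) | ∣elements∣≡total = sum-cong ≡1 (elements {X})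
    where
    ≡1 : ∀ x → 𝟙 (x ∈? A) ℕ.+ 𝟙 (x ∈? A ᶜ) ≡ 1
    ≡1 x with x ∈? A
    ... | yes _ = refl
    ... | no  _ = refl

-- A ring solver with integer coefficients

-- Cancellation needs coefficients with a decidable equality that computes, hence ℤ.
module IntegerRingSolver {c ℓ} (R : CommutativeRing c ℓ) where
  open CommutativeRing R hiding (zero)
    renaming (refl to ≈-refl; sym to ≈-sym; trans to ≈-trans)
  open Algebra.Properties.Ring ring
  open Algebra.Properties.Semiring.Mult.TCOptimised semiring using (1+×; ×-homo-+; ×1-homo-*) renaming (_×_ to _×ᴿ_)
  open Relation.Binary.Reasoning.Setoid setoid

  fromℤ : ℤ → Carrier
  fromℤ (ℤ.+ n)    = n ×ᴿ 1#
  fromℤ ℤ.-[1+ n ] = - (suc n ×ᴿ 1#)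

  fromℤ-⊖ : ∀ m n → fromℤ (m ℤ.⊖ n) ≈ m ×ᴿ 1# - n ×ᴿ 1#
  fromℤ-⊖ m zero = ≈-sym (≈-trans (+-congˡ -0#≈0#) (+-identityʳ _))
  fromℤ-⊖ zero (suc n) = ≈-sym (+-identityˡ _)
  fromℤ-⊖ (suc m) (suc n) = begin
    fromℤ (suc m ℤ.⊖ suc n)           ≡⟨ cong fromℤ (ℤ.[1+m]⊖[1+n]≡m⊖n m n) ⟩
    fromℤ (m ℤ.⊖ n)                   ≈⟨ fromℤ-⊖ m n ⟩
    m ×ᴿ 1# - n ×ᴿ 1#                   ≈⟨ +-congʳ (+-identityʳ _) ⟨
    (m ×ᴿ 1# + 0#) - n ×ᴿ 1#            ≈⟨ +-congʳ (+-congˡ (-‿inverseʳ 1#)) ⟨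
    (m ×ᴿ 1# + (1# - 1#)) - n ×ᴿ 1#     ≈⟨ +-congʳ (+-assoc _ _ _) ⟨
    ((m ×ᴿ 1# + 1#) - 1#) - n ×ᴿ 1#     ≈⟨ +-assoc _ _ _ ⟩
    (m ×ᴿ 1# + 1#) + (- 1# - n ×ᴿ 1#)   ≈⟨ +-cong (+-comm _ _) (-‿+-comm 1# (n ×ᴿ 1#)) ⟩
    (1# + m ×ᴿ 1#) - (1# + n ×ᴿ 1#)     ≈⟨ +-cong (1+× m 1#) (-‿cong (1+× n 1#)) ⟨
    suc m ×ᴿ 1# - suc n ×ᴿ 1# ∎

  fromℤ-neg : ∀ i → fromℤ (ℤ.- i) ≈ - fromℤ i
  fromℤ-neg (ℤ.+ zero)  = ≈-sym -0#≈0#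
  fromℤ-neg (ℤ.+ suc n) = ≈-refl
  fromℤ-neg ℤ.-[1+ n ]  = ≈-sym (-‿involutive _)

  fromℤ-+ : ∀ i j → fromℤ (i ℤ.+ j) ≈ fromℤ i + fromℤ j
  fromℤ-+ (ℤ.+ m)    (ℤ.+ n)    = ×-homo-+ 1# m n
  fromℤ-+ (ℤ.+ m)    ℤ.-[1+ n ] = fromℤ-⊖ m (suc n)
  fromℤ-+ ℤ.-[1+ m ] (ℤ.+ n)    = ≈-trans (fromℤ-⊖ n (suc m)) (+-comm _ _)
  fromℤ-+ ℤ.-[1+ m ] ℤ.-[1+ n ] = begin
    - (suc (suc (m ℕ.+ n)) ×ᴿ 1#)      ≡⟨ cong (λ k → - (suc k ×ᴿ 1#)) (ℕ.+-suc m n) ⟨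
    - ((suc m ℕ.+ suc n) ×ᴿ 1#)        ≈⟨ -‿cong (×-homo-+ 1# (suc m) (suc n)) ⟩
    - (suc m ×ᴿ 1# + suc n ×ᴿ 1#)       ≈⟨ -‿+-comm _ _ ⟨
    - (suc m ×ᴿ 1#) - suc n ×ᴿ 1# ∎

  fromℤ-*+ : ∀ i n → fromℤ (i ℤ.* ℤ.+ n) ≈ fromℤ i * fromℤ (ℤ.+ n)
  fromℤ-*+ (ℤ.+ m) n = begin
    fromℤ (ℤ.+ m ℤ.* ℤ.+ n)               ≡⟨ cong fromℤ (ℤ.pos-* m n) ⟨
    (m ℕ.* n) ×ᴿ 1#                    ≈⟨ ×1-homo-* m n ⟩
    m ×ᴿ 1# * n ×ᴿ 1# ∎
  fromℤ-*+ ℤ.-[1+ m ] n = begin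
    fromℤ (ℤ.-[1+ m ] ℤ.* ℤ.+ n)          ≡⟨ cong fromℤ (ℤ.neg-distribˡ-* (ℤ.+ suc m) (ℤ.+ n)) ⟨
    fromℤ (ℤ.- (ℤ.+ suc m ℤ.* ℤ.+ n))     ≈⟨ fromℤ-neg (ℤ.+ suc m ℤ.* ℤ.+ n) ⟩
    - fromℤ (ℤ.+ suc m ℤ.* ℤ.+ n)         ≈⟨ -‿cong (fromℤ-*+ (ℤ.+ suc m) n) ⟩
    - (suc m ×ᴿ 1# * n ×ᴿ 1#)           ≈⟨ -‿distribˡ-* _ _ ⟩
    - (suc m ×ᴿ 1#) * n ×ᴿ 1# ∎

  fromℤ-* : ∀ i j → fromℤ (i ℤ.* j) ≈ fromℤ i * fromℤ j
  fromℤ-* i (ℤ.+ n) = fromℤ-*+ i n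
  fromℤ-* i ℤ.-[1+ n ] = begin
    fromℤ (i ℤ.* ℤ.-[1+ n ])            ≡⟨ cong fromℤ (ℤ.neg-distribʳ-* i (ℤ.+ suc n)) ⟨
    fromℤ (ℤ.- (i ℤ.* ℤ.+ suc n))       ≈⟨ fromℤ-neg (i ℤ.* ℤ.+ suc n) ⟩
    - fromℤ (i ℤ.* ℤ.+ suc n)           ≈⟨ -‿cong (fromℤ-*+ i (suc n)) ⟩
    - (fromℤ i * suc n ×ᴿ 1#)          ≈⟨ -‿distribʳ-* _ _ ⟩
    fromℤ i * - (suc n ×ᴿ 1#) ∎

  morphism : ℤ.+-*-rawRing -Raw-AlmostCommutative⟶ fromCommutativeRing R
  morphism = record
    { ⟦_⟧    = fromℤ
    ; +-homo = fromℤ-+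
    ; *-homo = fromℤ-*
    ; -‿homo = fromℤ-neg
    ; 0-homo = ≈-refl
    ; 1-homo = ≈-refl
    }

  private
    -- Distinct integers may still agree in positive characteristic, so `nothing` claims no
    -- inequality; it only keeps the solver from merging the two coefficients.
    weak≟ : ∀ i j → Maybe (fromℤ i ≈ fromℤ j)
    weak≟ i j with i ℤ.≟ j
    ... | yes refl = just ≈-refl
    ... | no _       = nothing

  open Algebra.Solver.Ring ℤ.+-*-rawRing (fromCommutativeRing R) morphism weak≟
    public using (solve; con; _:=_; _:+_; _:*_; _:-_; :-_)

∣Vec∣ : ∀ {X} {{_ : Finite X}} d → length (elements {Vec X d}) ≡ length (elements {X}) ℕ.^ d
∣Vec∣ zero = refl
∣Vec∣ {X} (suc d) = begin
  length (elements {Vec X (suc d)})                    ≡⟨ ∣full∣ {Vec X (suc d)} ⟨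
  ∣ full {Vec X (suc d)} ∣
    ≡⟨ bijection⇒∣∣≡ (full {X} ⊗ full {Vec X d}) full (λ (x , xs) → x ∷ xs) _
        (λ { _ _ _ _ refl → refl }) (λ { (x ∷ xs) _ → (x , xs) , _ , refl }) ⟨
  ∣ full {X} ⊗ full {Vec X d} ∣                        ≡⟨ ∣⊗∣ (full {X}) (full {Vec X d}) ⟩
  ∣ full {X} ∣ ℕ.* ∣ full {Vec X d} ∣
    ≡⟨ cong₂ ℕ._*_ (∣full∣ {X}) (trans (∣full∣ {Vec X d}) (∣Vec∣ {X} d)) ⟩
  length (elements {X}) ℕ.^ suc d ∎
  where open ≡-Reasoning

-- Arithmetic in a finite field

module FieldProperties {q} (𝔽 : FiniteField q) where
  open FiniteField 𝔽
  open Inverse enumeration using (to; strictlyInverseʳ)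

  ring : CommutativeRing 0ℓ 0ℓ
  ring = record { isCommutativeRing = isCommutativeRing }

  open CommutativeRing ring public
    using (+-identityˡ; +-identityʳ; *-identityˡ; *-identityʳ; zeroˡ; zeroʳ; *-comm; -‿inverseʳ)
  open IntegerRingSolver ring public using (solve; con; _:=_; _:+_; _:*_; _:-_; :-_)

  ∣Carrier∣ : length (elements {Carrier}) ≡ q
  ∣Carrier∣ = length-tabulate _

  ∣full-Carrier∣ : ∣ full {Carrier} ∣ ≡ q
  ∣full-Carrier∣ = trans (∣full∣ {Carrier}) ∣Carrier∣

  *-inverseˡ : ∀ x → x ≢ 0# → x ⁻¹ * x ≡ 1#
  *-inverseˡ x x≢0 = trans (*-comm _ _) (*-inverseʳ x x≢0)

  x≢0∧xy≡0⇒y≡0 : ∀ {x y} → x ≢ 0# → x * y ≡ 0# → y ≡ 0#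
  x≢0∧xy≡0⇒y≡0 {x} {y} x≢0 xy≡0 = begin
    y                ≡⟨ *-identityˡ y ⟨
    1# * y           ≡⟨ cong (_* y) (*-inverseˡ x x≢0) ⟨
    x ⁻¹ * x * y     ≡⟨ solve 3 (λ a b c → a :* b :* c := a :* (b :* c)) refl (x ⁻¹) x y ⟩
    x ⁻¹ * (x * y)   ≡⟨ cong (x ⁻¹ *_) xy≡0 ⟩
    x ⁻¹ * 0#        ≡⟨ zeroʳ _ ⟩
    0# ∎
    where open ≡-Reasoning

  *-≢0 : ∀ {x y} → x ≢ 0# → y ≢ 0# → x * y ≢ 0#
  *-≢0 x≢0 y≢0 xy≡0 = y≢0 (x≢0∧xy≡0⇒y≡0 x≢0 xy≡0)

  x-y≡0⇒x≡y : ∀ {x y} → x - y ≡ 0# → x ≡ y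
  x-y≡0⇒x≡y {x} {y} x-y≡0 = begin
    x            ≡⟨ solve 2 (λ x y → x := x :- y :+ y) refl x y ⟩
    x - y + y    ≡⟨ cong (_+ y) x-y≡0 ⟩
    0# + y       ≡⟨ +-identityˡ y ⟩
    y ∎
    where open ≡-Reasoning

  x≡y⇒x-y≡0 : ∀ {x y} → x ≡ y → x - y ≡ 0#
  x≡y⇒x-y≡0 {x} refl = -‿inverseʳ x

  +-cancelˡ : ∀ x {y z} → x + y ≡ x + z → y ≡ z
  +-cancelˡ x {y} {z} eq = x-y≡0⇒x≡y (trans
    (solve 3 (λ x y z → y :- z := x :+ y :- (x :+ z)) refl x y z) (x≡y⇒x-y≡0 eq))

  *-cancelʳ : ∀ {x y z} → z ≢ 0# → x * z ≡ y * z → x ≡ y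
  *-cancelʳ {x} {y} {z} z≢0 eq = x-y≡0⇒x≡y (x≢0∧xy≡0⇒y≡0 z≢0 (trans
    (solve 3 (λ x y z → z :* (x :- y) := x :* z :- y :* z) refl x y z) (x≡y⇒x-y≡0 eq)))

  -- Otherwise x ↦ x + 1 would pair off the elements of the field.
  1+1≢0 : ¬ (2 ∣ q) → 1# + 1# ≢ 0#
  1+1≢0 q-odd 1+1≡0 = q-odd (divides ∣ ascents ∣ (begin
    q                                     ≡⟨ ∣Carrier∣ ⟨
    length (elements {Carrier})           ≡⟨ ∣∣+∣ᶜ∣ ascents ⟨
    ∣ ascents ∣ ℕ.+ ∣ ascents ᶜ ∣
      ≡⟨ cong (∣ ascents ∣ ℕ.+_) (bijection⇒∣∣≡ ascents (ascents ᶜ) (_+ 1#)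
          ascent⇒descent (λ x y _ _ → +1-injective) λ y y∉ → y + 1# , descent⇒ascent y y∉ , +1+1 y) ⟨
    ∣ ascents ∣ ℕ.+ ∣ ascents ∣           ≡⟨ cong (∣ ascents ∣ ℕ.+_) (ℕ.+-identityʳ _) ⟨
    2 ℕ.* ∣ ascents ∣                     ≡⟨ ℕ.*-comm 2 ∣ ascents ∣ ⟩
    ∣ ascents ∣ ℕ.* 2 ∎))
    where
    open ≡-Reasoning
    rank : Carrier → ℕ
    rank x = toℕ (to x)

    rank-injective : ∀ {x y} → rank x ≡ rank y → x ≡ y
    rank-injective {x} {y} eq = trans (sym (strictlyInverseʳ x))
      (trans (cong (Inverse.from enumeration) (Fin.toℕ-injective eq)) (strictlyInverseʳ y))

    -- One element of each pair x, x + 1, singled out by the order that the enumeration induces; the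
    -- successor map exchanges these with their complement.
    ascents : Subset Carrier
    ascents = ⟨ (λ x → rank x < rank (x + 1#)) ∣ (λ x → rank x ℕ.<? rank (x + 1#)) ⟩

    +1+1 : ∀ x → x + 1# + 1# ≡ x
    +1+1 x = begin
      x + 1# + 1#     ≡⟨ solve 2 (λ x y → x :+ y :+ y := x :+ (y :+ y)) refl x 1# ⟩
      x + (1# + 1#)   ≡⟨ cong (x +_) 1+1≡0 ⟩
      x + 0#          ≡⟨ +-identityʳ x ⟩
      x ∎

    +1-injective : ∀ {x y} → x + 1# ≡ y + 1# → x ≡ y
    +1-injective {x} {y} eq = trans (sym (+1+1 x)) (trans (cong (_+ 1#) eq) (+1+1 y))

    x≢x+1 : ∀ x → x ≢ x + 1#
    x≢x+1 x eq = 0≢1 (begin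
      0#             ≡⟨ x≡y⇒x-y≡0 (sym eq) ⟨
      x + 1# - x     ≡⟨ solve 2 (λ x y → x :+ y :- x := y) refl x 1# ⟩
      1# ∎)

    ascent⇒descent : ∀ x → x ∈ ascents → x + 1# ∉ ascents
    ascent⇒descent x x< x+1< = ℕ.<-asym x< (subst (rank (x + 1#) <_) (cong rank (+1+1 x)) x+1<)

    descent⇒ascent : ∀ x → x ∉ ascents → x + 1# ∈ ascents
    descent⇒ascent x x≮ = subst (rank (x + 1#) <_) (sym (cong rank (+1+1 x)))
      (ℕ.≤∧≢⇒< (ℕ.≮⇒≥ x≮) (λ eq → x≢x+1 x (sym (rank-injective eq))))

  roots : (α β γ : Carrier) → Subset Carrier
  roots α β γ = ⟨ (λ s → α * (s * s) + β * s + γ ≡ 0#) ∣ (λ s → (α * (s * s) + β * s + γ) ≟ 0#) ⟩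

  -- Dividing the difference of two vanishing values by x - y leaves the chord condition α (x + y) +
  -- β = 0. Two chords through a common root force α = 0, and then one chord forces β = 0. The
  -- linear case α = 0 is included because isotropic directions in `line-bound` lead to it.
  ∣roots∣≤2 : ∀ α β γ → ¬ (α ≡ 0# × β ≡ 0#) → ∣ roots α β γ ∣ ≤ 2
  ∣roots∣≤2 α β γ nontrivial = ∣∣≤2 (roots α β γ) λ x y z fx fy fz x≢y x≢z y≢z →
    let α≡0 = x≢0∧xy≡0⇒y≡0 (y≢z ∘ x-y≡0⇒x≡y) (begin
          (y - z) * α                                    ≡⟨ solve 5 (λ α β x y z → (y :- z) :* α :=
                (α :* (x :+ y) :+ β) :- (α :* (x :+ z) :+ β)) refl α β x y z ⟩
          (α * (x + y) + β) - (α * (x + z) + β)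
            ≡⟨ cong₂ _-_ (chord x≢y fx fy) (chord x≢z fx fz) ⟩
          0# - 0#                                        ≡⟨ -‿inverseʳ 0# ⟩
          0# ∎)
        β≡0 = begin
          β                      ≡⟨ +-identityˡ β ⟨
          0# + β                 ≡⟨ cong (_+ β) (zeroˡ _) ⟨
          0# * (x + y) + β       ≡⟨ cong (λ a → a * (x + y) + β) α≡0 ⟨
          α * (x + y) + β        ≡⟨ chord x≢y fx fy ⟩
          0# ∎
    in nontrivial (α≡0 , β≡0)
    where
    open ≡-Reasoning
    chord : ∀ {x y} → x ≢ y → x ∈ roots α β γ → y ∈ roots α β γ → α * (x + y) + β ≡ 0#
    chord {x} {y} x≢y fx fy = x≢0∧xy≡0⇒y≡0 (x≢y ∘ x-y≡0⇒x≡y) (begin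
      (x - y) * (α * (x + y) + β)
        ≡⟨ solve 5 (λ α β γ x y → (x :- y) :* (α :* (x :+ y) :+ β) :=
            (α :* (x :* x) :+ β :* x :+ γ) :- (α :* (y :* y) :+ β :* y :+ γ)) refl α β γ x y ⟩
      (α * (x * x) + β * x + γ) - (α * (y * y) + β * y + γ)
        ≡⟨ x≡y⇒x-y≡0 (trans fx (sym fy)) ⟩
      0# ∎)

  private
    image : Carrier → Carrier → Subset Carrier
    image a c = ⟨ (λ r → ∃[ x ] a * (x * x) + c ≡ r) ∣ (λ r → ∃? λ x → (a * (x * x) + c) ≟ r) ⟩

  -- Pigeonhole: the values a x² and the values - b y² - c each fill more than half of the field, so
  -- the two sets meet. A value is taken at most twice, which gives at least half, and oddness of q
  -- makes the inequality strict.
  binary-form-represents : ¬ (2 ∣ q) → ∀ {a b} → a ≢ 0# → b ≢ 0# → ∀ c →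
                           ∃₂ λ x y → a * (x * x) + b * (y * y) + c ≡ 0#
  binary-form-represents q-odd {a} {b} a≢0 b≢0 c
    with ∃? (_∈? (image a 0# ∩ image (- b) (- c)))
  ... | yes (r , (x , eq) , (y , eq′)) = x , y , (begin
      a * (x * x) + b * (y * y) + c
        ≡⟨ solve 5 (λ a b c x y → a :* (x :* x) :+ b :* (y :* y) :+ c :=
            (a :* (x :* x) :+ con (ℤ.+ 0)) :- (:- b :* (y :* y) :+ :- c)) refl a b c x y ⟩
      (a * (x * x) + 0#) - (- b * (y * y) + - c)         ≡⟨ x≡y⇒x-y≡0 (trans eq (sym eq′)) ⟩
      0# ∎)
    where open ≡-Reasoning
  ... | no disjoint = ⊥-elim (ℕ.<-irrefl refl (begin-strict
      q ℕ.+ q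
        <⟨ ℕ.+-mono-< (half a≢0 0#) (half -b≢0 (- c)) ⟩
      2 ℕ.* ∣ image a 0# ∣ ℕ.+ 2 ℕ.* ∣ image (- b) (- c) ∣
        ≡⟨ ℕ.*-distribˡ-+ 2 ∣ image a 0# ∣ _ ⟨
      2 ℕ.* (∣ image a 0# ∣ ℕ.+ ∣ image (- b) (- c) ∣)
        ≤⟨ ℕ.*-monoʳ-≤ 2 (subst (∣ image a 0# ∣ ℕ.+ ∣ image (- b) (- c) ∣ ≤_) ∣Carrier∣ (disjoint⇒∣∣+∣∣≤ (image a 0#) (image (- b) (- c))
            λ r r∈ r∈′ → disjoint (r , r∈ , r∈′))) ⟩
      2 ℕ.* q
        ≡⟨ cong (q ℕ.+_) (ℕ.+-identityʳ q) ⟩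
      q ℕ.+ q ∎))
    where
    open ℕ.≤-Reasoning
    -b≢0 : - b ≢ 0#
    -b≢0 -b≡0 = b≢0 (trans (solve 1 (λ b → b := con (ℤ.+ 0) :- (:- b)) refl b) (x≡y⇒x-y≡0 (sym -b≡0)))

    half : ∀ {a} → a ≢ 0# → ∀ c → q < 2 ℕ.* ∣ image a c ∣
    half {a} a≢0 c = ℕ.≤∧≢⇒<
      (subst (_≤ 2 ℕ.* ∣ image a c ∣) ∣full-Carrier∣
        (fibres≤⇒∣∣≤ full (image a c) (λ x → a * (x * x) + c) (λ x _ → x , refl) 2 λ r _ →
          ℕ.≤-trans (⊆⇒∣∣≤ (fibre full (λ x → a * (x * x) + c) r) (roots a 0# (c - r)) λ { x (_ , refl) →
              solve 3 (λ a x c → a :* (x :* x) :+ con (ℤ.+ 0) :* x :+ (c :- (a :* (x :* x) :+ c)) := con (ℤ.+ 0)) refl a x c })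
            (∣roots∣≤2 a 0# (c - r) (a≢0 ∘ proj₁))))
      λ eq → q-odd (divides ∣ image a c ∣ (trans eq (ℕ.*-comm 2 ∣ image a c ∣)))

-- Identities in coordinate spaces

module VectorIdentities {q} (𝔽 : FiniteField q) where
  open FiniteField 𝔽
  open Vectors 𝔽
  open FieldProperties 𝔽

  +ⱽ-comm : ∀ {d} (x y : Vec Carrier d) → x +ⱽ y ≡ y +ⱽ x
  +ⱽ-comm []       []       = refl
  +ⱽ-comm (x ∷ xs) (y ∷ ys) = cong₂ _∷_ (solve 2 (λ x y → x :+ y := y :+ x) refl x y) (+ⱽ-comm xs ys)

  +ⱽ-identityˡ : ∀ {d} (x : Vec Carrier d) → 0ⱽ +ⱽ x ≡ x
  +ⱽ-identityˡ []       = refl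
  +ⱽ-identityˡ (x ∷ xs) = cong₂ _∷_ (+-identityˡ x) (+ⱽ-identityˡ xs)

  -ⱽ-as-+ⱽ : ∀ {d} (x y : Vec Carrier d) → x -ⱽ y ≡ x +ⱽ (- 1#) · y
  -ⱽ-as-+ⱽ []       []       = refl
  -ⱽ-as-+ⱽ (x ∷ xs) (y ∷ ys) = cong₂ _∷_
    (solve 2 (λ x y → x :- y := x :+ (:- con (ℤ.+ 1)) :* y) refl x y) (-ⱽ-as-+ⱽ xs ys)

  x+x : ∀ {d} (x : Vec Carrier d) → x +ⱽ x ≡ (1# + 1#) · x
  x+x []       = refl
  x+x (x ∷ xs) = cong₂ _∷_ (solve 1 (λ x → x :+ x := con (ℤ.+ 2) :* x) refl x) (x+x xs)

  0·x : ∀ {d} (x : Vec Carrier d) → 0# · x ≡ 0ⱽ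
  0·x []       = refl
  0·x (x ∷ xs) = cong₂ _∷_ (zeroˡ x) (0·x xs)

  a·0 : ∀ {d} a → a · 0ⱽ {d} ≡ 0ⱽ
  a·0 {zero}  a = refl
  a·0 {suc d} a = cong₂ _∷_ (zeroʳ a) (a·0 a)

  x-x : ∀ {d} (x : Vec Carrier d) → x -ⱽ x ≡ 0ⱽ
  x-x []       = refl
  x-x (x ∷ xs) = cong₂ _∷_ (-‿inverseʳ x) (x-x xs)

  [x-y]+y : ∀ {d} (x y : Vec Carrier d) → (x -ⱽ y) +ⱽ y ≡ x
  [x-y]+y []       []       = refl
  [x-y]+y (x ∷ xs) (y ∷ ys) = cong₂ _∷_ (solve 2 (λ x y → x :- y :+ y := x) refl x y) ([x-y]+y xs ys)

  [x+y]-y : ∀ {d} (x y : Vec Carrier d) → (x +ⱽ y) -ⱽ y ≡ x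
  [x+y]-y []       []       = refl
  [x+y]-y (x ∷ xs) (y ∷ ys) = cong₂ _∷_ (solve 2 (λ x y → x :+ y :- y := x) refl x y) ([x+y]-y xs ys)

  [x+ay]-z : ∀ {d} a (x y z : Vec Carrier d) → (x +ⱽ a · y) -ⱽ z ≡ (x -ⱽ z) +ⱽ a · y
  [x+ay]-z a []       []       []       = refl
  [x+ay]-z a (x ∷ xs) (y ∷ ys) (z ∷ zs) = cong₂ _∷_
    (solve 4 (λ a x y z → x :+ a :* y :- z := x :- z :+ a :* y) refl a x y z) ([x+ay]-z a xs ys zs)

  [x+ay]-ay : ∀ {d} a (x y : Vec Carrier d) → (x +ⱽ a · y) +ⱽ (- a) · y ≡ x
  [x+ay]-ay a []       []       = refl
  [x+ay]-ay a (x ∷ xs) (y ∷ ys) = cong₂ _∷_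
    (solve 3 (λ a x y → x :+ a :* y :+ (:- a) :* y := x) refl a x y) ([x+ay]-ay a xs ys)

  [x-ay]+ay : ∀ {d} a (x y : Vec Carrier d) → (x +ⱽ (- a) · y) +ⱽ a · y ≡ x
  [x-ay]+ay a []       []       = refl
  [x-ay]+ay a (x ∷ xs) (y ∷ ys) = cong₂ _∷_
    (solve 3 (λ a x y → x :+ (:- a) :* y :+ a :* y := x) refl a x y) ([x-ay]+ay a xs ys)

  x-0 : ∀ {d} (x : Vec Carrier d) → x -ⱽ 0ⱽ ≡ x
  x-0 []       = refl
  x-0 (x ∷ xs) = cong₂ _∷_ (solve 1 (λ x → x :- con (ℤ.+ 0) := x) refl x) (x-0 xs)

  [x-y]-[z-y] : ∀ {d} (x y z : Vec Carrier d) → (x -ⱽ y) -ⱽ (z -ⱽ y) ≡ x -ⱽ z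
  [x-y]-[z-y] []       []       []       = refl
  [x-y]-[z-y] (x ∷ xs) (y ∷ ys) (z ∷ zs) = cong₂ _∷_
    (solve 3 (λ x y z → (x :- y) :- (z :- y) := x :- z) refl x y z) ([x-y]-[z-y] xs ys zs)

  x-[y+az] : ∀ {d} a (x y z : Vec Carrier d) → x -ⱽ (y +ⱽ a · z) ≡ (x -ⱽ y) +ⱽ (- a) · z
  x-[y+az] a []       []       []       = refl
  x-[y+az] a (x ∷ xs) (y ∷ ys) (z ∷ zs) = cong₂ _∷_
    (solve 4 (λ a x y z → x :- (y :+ a :* z) := x :- y :+ (:- a) :* z) refl a x y z) (x-[y+az] a xs ys zs)

  x-y≡0ⱽ⇒x≡y : ∀ {d} {x y : Vec Carrier d} → x -ⱽ y ≡ 0ⱽ → x ≡ y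
  x-y≡0ⱽ⇒x≡y {x = x} {y} eq = trans (sym ([x-y]+y x y)) (trans (cong (_+ⱽ y) eq) (+ⱽ-identityˡ y))

  +ⱽ-cancelʳ : ∀ {d} {x y} (z : Vec Carrier d) → x +ⱽ z ≡ y +ⱽ z → x ≡ y
  +ⱽ-cancelʳ {x = x} {y} z eq = trans (sym ([x+y]-y x z)) (trans (cong (_-ⱽ z) eq) ([x+y]-y y z))

  +·-cancel : ∀ {d} {a b} {x y z : Vec Carrier d} → a ≡ b → x +ⱽ a · z ≡ y +ⱽ b · z → x ≡ y
  +·-cancel {a = a} {z = z} refl = +ⱽ-cancelʳ (a · z)

  -- Turns a coincidence of two parametrised points into a statement about directions: x - z is a
  -- multiple of y, which membership, a pairing or Q can then force to be zero.
  x+ay≡z+by⇒x-z : ∀ {d} {a b} {x y z : Vec Carrier d} → x +ⱽ a · y ≡ z +ⱽ b · y → x -ⱽ z ≡ (b - a) · y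
  x+ay≡z+by⇒x-z {x = []}     {[]}     {[]}     eq = refl
  x+ay≡z+by⇒x-z {a = a} {b} {x ∷ xs} {y ∷ ys} {z ∷ zs} eq = cong₂ _∷_ (begin
      x - z
        ≡⟨ solve 4 (λ a x y z → x :- z := (x :+ a :* y) :- z :- a :* y) refl a x y z ⟩
      (x + a * y) - z - a * y    ≡⟨ cong (λ s → s - z - a * y) (∷-injectiveˡ eq) ⟩
      (z + b * y) - z - a * y    ≡⟨ solve 4 (λ a b y z → (z :+ b :* y) :- z :- a :* y := (b :- a) :* y) refl a b y z ⟩
      (b - a) * y ∎)
    (x+ay≡z+by⇒x-z (∷-injectiveʳ eq))
    where open ≡-Reasoning

  ·-cancel : ∀ {d} {a} → a ≢ 0# → (x : Vec Carrier d) → a ⁻¹ · a · x ≡ x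
  ·-cancel a≢0 []       = refl
  ·-cancel {a = a} a≢0 (x ∷ xs) = cong₂ _∷_ (begin
      a ⁻¹ * (a * x)   ≡⟨ solve 3 (λ a b x → b :* (a :* x) := (b :* a) :* x) refl a (a ⁻¹) x ⟩
      (a ⁻¹ * a) * x   ≡⟨ cong (_* x) (*-inverseˡ a a≢0) ⟩
      1# * x           ≡⟨ *-identityˡ x ⟩
      x                ∎) (·-cancel a≢0 xs)
    where open ≡-Reasoning

-- Quadratic spaces over fields of odd order

module QuadraticProperties {q d} (V : QuadraticSpace q d) (q-odd : ¬ (2 ∣ q)) where
  open Geometry V
  open FieldProperties 𝔽
  open VectorIdentities 𝔽

  2# : Carrier
  2# = 1# + 1#

  2#≢0 : 2# ≢ 0#
  2#≢0 = 1+1≢0 q-odd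

  ⟪⟫-sym : ∀ x y → ⟪ x , y ⟫ ≡ ⟪ y , x ⟫
  ⟪⟫-sym x y = cong (_* 2# ⁻¹) (begin
    Q (x +ⱽ y) - Q x - Q y   ≡⟨ cong (λ z → Q z - Q x - Q y) (+ⱽ-comm x y) ⟩
    Q (y +ⱽ x) - Q x - Q y   ≡⟨ solve 3 (λ a b c → a :- b :- c := a :- c :- b) refl (Q (y +ⱽ x)) (Q x) (Q y) ⟩
    Q (y +ⱽ x) - Q y - Q x   ∎)
    where open ≡-Reasoning

  ⟪⟫-+·ˡ : ∀ x a y z → ⟪ x +ⱽ a · y , z ⟫ ≡ ⟪ x , z ⟫ + a * ⟪ y , z ⟫
  ⟪⟫-+·ˡ x a y z rewrite polar-+ x (a · y) z | polar-· a y z =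
    solve 4 (λ p a r h → (p :+ a :* r) :* h := p :* h :+ a :* (r :* h)) refl (polar Q x z) a (polar Q y z) (2# ⁻¹)

  ⟪⟫-·ˡ : ∀ a x z → ⟪ a · x , z ⟫ ≡ a * ⟪ x , z ⟫
  ⟪⟫-·ˡ a x z rewrite polar-· a x z = solve 3 (λ a p h → (a :* p) :* h := a :* (p :* h)) refl a (polar Q x z) (2# ⁻¹)

  ⟪⟫-·ʳ : ∀ a x z → ⟪ z , a · x ⟫ ≡ a * ⟪ z , x ⟫
  ⟪⟫-·ʳ a x z = trans (⟪⟫-sym z (a · x)) (trans (⟪⟫-·ˡ a x z) (cong (a *_) (⟪⟫-sym x z)))

  ⟪⟫-+ˡ : ∀ x y z → ⟪ x +ⱽ y , z ⟫ ≡ ⟪ x , z ⟫ + ⟪ y , z ⟫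
  ⟪⟫-+ˡ x y z rewrite polar-+ x y z =
    solve 3 (λ p r h → (p :+ r) :* h := p :* h :+ r :* h) refl (polar Q x z) (polar Q y z) (2# ⁻¹)

  ⟪⟫--ˡ : ∀ x y z → ⟪ x -ⱽ y , z ⟫ ≡ ⟪ x , z ⟫ - ⟪ y , z ⟫
  ⟪⟫--ˡ x y z = trans (cong (λ u → ⟪ u , z ⟫) (-ⱽ-as-+ⱽ x y)) (trans (⟪⟫-+·ˡ x (- 1#) y z)
    (solve 2 (λ p r → p :+ (:- con (ℤ.+ 1)) :* r := p :- r) refl ⟪ x , z ⟫ ⟪ y , z ⟫))

  ⟪⟫-zeroˡ : ∀ x → ⟪ 0ⱽ , x ⟫ ≡ 0#
  ⟪⟫-zeroˡ x = trans (cong (λ o → ⟪ o , x ⟫) (sym (0·x 0ⱽ))) (trans (⟪⟫-·ˡ 0# 0ⱽ x) (zeroˡ _))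

  2⟪⟫≡polar : ∀ x y → 2# * ⟪ x , y ⟫ ≡ polar Q x y
  2⟪⟫≡polar x y = begin
    2# * (polar Q x y * 2# ⁻¹)    ≡⟨ solve 3 (λ t p h → t :* (p :* h) := t :* h :* p) refl 2# (polar Q x y) (2# ⁻¹) ⟩
    2# * 2# ⁻¹ * polar Q x y      ≡⟨ cong (_* polar Q x y) (*-inverseʳ 2# 2#≢0) ⟩
    1# * polar Q x y              ≡⟨ *-identityˡ _ ⟩
    polar Q x y ∎
    where open ≡-Reasoning

  Q-+ : ∀ x y → Q (x +ⱽ y) ≡ Q x + 2# * ⟪ x , y ⟫ + Q y
  Q-+ x y = trans (solve 3 (λ s a b → s := a :+ (s :- a :- b) :+ b) refl (Q (x +ⱽ y)) (Q x) (Q y))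
    (cong (λ p → Q x + p + Q y) (sym (2⟪⟫≡polar x y)))

  Q-+· : ∀ x a y → Q (x +ⱽ a · y) ≡ Q x + 2# * (a * ⟪ x , y ⟫) + a * a * Q y
  Q-+· x a y = trans (Q-+ x (a · y)) (cong₂ (λ b c → Q x + 2# * b + c) (⟪⟫-·ʳ a y x) (homogeneous a y))

  ⟪x,x⟫≡Qx : ∀ x → ⟪ x , x ⟫ ≡ Q x
  ⟪x,x⟫≡Qx x = begin
    polar Q x x * 2# ⁻¹                       ≡⟨ cong (λ y → (Q y - Q x - Q x) * 2# ⁻¹) (x+x x) ⟩
    (Q (2# · x) - Q x - Q x) * 2# ⁻¹
      ≡⟨ cong (λ r → (r - Q x - Q x) * 2# ⁻¹) (homogeneous 2# x) ⟩
    (2# * 2# * Q x - Q x - Q x) * 2# ⁻¹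
      ≡⟨ solve 2 (λ r h → (con (ℤ.+ 2) :* con (ℤ.+ 2) :* r :- r :- r) :* h
          := (con (ℤ.+ 2) :* h) :* r) refl (Q x) (2# ⁻¹) ⟩
    2# * 2# ⁻¹ * Q x                          ≡⟨ cong (_* Q x) (*-inverseʳ 2# 2#≢0) ⟩
    1# * Q x                                  ≡⟨ *-identityˡ _ ⟩
    Q x ∎
    where open ≡-Reasoning

  1<q : 1 < q
  1<q with 1 ℕ.<? q
  ... | yes 1<q = 1<q
  ... | no  1≮q = contradiction (trans (sym (strictlyInverseʳ 0#)) (trans (cong from (Fin.toℕ-injective
                    (trans (small (to 0#)) (sym (small (to 1#)))))) (strictlyInverseʳ 1#))) 0≢1
    where
    open Inverse enumeration using (to; from; strictlyInverseʳ)
    small : (i : Fin q) → toℕ i ≡ 0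
    small i = ℕ.n<1⇒n≡0 (ℕ.<-≤-trans (Fin.toℕ<n i) (ℕ.≮⇒≥ 1≮q))

  ∣Point∣ : ∣ full {Point} ∣ ≡ q ℕ.^ d
  ∣Point∣ = trans (∣full∣ {Point}) (trans (∣Vec∣ {Carrier} d) (cong (ℕ._^ d) ∣Carrier∣))

  abstract
    -- The pairings with `us` map q ^ d points to q ^ k tuples, so two points have the same tuple,
    -- and their difference is the vector sought. This pigeonhole replaces rank and nullity.
    common-orthogonal : ∀ {k} → k < d → (us : Vec Point k) →
                        ∃[ x ] x ≢ 0ⱽ × (∀ i → ⟪ x , lookup us i ⟫ ≡ 0#)
    common-orthogonal {k} k<d us with ∃? (λ x → ¬? (x ≟ 0ⱽ) ×-dec (Vec.map (λ u → ⟪ x , u ⟫) us ≟ 0ⱽ))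
    ... | yes (x , x≢0 , pairings≡0) = x , x≢0 , λ i → begin
        ⟪ x , lookup us i ⟫                         ≡⟨ lookup-map i (λ u → ⟪ x , u ⟫) us ⟨
        lookup (Vec.map (λ u → ⟪ x , u ⟫) us) i        ≡⟨ cong (λ v → lookup v i) pairings≡0 ⟩
        lookup 0ⱽ i                                 ≡⟨ lookup-replicate i 0# ⟩
        0# ∎
      where open ≡-Reasoning
    ... | no none = contradiction (ℕ.^-monoʳ-< q 1<q k<d) (ℕ.≤⇒≯ (subst₂ _≤_ ∣Point∣
          (trans (∣full∣ {Vec Carrier k}) (trans (∣Vec∣ {Carrier} k) (cong (ℕ._^ k) ∣Carrier∣)))
          (injection⇒∣∣≤ full full (λ x → Vec.map (λ u → ⟪ x , u ⟫) us) (λ _ _ → tt) λ x y _ _ eq → injective x y eq)))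
      where
      pairings-- : ∀ {m} (us : Vec Point m) x y →
                   Vec.map (λ u → ⟪ x , u ⟫) us ≡ Vec.map (λ u → ⟪ y , u ⟫) us → Vec.map (λ u → ⟪ x -ⱽ y , u ⟫) us ≡ 0ⱽ
      pairings-- []       x y eq = refl
      pairings-- (u ∷ us) x y eq = cong₂ _∷_
        (trans (⟪⟫--ˡ x y u) (x≡y⇒x-y≡0 (∷-injectiveˡ eq)))
        (pairings-- us x y (∷-injectiveʳ eq))

      injective : ∀ x y → Vec.map (λ u → ⟪ x , u ⟫) us ≡ Vec.map (λ u → ⟪ y , u ⟫) us → x ≡ y
      injective x y eq with (x -ⱽ y) ≟ 0ⱽ
      ... | yes x-y≡0 = x-y≡0ⱽ⇒x≡y x-y≡0
      ... | no  x-y≢0 = ⊥-elim (none (x -ⱽ y , x-y≢0 , pairings-- us x y eq))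

  abstract
    nonzero-pairing : ∀ {x} → x ≢ 0ⱽ → ∃[ y ] ⟪ y , x ⟫ ≢ 0#
    nonzero-pairing {x} x≢0 with ∃? (λ y → ¬? (⟪ y , x ⟫ ≟ 0#))
    ... | yes found = found
    ... | no  none  = contradiction (nondegenerate x all-zero) x≢0
      where
      all-zero : ∀ y → ⟪ x , y ⟫ ≡ 0#
      all-zero y with ⟪ x , y ⟫ ≟ 0#
      ... | yes eq = eq
      ... | no neq = ⊥-elim (none (y , λ eq → neq (trans (⟪⟫-sym x y) eq)))

  abstract
    -- Three successively orthogonal vectors either include an isotropic one or diagonalise a
    -- ternary form. In the second case Q (e₃ + x e₁ + y e₂) = 0 is solvable in x and y, and the
    -- fixed coefficient 1 of e₃ keeps the solution nonzero, as it pairs with e₃ to Q e₃.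
    isotropic-vector : 3 ≤ d → ∃[ v ] v ≢ 0ⱽ × Q v ≡ 0#
    isotropic-vector 3≤d
      with e₁ , e₁≢0 , _   ← common-orthogonal (ℕ.≤-trans (s≤s z≤n) 3≤d) []
      with e₂ , e₂≢0 , e₂⊥ ← common-orthogonal (ℕ.≤-trans (s≤s (s≤s z≤n)) 3≤d) (e₁ ∷ [])
      with e₃ , e₃≢0 , e₃⊥ ← common-orthogonal 3≤d (e₁ ∷ e₂ ∷ [])
      with Q e₁ ≟ 0# | Q e₂ ≟ 0# | Q e₃ ≟ 0#
    ... | yes Qe₁≡0 | _         | _         = e₁ , e₁≢0 , Qe₁≡0
    ... | no  _     | yes Qe₂≡0 | _         = e₂ , e₂≢0 , Qe₂≡0
    ... | no  _     | no  _     | yes Qe₃≡0 = e₃ , e₃≢0 , Qe₃≡0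
    ... | no Qe₁≢0  | no Qe₂≢0  | no Qe₃≢0
      with x , y , eq ← binary-form-represents q-odd Qe₁≢0 Qe₂≢0 (Q e₃) =
        v , v≢0 , Qv≡0
      where
      open ≡-Reasoning
      v : Point
      v = (e₃ +ⱽ x · e₁) +ⱽ y · e₂

      ⟪v,e₃⟫≡Qe₃ : ⟪ v , e₃ ⟫ ≡ Q e₃
      ⟪v,e₃⟫≡Qe₃ = begin
        ⟪ v , e₃ ⟫                                           ≡⟨ ⟪⟫-+·ˡ _ y e₂ e₃ ⟩
        ⟪ e₃ +ⱽ x · e₁ , e₃ ⟫ + y * ⟪ e₂ , e₃ ⟫              ≡⟨ cong₂ _+_ (⟪⟫-+·ˡ e₃ x e₁ e₃)
              (cong (y *_) (trans (⟪⟫-sym e₂ e₃) (e₃⊥ (suc zero)))) ⟩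
        ⟪ e₃ , e₃ ⟫ + x * ⟪ e₁ , e₃ ⟫ + y * 0#
          ≡⟨ cong₂ (λ a b → a + x * b + y * 0#) (⟪x,x⟫≡Qx e₃)
              (trans (⟪⟫-sym e₁ e₃) (e₃⊥ zero)) ⟩
        Q e₃ + x * 0# + y * 0#
          ≡⟨ solve 3 (λ a x y → a :+ x :* con (ℤ.+ 0) :+ y :* con (ℤ.+ 0) := a) refl (Q e₃) x y ⟩
        Q e₃ ∎

      v≢0 : v ≢ 0ⱽ
      v≢0 v≡0 = Qe₃≢0 (trans (sym ⟪v,e₃⟫≡Qe₃) (trans (cong (λ u → ⟪ u , e₃ ⟫) v≡0) (⟪⟫-zeroˡ e₃)))

      Qv≡0 : Q v ≡ 0#
      Qv≡0 = begin
        Q v                                                                       ≡⟨ Q-+· _ y e₂ ⟩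
        Q (e₃ +ⱽ x · e₁) + 2# * (y * ⟪ e₃ +ⱽ x · e₁ , e₂ ⟫) + y * y * Q e₂
          ≡⟨ cong₂ (λ a b → a + 2# * (y * b) + y * y * Q e₂)
              (Q-+· e₃ x e₁) (⟪⟫-+·ˡ e₃ x e₁ e₂) ⟩
        Q e₃ + 2# * (x * ⟪ e₃ , e₁ ⟫) + x * x * Q e₁
          + 2# * (y * (⟪ e₃ , e₂ ⟫ + x * ⟪ e₁ , e₂ ⟫)) + y * y * Q e₂
            ≡⟨ cong₂ (λ a b → Q e₃ + 2# * (x * a) + x * x * Q e₁ + 2# * (y * b) + y * y * Q e₂)
                (e₃⊥ zero) (cong₂ (λ a b → a + x * b) (e₃⊥ (suc zero)) (trans (⟪⟫-sym e₁ e₂) (e₂⊥ zero))) ⟩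
        Q e₃ + 2# * (x * 0#) + x * x * Q e₁ + 2# * (y * (0# + x * 0#)) + y * y * Q e₂
          ≡⟨ solve 5 (λ a b c x y → c :+ con (ℤ.+ 2) :* (x :* con (ℤ.+ 0)) :+ x :* x :* a
                                       :+ con (ℤ.+ 2) :* (y :* (con (ℤ.+ 0) :+ x :* con (ℤ.+ 0))) :+ y :* y :* b
                                    := a :* (x :* x) :+ b :* (y :* y) :+ c) refl (Q e₁) (Q e₂) (Q e₃) x y ⟩
        Q e₁ * (x * x) + Q e₂ * (y * y) + Q e₃                                    ≡⟨ eq ⟩
        0# ∎

  abstract
    dual-vector : ∀ {v} → v ≢ 0ⱽ → ∃[ w ] ⟪ w , v ⟫ ≡ 1#
    dual-vector {v} v≢0 with y , ⟪y,v⟫≢0 ← nonzero-pairing v≢0 =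
      ⟪ y , v ⟫ ⁻¹ · y , trans (⟪⟫-·ˡ _ y v) (*-inverseˡ _ ⟪y,v⟫≢0)

  -- Polarisation: if all three values vanished, so would 2 ⟪ x , e ⟫. When x and e lie in a
  -- subspace, the anisotropic vector is found in the same subspace.
  anisotropic-combination : ∀ x e → ⟪ x , e ⟫ ≢ 0# → Q x ≢ 0# ⊎ Q e ≢ 0# ⊎ Q (x +ⱽ e) ≢ 0#
  anisotropic-combination x e ⟪x,e⟫≢0 with Q x ≟ 0# | Q e ≟ 0#
  ... | no Qx≢0   | _         = inj₁ Qx≢0
  ... | yes _     | no Qe≢0   = inj₂ (inj₁ Qe≢0)
  ... | yes Qx≡0  | yes Qe≡0  = inj₂ (inj₂ λ Q≡0 → *-≢0 2#≢0 ⟪x,e⟫≢0 (begin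
      2# * ⟪ x , e ⟫
        ≡⟨ solve 1 (λ a → a := con (ℤ.+ 0) :+ a :+ con (ℤ.+ 0)) refl (2# * ⟪ x , e ⟫) ⟩
      0# + 2# * ⟪ x , e ⟫ + 0#         ≡⟨ cong₂ (λ a b → a + 2# * ⟪ x , e ⟫ + b) Qx≡0 Qe≡0 ⟨
      Q x + 2# * ⟪ x , e ⟫ + Q e       ≡⟨ Q-+ x e ⟨
      Q (x +ⱽ e)                       ≡⟨ Q≡0 ⟩
      0# ∎))
    where open ≡-Reasoning

  sphere : Point → Carrier → Subset Point
  sphere c r = ⟨ (λ x → Q (x -ⱽ c) ≡ r) ∣ (λ x → Q (x -ⱽ c) ≟ r) ⟩

  -- The expansion is made around the endpoint y + s e instead of y. The coefficients then depend on
  -- the endpoint alone, so all s leading to a given endpoint satisfy one quadratic equation.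
  line-sphere-root : ∀ c r e s y → Q (y -ⱽ c) ≡ r →
                     s ∈ roots (Q e) (- (2# * ⟪ (y +ⱽ s · e) -ⱽ c , e ⟫)) (Q ((y +ⱽ s · e) -ⱽ c) - r)
  line-sphere-root c r e s y Qy≡r = begin
    Q e * (s * s) + - (2# * ⟪ x′ , e ⟫) * s + (Q x′ - r)
      ≡⟨ solve 5 (λ a s b c r → a :* (s :* s) :+ :- (con (ℤ.+ 2) :* b) :* s :+ (c :- r)
                   := (c :+ con (ℤ.+ 2) :* ((:- s) :* b) :+ (:- s) :* (:- s) :* a) :- r) refl (Q e) s ⟪ x′ , e ⟫ (Q x′) r ⟩
    (Q x′ + 2# * (- s * ⟪ x′ , e ⟫) + - s * - s * Q e) - r
      ≡⟨ cong (_- r) (Q-+· x′ (- s) e) ⟨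
    Q (x′ +ⱽ (- s) · e) - r
      ≡⟨ cong (λ p → Q p - r) (trans (sym ([x+ay]-z (- s) (y +ⱽ s · e) e c)) (cong (_-ⱽ c) ([x+ay]-ay s y e))) ⟩
    Q (y -ⱽ c) - r
      ≡⟨ x≡y⇒x-y≡0 Qy≡r ⟩
    0# ∎
    where
    open ≡-Reasoning
    x′ : Point
    x′ = (y +ⱽ s · e) -ⱽ c

  -- Every line in direction e meets the sphere in at most two points unless it lies on
  -- a sphere about the same centre.
  line-bound : (S : Subset Point) (e c : Point) (r : Carrier) →
               (∀ s x → x ∈ S → x +ⱽ s · e ∈ S) →
               (∀ x → x ∈ S → ¬ (Q e ≡ 0# × ⟪ x -ⱽ c , e ⟫ ≡ 0#)) →
               q ℕ.* ∣ S ∩ sphere c r ∣ ≤ 2 ℕ.* ∣ S ∣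
  line-bound S e c r closed nontrivial = begin
    q ℕ.* ∣ S ∩ sphere c r ∣                   ≡⟨ cong (ℕ._* ∣ S ∩ sphere c r ∣) ∣full-Carrier∣ ⟨
    ∣ full {Carrier} ∣ ℕ.* ∣ S ∩ sphere c r ∣  ≡⟨ ∣⊗∣ (full {Carrier}) (S ∩ sphere c r) ⟨
    ∣ full {Carrier} ⊗ (S ∩ sphere c r) ∣
      ≤⟨ fibres≤⇒∣∣≤ (full {Carrier} ⊗ (S ∩ sphere c r)) S along
          (λ { (s , y) (_ , y∈S , _) → closed s y y∈S }) 2 at-most-two ⟩
    2 ℕ.* ∣ S ∣ ∎
    where
    open ℕ.≤-Reasoning
    -- The pairs (s , y) with y on the section are sorted by endpoint, which stays in S; an endpoint
    -- arises at most twice.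
    along : Carrier × Point → Point
    along (s , y) = y +ⱽ s · e

    at-most-two : ∀ x → x ∈ S → ∣ fibre (full {Carrier} ⊗ (S ∩ sphere c r)) along x ∣ ≤ 2
    at-most-two x x∈S = ℕ.≤-trans
      (injection⇒∣∣≤ (fibre (full {Carrier} ⊗ (S ∩ sphere c r)) along x) (roots (Q e) (- (2# * ⟪ x -ⱽ c , e ⟫)) (Q (x -ⱽ c) - r)) proj₁
        (λ { (s , y) ((_ , _ , Qy≡r) , refl) → line-sphere-root c r e s y Qy≡r })
        λ { (s , y) (.s , y′) (_ , refl) (_ , eq) refl → cong (s ,_) (sym (+ⱽ-cancelʳ (s · e) eq)) })
      (∣roots∣≤2 _ _ _ λ (Qe≡0 , β≡0) → nontrivial x x∈S (Qe≡0 , x≢0∧xy≡0⇒y≡0 2#≢0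
        (trans (solve 1 (λ b → b := con (ℤ.+ 0) :- (:- b)) refl _) (x≡y⇒x-y≡0 (sym β≡0)))))

-- Natural numbers as rationals

infix 9 _/1
_/1 : ℕ → ℚ
n /1 = ℤ.+ n ℚ./ 1

-- Division normalises by a gcd and is stuck on a variable numerator; in this explicit form the
-- rational operations compute.
/1-canonical : ∀ n → n /1 ≡ mkℚ (ℤ.+ n) 0 (Coprime.sym (Coprime.1-coprimeTo n))
/1-canonical n = ℚ.fromℚᵘ-toℚᵘ (mkℚ (ℤ.+ n) 0 (Coprime.sym (Coprime.1-coprimeTo n)))

/1-+ : ∀ m n → (m ℕ.+ n) /1 ≡ m /1 ℚ.+ n /1
/1-+ m n = trans
  (cong (ℚ._/ 1) (cong₂ ℤ._+_ (sym (ℤ.*-identityʳ (ℤ.+ m))) (sym (ℤ.*-identityʳ (ℤ.+ n)))))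
  (sym (cong₂ ℚ._+_ (/1-canonical m) (/1-canonical n)))

/1-* : ∀ m n → (m ℕ.* n) /1 ≡ m /1 ℚ.* n /1
/1-* m n = trans (cong (ℚ._/ 1) (ℤ.pos-* m n)) (sym (cong₂ ℚ._*_ (/1-canonical m) (/1-canonical n)))

/1-mono-< : ∀ {m n} → m < n → m /1 ℚ.< n /1
/1-mono-< {m} {n} m<n rewrite /1-canonical m | /1-canonical n =
  ℚ.*<* (ℤ.*-monoʳ-<-pos (ℤ.+ 1) (ℤ.+<+ m<n))

[kq]/q : ∀ k q .{{_ : NonZero q}} → ℤ.+ (k ℕ.* q) ℚ./ q ≡ k /1
[kq]/q k (suc q) = ℚ.fromℚᵘ-cong {ℚᵘ.mkℚᵘ (ℤ.+ (k ℕ.* suc q)) q} {ℚᵘ.mkℚᵘ (ℤ.+ k) 0}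
  (ℚᵘ.*≡* (trans (ℤ.*-identityʳ _) (ℤ.pos-* k (suc q))))

/1-difference : ∀ {i m k} → i ≡ m ℕ.+ k → i /1 ℚ.- k /1 ≡ m /1
/1-difference {m = m} {k} refl = begin
  (m ℕ.+ k) /1 ℚ.- k /1          ≡⟨ cong (ℚ._- k /1) (/1-+ m k) ⟩
  m /1 ℚ.+ k /1 ℚ.- k /1         ≡⟨ ℚ.+-assoc (m /1) (k /1) _ ⟩
  m /1 ℚ.+ (k /1 ℚ.- k /1)       ≡⟨ cong (m /1 ℚ.+_) (ℚ.+-inverseʳ (k /1)) ⟩
  m /1 ℚ.+ ℚ.0ℚ                  ≡⟨ ℚ.+-identityʳ _ ⟩
  m /1 ∎
  where open ≡-Reasoning

-- Incidences and discrepancies of a block system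

module BlockCounts {q d} {V : QuadraticSpace q d} (q-odd : ¬ (2 ∣ q)) (B : BlockSystem V) where
  open Geometry V
  open FieldProperties 𝔽
  open VectorIdentities 𝔽
  open QuadraticProperties V q-odd
  open BlockSystem B hiding (blocks; CrossBlocksVanish; ExactCentredBlocks)

  t n : ℕ
  t = ∣ Z ∣
  n = ∣ X_R ∣

  -- The functional that recovers the block: `A z` and the centres of `𝒮[ z ]` lie at level z,
  -- because v and `X_R` are in its kernel and w is at level 1.
  level : Point → Carrier
  level x = ⟪ x , v ⟫

  ⟪v,v⟫≡0 : ⟪ v , v ⟫ ≡ 0#
  ⟪v,v⟫≡0 = trans (⟪x,x⟫≡Qx v) Qv≡0

  level-c : ∀ z → level (c z) ≡ z
  level-c z = trans (⟪⟫-·ˡ z w v) (trans (cong (z *_) ⟪w,v⟫≡1) (*-identityʳ z))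

  level-[x-c] : ∀ x z → level (x -ⱽ c z) ≡ level x - z
  level-[x-c] x z = trans (⟪⟫--ˡ x (c z) v) (cong (λ a → level x - a) (level-c z))

  level-A : ∀ {x z} → x ∈ A z → level x ≡ z
  level-A {x} {z} (⊥v , _) = x-y≡0⇒x≡y (trans (sym (level-[x-c] x z)) ⊥v)

  level-centre : ∀ z u → level (c z +ⱽ u · v) ≡ z
  level-centre z u = trans (⟪⟫-+·ˡ (c z) u v v) (trans (cong₂ (λ a b → a + u * b) (level-c z) ⟪v,v⟫≡0)
    (solve 2 (λ z u → z :+ u :* con (ℤ.+ 0) := z) refl z u))

  level-𝒮 : ∀ {s z} → s ∈ 𝒮[ z ] → level (centre s) ≡ z
  level-𝒮 {z = z} (u , refl) = level-centre z u

  ∣A∣≡n : ∀ z → ∣ A z ∣ ≡ n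
  ∣A∣≡n z = bijection⇒∣∣≡ (A z) X_R (_-ⱽ c z) (λ _ x∈ → x∈)
    (λ x y _ _ eq → trans (sym ([x-y]+y x (c z))) (trans (cong (_+ⱽ c z) eq) ([x-y]+y y (c z))))
    λ y y∈ → y +ⱽ c z , subst (_∈ X_R) (sym ([x+y]-y y (c z))) y∈ , [x+y]-y y (c z)

  ∣𝒮[z]∣≡q : ∀ z → ∣ 𝒮[ z ] ∣ ≡ q
  ∣𝒮[z]∣≡q z = trans (sym (bijection⇒∣∣≡ full 𝒮[ z ] (λ u → c z +ⱽ u · v , R) (λ u _ → u , refl)
    (λ u u′ _ _ eq → injective u u′ (cong proj₁ eq)) λ { _ (u , refl) → u , tt , refl })) ∣full-Carrier∣
    where
    open ≡-Reasoning
    -- Pairing with w separates the centres, since ⟪ v , w ⟫ = 1.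
    injective : ∀ u u′ → c z +ⱽ u · v ≡ c z +ⱽ u′ · v → u ≡ u′
    injective u u′ eq = sym (x-y≡0⇒x≡y (begin
      u′ - u                       ≡⟨ *-identityʳ _ ⟨
      (u′ - u) * 1#                ≡⟨ cong ((u′ - u) *_) (trans (⟪⟫-sym v w) ⟪w,v⟫≡1) ⟨
      (u′ - u) * ⟪ v , w ⟫         ≡⟨ ⟪⟫-·ˡ _ v w ⟨
      ⟪ (u′ - u) · v , w ⟫         ≡⟨ cong (λ x → ⟪ x , w ⟫) (x+ay≡z+by⇒x-z eq) ⟨
      ⟪ c z -ⱽ c z , w ⟫           ≡⟨ cong (λ x → ⟪ x , w ⟫) (x-x (c z)) ⟩
      ⟪ 0ⱽ , w ⟫                   ≡⟨ ⟪⟫-zeroˡ w ⟩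
      0# ∎))

  Q-from-centre : ∀ {p b} → p ∈ A b → ∀ z u → Q (p -ⱽ (c z +ⱽ u · v)) ≡ Q (p -ⱽ c z) - u * (2# * (b - z))
  Q-from-centre {p} {b} p∈ z u = begin
    Q (p -ⱽ (c z +ⱽ u · v))
      ≡⟨ cong Q (x-[y+az] u p (c z) v) ⟩
    Q ((p -ⱽ c z) +ⱽ (- u) · v)
      ≡⟨ Q-+· (p -ⱽ c z) (- u) v ⟩
    Q (p -ⱽ c z) + 2# * (- u * level (p -ⱽ c z)) + - u * - u * Q v
      ≡⟨ cong₂ (λ a b → Q (p -ⱽ c z) + 2# * (- u * a) + - u * - u * b)
          (trans (level-[x-c] p z) (cong (_- z) (level-A p∈))) Qv≡0 ⟩
    Q (p -ⱽ c z) + 2# * (- u * (b - z)) + - u * - u * 0#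
      ≡⟨ solve 4 (λ Q u b z → Q :+ con (ℤ.+ 2) :* (:- u :* (b :- z)) :+ :- u :* :- u :* con (ℤ.+ 0)
          := Q :- u :* (con (ℤ.+ 2) :* (b :- z))) refl (Q (p -ⱽ c z)) u b z ⟩
    Q (p -ⱽ c z) - u * (2# * (b - z)) ∎
    where open ≡-Reasoning

  ∣incident-diagonal∣ : ∀ z → ∣ incident (A z) 𝒮[ z ] ∣ ≡ n ℕ.* q
  ∣incident-diagonal∣ z = begin
    ∣ incident (A z) 𝒮[ z ] ∣
      ≡⟨ ≐⇒∣∣≡ (incident (A z) 𝒮[ z ]) (A z ⊗ 𝒮[ z ]) (λ _ → proj₁) (λ (p , s) → all-incident p s) ⟩
    ∣ A z ⊗ 𝒮[ z ] ∣                 ≡⟨ ∣⊗∣ (A z) 𝒮[ z ] ⟩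
    ∣ A z ∣ ℕ.* ∣ 𝒮[ z ] ∣           ≡⟨ cong₂ ℕ._*_ (∣A∣≡n z) (∣𝒮[z]∣≡q z) ⟩
    n ℕ.* q ∎
    where
    open ≡-Reasoning
    all-incident : ∀ p s → (p , s) ∈ A z ⊗ 𝒮[ z ] → (p , s) ∈ incident (A z) 𝒮[ z ]
    all-incident p s (p∈ , u , refl) = (p∈ , u , refl) , (begin
      Q (p -ⱽ (c z +ⱽ u · v))               ≡⟨ Q-from-centre p∈ z u ⟩
      Q (p -ⱽ c z) - u * (2# * (z - z))
        ≡⟨ solve 3 (λ a u z → a :- u :* (con (ℤ.+ 2) :* (z :- z)) := a) refl (Q (p -ⱽ c z)) u z ⟩
      Q (p -ⱽ c z)                          ≡⟨ proj₂ p∈ ⟩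
      R ∎)

  -- For b ≠ z the incidence equation is linear in u with nonzero leading coefficient 2 (b - z).
  ∣incident-cross∣ : ∀ {b z} → b ≢ z → ∣ incident (A b) 𝒮[ z ] ∣ ≡ n
  ∣incident-cross∣ {b} {z} b≢z = trans
    (bijection⇒∣∣≡ (incident (A b) 𝒮[ z ]) (A b) proj₁ (λ { _ ((p∈ , _) , _) → p∈ })
      (λ { (p , _) (_ , _) ((p∈ , u , refl) , eq) ((_ , u′ , refl) , eq′) refl →
        cong (λ u → p , c z +ⱽ u · v , R) (unique p∈ u u′ (trans eq (sym eq′))) })
      λ p p∈ → (p , c z +ⱽ u₀ p · v , R) , ((p∈ , u₀ p , refl) , incidence p∈) , refl)
    (∣A∣≡n b)
    where
    open ≡-Reasoning
    k : Carrier
    k = 2# * (b - z)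

    k≢0 : k ≢ 0#
    k≢0 = *-≢0 2#≢0 (b≢z ∘ x-y≡0⇒x≡y)

    u₀ : Point → Carrier
    u₀ p = (Q (p -ⱽ c z) - R) * k ⁻¹

    incidence : ∀ {p} → p ∈ A b → Q (p -ⱽ (c z +ⱽ u₀ p · v)) ≡ R
    incidence {p} p∈ = begin
      Q (p -ⱽ (c z +ⱽ u₀ p · v))                            ≡⟨ Q-from-centre p∈ z (u₀ p) ⟩
      Q (p -ⱽ c z) - (Q (p -ⱽ c z) - R) * k ⁻¹ * k
        ≡⟨ solve 4 (λ a r h k → a :- (a :- r) :* h :* k := a :- (a :- r) :* (h :* k)) refl (Q (p -ⱽ c z)) R (k ⁻¹) k ⟩
      Q (p -ⱽ c z) - (Q (p -ⱽ c z) - R) * (k ⁻¹ * k)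
        ≡⟨ cong (λ e → Q (p -ⱽ c z) - (Q (p -ⱽ c z) - R) * e) (*-inverseˡ k k≢0) ⟩
      Q (p -ⱽ c z) - (Q (p -ⱽ c z) - R) * 1#
        ≡⟨ solve 2 (λ a r → a :- (a :- r) :* con (ℤ.+ 1) := r) refl (Q (p -ⱽ c z)) R ⟩
      R ∎

    unique : ∀ {p} → p ∈ A b → ∀ u u′ → Q (p -ⱽ (c z +ⱽ u · v)) ≡ Q (p -ⱽ (c z +ⱽ u′ · v)) → u ≡ u′
    unique {p} p∈ u u′ eq = sym (x-y≡0⇒x≡y (x≢0∧xy≡0⇒y≡0 k≢0 (begin
      k * (u′ - u)
        ≡⟨ solve 4 (λ a k u u′ → k :* (u′ :- u) := (a :- u :* k) :- (a :- u′ :* k)) refl (Q (p -ⱽ c z)) k u u′ ⟩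
      (Q (p -ⱽ c z) - u * k) - (Q (p -ⱽ c z) - u′ * k)
        ≡⟨ x≡y⇒x-y≡0 (trans (sym (Q-from-centre p∈ z u)) (trans eq (Q-from-centre p∈ z u′))) ⟩
      0# ∎)))

  ∣P∣≡nt : ∣ P ∣ ≡ n ℕ.* t
  ∣P∣≡nt = fibres≡⇒∣∣≡ P Z level (λ { x (z , z∈Z , x∈A) → subst (_∈ Z) (sym (level-A x∈A)) z∈Z }) n λ z z∈Z → trans
    (≐⇒∣∣≡ (fibre P level z) (A z)
      (λ { x ((z′ , _ , x∈A) , refl) → subst (λ z → x ∈ A z) (sym (level-A x∈A)) x∈A })
      λ x x∈A → (z , z∈Z , x∈A) , level-A x∈A)
    (∣A∣≡n z)

  ∣𝒮∣≡qt : ∣ 𝒮 ∣ ≡ q ℕ.* t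
  ∣𝒮∣≡qt = fibres≡⇒∣∣≡ 𝒮 Z (level ∘ centre) (λ { s (z , z∈Z , s∈) → subst (_∈ Z) (sym (level-𝒮 s∈)) z∈Z }) q λ z z∈Z → trans
    (≐⇒∣∣≡ (fibre 𝒮 (level ∘ centre) z) 𝒮[ z ]
      (λ { s ((z′ , _ , s∈) , refl) → subst (λ z → s ∈ 𝒮[ z ]) (sym (level-𝒮 s∈)) s∈ })
      λ s s∈ → (z , z∈Z , s∈) , level-𝒮 s∈)
    (∣𝒮[z]∣≡q z)

  private
    levels : Point × Sphere → Carrier × Carrier
    levels (p , s) = level p , level (centre s)

    diagonal : Subset (Carrier × Carrier)
    diagonal = ⟨ (λ (b , z) → b ∈ Z × b ≡ z) ∣ (λ (b , z) → (b ∈? Z) ×-dec (b ≟ z)) ⟩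

    ∣diagonal∣ : ∣ diagonal ∣ ≡ t
    ∣diagonal∣ = bijection⇒∣∣≡ diagonal Z proj₁ (λ _ → proj₁) (λ { _ _ (_ , refl) (_ , refl) refl → refl })
      λ z z∈Z → (z , z) , (z∈Z , refl) , refl

    n+n[q-1] : n ℕ.+ n ℕ.* (q ∸ 1) ≡ n ℕ.* q
    n+n[q-1] = begin
      n ℕ.+ n ℕ.* (q ∸ 1)      ≡⟨ ℕ.*-suc n (q ∸ 1) ⟨
      n ℕ.* (1 ℕ.+ (q ∸ 1))    ≡⟨ cong (n ℕ.*_) (ℕ.m+[n∸m]≡n (ℕ.<⇒≤ 1<q)) ⟩
      n ℕ.* q ∎
      where open ≡-Reasoning

    -- A diagonal pair is credited with the common value n and, separately, with its excess n (q -
    -- 1). The first indicator then sums to the expected n t², the second to the surplus.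
    ∣block∣ : ∀ y → ∣ fibre (incident P 𝒮) levels y ∣ ≡ n ℕ.* 𝟙 (y ∈? Z ⊗ Z) ℕ.+ n ℕ.* (q ∸ 1) ℕ.* 𝟙 (y ∈? diagonal)
    ∣block∣ (b , z) with b ∈? Z | z ∈? Z | b ≟ z
    ... | no b∉Z | _ | _ rewrite ℕ.*-zeroʳ n | ℕ.*-zeroʳ (n ℕ.* (q ∸ 1)) = ∅⇒∣∣≡0 (fibre (incident P 𝒮) levels (b , z))
      λ { (p , s) (((((b′ , b′∈Z , p∈) , _) , _) , refl)) → b∉Z (subst (_∈ Z) (sym (level-A p∈)) b′∈Z) }
    ... | yes b∈Z | no z∉Z | yes refl = contradiction b∈Z z∉Z
    ... | yes b∈Z | no z∉Z | no _ rewrite ℕ.*-zeroʳ n | ℕ.*-zeroʳ (n ℕ.* (q ∸ 1)) = ∅⇒∣∣≡0 (fibre (incident P 𝒮) levels (b , z))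
      λ { (p , s) ((((_ , z′ , z′∈Z , s∈) , _) , refl)) → z∉Z (subst (_∈ Z) (sym (level-𝒮 s∈)) z′∈Z) }
    ... | yes b∈Z | yes z∈Z | b≟z = trans
      (≐⇒∣∣≡ (fibre (incident P 𝒮) levels (b , z)) (incident (A b) 𝒮[ z ])
        (λ { (p , s) ((((b′ , _ , p∈) , (z′ , _ , s∈)) , eq) , refl) →
          (subst (λ b → p ∈ A b) (sym (level-A p∈)) p∈ , subst (λ z → s ∈ 𝒮[ z ]) (sym (level-𝒮 s∈)) s∈) , eq })
        λ { (p , s) ((p∈ , s∈) , eq) → (((b , b∈Z , p∈) , (z , z∈Z , s∈)) , eq) , cong₂ _,_ (level-A p∈) (level-𝒮 s∈) })
      (count b≟z)
      where
      count : (b≟z : Dec (b ≡ z)) → ∣ incident (A b) 𝒮[ z ] ∣ ≡ n ℕ.* 1 ℕ.+ n ℕ.* (q ∸ 1) ℕ.* 𝟙 (yes b∈Z ×-dec b≟z)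
      count (yes refl) rewrite ℕ.*-identityʳ n | ℕ.*-identityʳ (n ℕ.* (q ∸ 1)) = trans (∣incident-diagonal∣ b) (sym n+n[q-1])
      count (no b≢z) rewrite ℕ.*-identityʳ n | ℕ.*-zeroʳ (n ℕ.* (q ∸ 1)) | ℕ.+-identityʳ n = ∣incident-cross∣ b≢z

  ∣incident-P-𝒮∣ : ∣ incident P 𝒮 ∣ ≡ n ℕ.* (t ℕ.* t) ℕ.+ n ℕ.* (q ∸ 1) ℕ.* t
  ∣incident-P-𝒮∣ = begin
    ∣ incident P 𝒮 ∣
      ≡⟨ ∣∣≡∑fibres (incident P 𝒮) levels ⟩
    total (λ y → ∣ fibre (incident P 𝒮) levels y ∣)
      ≡⟨ sum-cong ∣block∣ (elements {Carrier × Carrier}) ⟩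
    total (λ y → n ℕ.* 𝟙 (y ∈? Z ⊗ Z) ℕ.+ n ℕ.* (q ∸ 1) ℕ.* 𝟙 (y ∈? diagonal))
      ≡⟨ sum-+ _ _ (elements {Carrier × Carrier}) ⟩
    total (λ y → n ℕ.* 𝟙 (y ∈? Z ⊗ Z)) ℕ.+ total (λ y → n ℕ.* (q ∸ 1) ℕ.* 𝟙 (y ∈? diagonal))
      ≡⟨ cong₂ ℕ._+_ (total-indicator n (Z ⊗ Z)) (total-indicator (n ℕ.* (q ∸ 1)) diagonal) ⟩
    n ℕ.* ∣ Z ⊗ Z ∣ ℕ.+ n ℕ.* (q ∸ 1) ℕ.* ∣ diagonal ∣
      ≡⟨ cong₂ (λ a b → n ℕ.* a ℕ.+ n ℕ.* (q ∸ 1) ℕ.* b) (∣⊗∣ Z Z) ∣diagonal∣ ⟩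
    n ℕ.* (t ℕ.* t) ℕ.+ n ℕ.* (q ∸ 1) ℕ.* t ∎
    where open ≡-Reasoning

  -- For a cross pair, a diagonal pair and the whole system alike, the expected count |S| |T| / q is
  -- an integer k, so each discrepancy is a natural number m.
  σ-from-counts : ∀ (S : Subset Point) (T : Subset Sphere) {m k} →
                  ∣ incident S T ∣ ≡ m ℕ.+ k → ∣ S ∣ ℕ.* ∣ T ∣ ≡ k ℕ.* q → σ S T ≡ m /1
  σ-from-counts S T {m} {k} I≡ product≡ = trans
    (cong (λ r → ∣ incident S T ∣ /1 ℚ.- r) (trans (cong (λ a → ℚ._/_ (ℤ.+ a) q {{nonZero}}) product≡) ([kq]/q k q {{nonZero}})))
    (/1-difference {m = m} {k} I≡)

  surplus : ℕ
  surplus = n ℕ.* (q ∸ 1)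

  σ-cross : ∀ {b z} → b ≢ z → σ (A b) 𝒮[ z ] ≡ 0ℚ
  σ-cross {b} {z} b≢z = σ-from-counts (A b) 𝒮[ z ] {0} {n} (∣incident-cross∣ b≢z) (cong₂ ℕ._*_ (∣A∣≡n b) (∣𝒮[z]∣≡q z))

  σ-diagonal : ∀ z → σ (A z) 𝒮[ z ] ≡ surplus /1
  σ-diagonal z = σ-from-counts (A z) 𝒮[ z ] {surplus} {n}
    (trans (∣incident-diagonal∣ z) (trans (sym n+n[q-1]) (ℕ.+-comm n _))) (cong₂ ℕ._*_ (∣A∣≡n z) (∣𝒮[z]∣≡q z))

  σ-total : σ P 𝒮 ≡ (t ℕ.* surplus) /1
  σ-total = σ-from-counts P 𝒮 {t ℕ.* surplus} {n ℕ.* (t ℕ.* t)}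
    (trans ∣incident-P-𝒮∣ (trans (ℕ.+-comm (n ℕ.* (t ℕ.* t)) _) (cong (ℕ._+ n ℕ.* (t ℕ.* t)) (ℕ.*-comm surplus t))))
    (trans (cong₂ ℕ._*_ ∣P∣≡nt ∣𝒮∣≡qt)
      (rearrange n t q))
    where
    rearrange : ∀ n t q → n ℕ.* t ℕ.* (q ℕ.* t) ≡ n ℕ.* (t ℕ.* t) ℕ.* q
    rearrange = solve-∀

  exact-centred-blocks : ExactCentredBlocks B
  exact-centred-blocks = record
    { disjoint-A  = λ b z _ _ b≢z x x∈A x∈A′ → b≢z (trans (sym (level-A x∈A)) (level-A x∈A′))
    ; disjoint-𝒮  = λ b z _ _ b≢z s s∈ s∈′ → b≢z (trans (sym (level-𝒮 s∈)) (level-𝒮 s∈′))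
    ; cross-block = λ b z _ _ b≢z → σ-cross b≢z
    ; total       = trans σ-total (sym (constant-sum (filter (_∈? Z) elements)))
    }
    where
    constant-sum : ∀ zs → foldr ℚ._+_ 0ℚ (map (λ z → σ (A z) 𝒮[ z ]) zs) ≡ (length zs ℕ.* surplus) /1
    constant-sum []       = refl
    constant-sum (z ∷ zs) = trans (cong₂ ℚ._+_ (σ-diagonal z) (constant-sum zs)) (sym (/1-+ surplus _))

  one-radius : OneNonzeroRadius 𝒮
  one-radius = R , R≢0 , λ { s (z , _ , u , refl) → refl }

  0<t : 0 < t
  0<t = ∈⇒0<∣∣ Z (proj₂ Z-nonempty)

  0<n : 0 < n
  0<n = ∈⇒0<∣∣ X_R (proj₂ represented)

-- The hyperplane orthogonal to an isotropic vector

module IsotropicHyperplane {q d} (V : QuadraticSpace q d) (q-odd : ¬ (2 ∣ q)) where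
  open Geometry V
  open FieldProperties 𝔽
  open VectorIdentities 𝔽
  open QuadraticProperties V q-odd

  -- Weaker than the usual notion: Q w is arbitrary, so w can be replaced by its rejection from a
  -- vector of `v ⊥` without further correction.
  record HyperbolicPair (v w : Point) : Set where
    field
      Qv≡0    : Q v ≡ 0#
      ⟪w,v⟫≡1 : ⟪ w , v ⟫ ≡ 1#

  -- For a pair as above, the projection onto `v ⊥` along the line of w.
  project : (v w x : Point) → Point
  project v w x = x +ⱽ (- ⟪ x , v ⟫) · w

  _⊥ : Point → Subset Point
  v ⊥ = ⟨ (λ x → ⟪ x , v ⟫ ≡ 0#) ∣ (λ x → ⟪ x , v ⟫ ≟ 0#) ⟩

  +-⊥ : ∀ {x y} u → x ∈ u ⊥ → y ∈ u ⊥ → x +ⱽ y ∈ u ⊥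
  +-⊥ {x} {y} u x⊥ y⊥ = trans (⟪⟫-+ˡ x y u) (trans (cong₂ _+_ x⊥ y⊥) (+-identityˡ 0#))

  -- The orthogonal projection onto `y ⊥` when Q y ≠ 0.
  reject : (y x : Point) → Point
  reject y x = x +ⱽ (- (⟪ x , y ⟫ * Q y ⁻¹)) · y

  reject-⊥ : ∀ {y} → Q y ≢ 0# → ∀ x → reject y x ∈ y ⊥
  reject-⊥ {y} Qy≢0 x = begin
    ⟪ reject y x , y ⟫                                     ≡⟨ ⟪⟫-+·ˡ x _ y y ⟩
    ⟪ x , y ⟫ + - (⟪ x , y ⟫ * Q y ⁻¹) * ⟪ y , y ⟫
      ≡⟨ cong (λ a → ⟪ x , y ⟫ + - (⟪ x , y ⟫ * Q y ⁻¹) * a) (⟪x,x⟫≡Qx y) ⟩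
    ⟪ x , y ⟫ + - (⟪ x , y ⟫ * Q y ⁻¹) * Q y
      ≡⟨ solve 3 (λ a h b → a :+ :- (a :* h) :* b := a :- a :* (h :* b)) refl ⟪ x , y ⟫ (Q y ⁻¹) (Q y) ⟩
    ⟪ x , y ⟫ - ⟪ x , y ⟫ * (Q y ⁻¹ * Q y)
      ≡⟨ cong (λ a → ⟪ x , y ⟫ - ⟪ x , y ⟫ * a) (*-inverseˡ _ Qy≢0) ⟩
    ⟪ x , y ⟫ - ⟪ x , y ⟫ * 1#
      ≡⟨ solve 1 (λ a → a :- a :* con (ℤ.+ 1) := con (ℤ.+ 0)) refl ⟪ x , y ⟫ ⟩
    0# ∎
    where open ≡-Reasoning

  reject-⟪⟫ : ∀ {y e} → ⟪ y , e ⟫ ≡ 0# → ∀ x → ⟪ reject y x , e ⟫ ≡ ⟪ x , e ⟫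
  reject-⟪⟫ {y} {e} y⊥e x = begin
    ⟪ reject y x , e ⟫                                     ≡⟨ ⟪⟫-+·ˡ x _ y e ⟩
    ⟪ x , e ⟫ + - (⟪ x , y ⟫ * Q y ⁻¹) * ⟪ y , e ⟫
      ≡⟨ cong (λ b → ⟪ x , e ⟫ + - (⟪ x , y ⟫ * Q y ⁻¹) * b) y⊥e ⟩
    ⟪ x , e ⟫ + - (⟪ x , y ⟫ * Q y ⁻¹) * 0#
      ≡⟨ solve 2 (λ a b → a :+ :- b :* con (ℤ.+ 0) := a) refl ⟪ x , e ⟫ _ ⟩
    ⟪ x , e ⟫ ∎
    where open ≡-Reasoning

  module _ {v w : Point} (hyperbolic : HyperbolicPair v w) where
    open HyperbolicPair hyperbolic
    open ≡-Reasoning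

    project-⊥ : ∀ x → project v w x ∈ v ⊥
    project-⊥ x = begin
      ⟪ x +ⱽ (- ⟪ x , v ⟫) · w , v ⟫        ≡⟨ ⟪⟫-+·ˡ x _ w v ⟩
      ⟪ x , v ⟫ + - ⟪ x , v ⟫ * ⟪ w , v ⟫   ≡⟨ cong (λ a → ⟪ x , v ⟫ + - ⟪ x , v ⟫ * a) ⟪w,v⟫≡1 ⟩
      ⟪ x , v ⟫ + - ⟪ x , v ⟫ * 1#
        ≡⟨ solve 1 (λ a → a :+ :- a :* con (ℤ.+ 1) := con (ℤ.+ 0)) refl ⟪ x , v ⟫ ⟩
      0# ∎

    project-⟪⟫ : ∀ {e} → ⟪ w , e ⟫ ≡ 0# → ∀ x → ⟪ project v w x , e ⟫ ≡ ⟪ x , e ⟫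
    project-⟪⟫ {e} w⊥e x = begin
      ⟪ x +ⱽ (- ⟪ x , v ⟫) · w , e ⟫        ≡⟨ ⟪⟫-+·ˡ x _ w e ⟩
      ⟪ x , e ⟫ + - ⟪ x , v ⟫ * ⟪ w , e ⟫   ≡⟨ cong (λ a → ⟪ x , e ⟫ + - ⟪ x , v ⟫ * a) w⊥e ⟩
      ⟪ x , e ⟫ + - ⟪ x , v ⟫ * 0#
        ≡⟨ solve 2 (λ a b → a :+ :- b :* con (ℤ.+ 0) := a) refl ⟪ x , e ⟫ ⟪ x , v ⟫ ⟩
      ⟪ x , e ⟫ ∎

    level-+·w : ∀ x a → ⟪ x +ⱽ a · w , v ⟫ ≡ ⟪ x , v ⟫ + a
    level-+·w x a = trans (⟪⟫-+·ˡ x a w v) (trans (cong (λ b → ⟪ x , v ⟫ + a * b) ⟪w,v⟫≡1) (cong (⟪ x , v ⟫ +_) (*-identityʳ a)))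

    -- Splitting off the line of w identifies the space with `v ⊥` times the field. The factor q
    -- stays on the left so that the exponent d - 1 is avoided.
    ∣v⊥∣q : ∣ v ⊥ ∣ ℕ.* q ≡ q ℕ.^ d
    ∣v⊥∣q = begin
      ∣ v ⊥ ∣ ℕ.* q                      ≡⟨ cong (∣ v ⊥ ∣ ℕ.*_) ∣full-Carrier∣ ⟨
      ∣ v ⊥ ∣ ℕ.* ∣ full {Carrier} ∣     ≡⟨ ∣⊗∣ (v ⊥) (full {Carrier}) ⟨
      ∣ v ⊥ ⊗ full {Carrier} ∣
        ≡⟨ bijection⇒∣∣≡ (v ⊥ ⊗ full {Carrier}) full (λ (y , a) → y +ⱽ a · w) _
            (λ { (y , a) (y′ , a′) (y⊥ , _) (y′⊥ , _) eq → injective y y′ a a′ y⊥ y′⊥ eq })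
            (λ x _ → (project v w x , ⟪ x , v ⟫) , (project-⊥ x , tt) , [x-ay]+ay _ x w) ⟩
      ∣ full {Point} ∣                   ≡⟨ ∣Point∣ ⟩
      q ℕ.^ d ∎
      where
      level : ∀ {y} a → y ∈ v ⊥ → ⟪ y +ⱽ a · w , v ⟫ ≡ a
      level {y} a y⊥ = trans (level-+·w y a) (trans (cong (_+ a) y⊥) (+-identityˡ a))

      injective : ∀ y y′ a a′ → y ∈ v ⊥ → y′ ∈ v ⊥ → y +ⱽ a · w ≡ y′ +ⱽ a′ · w → (y , a) ≡ (y′ , a′)
      injective y y′ a a′ y⊥ y′⊥ eq with refl ← trans (sym (level a y⊥)) (trans (cong (λ x → ⟪ x , v ⟫) eq) (level a′ y′⊥)) =
        cong (_, a) (+ⱽ-cancelʳ (a · w) eq)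

    abstract
      -- The vector e is orthogonal to w as well as to v, so projecting x along w preserves its
      -- nonzero pairing with e. This leaves two vectors of `v ⊥` to which polarisation applies.
      anisotropic-in-v⊥ : 3 ≤ d → ∃[ u ] u ∈ v ⊥ × Q u ≢ 0#
      anisotropic-in-v⊥ 3≤d
        with e , e≢0 , e⊥ ← common-orthogonal 3≤d (v ∷ w ∷ [])
        with x , ⟪x,e⟫≢0 ← nonzero-pairing e≢0 =
        cases (anisotropic-combination x′ e (⟪x,e⟫≢0 ∘ trans (sym (project-⟪⟫ (trans (⟪⟫-sym w e) (e⊥ (suc zero))) x))))
        where
        x′ : Point
        x′ = project v w x

        cases : Q x′ ≢ 0# ⊎ Q e ≢ 0# ⊎ Q (x′ +ⱽ e) ≢ 0# → ∃[ u ] u ∈ v ⊥ × Q u ≢ 0#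
        cases (inj₁ Q≢0)        = x′ , project-⊥ x , Q≢0
        cases (inj₂ (inj₁ Q≢0)) = e , e⊥ zero , Q≢0
        cases (inj₂ (inj₂ Q≢0)) = x′ +ⱽ e , +-⊥ v (project-⊥ x) (e⊥ zero) , Q≢0

    abstract
      -- The three vectors v, w, y are independent, so 4 ≤ d leaves a common orthogonal
      -- vector e, which is not in the radical of v⊥ ∩ y⊥.
      anisotropic-in-v⊥∩y⊥ : 4 ≤ d → ∀ {y} → y ∈ v ⊥ → Q y ≢ 0# → ⟪ w , y ⟫ ≡ 0# →
                             ∃[ u ] u ∈ v ⊥ × u ∈ y ⊥ × Q u ≢ 0#
      anisotropic-in-v⊥∩y⊥ 4≤d {y} y⊥v Qy≢0 w⊥y
        with e , e≢0 , e⊥ ← common-orthogonal 4≤d (v ∷ w ∷ y ∷ [])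
        with x , ⟪x,e⟫≢0 ← nonzero-pairing e≢0 =
        cases (anisotropic-combination x′ e (⟪x,e⟫≢0 ∘ trans (sym ⟪x′,e⟫≡⟪x,e⟫)))
        where
        x′ : Point
        x′ = reject y (project v w x)

        e⊥y : e ∈ y ⊥
        e⊥y = e⊥ (suc (suc zero))

        x′⊥v : x′ ∈ v ⊥
        x′⊥v = trans (reject-⟪⟫ y⊥v (project v w x)) (project-⊥ x)

        x′⊥y : x′ ∈ y ⊥
        x′⊥y = reject-⊥ Qy≢0 (project v w x)

        ⟪x′,e⟫≡⟪x,e⟫ : ⟪ x′ , e ⟫ ≡ ⟪ x , e ⟫
        ⟪x′,e⟫≡⟪x,e⟫ = trans (reject-⟪⟫ (trans (⟪⟫-sym y e) e⊥y) (project v w x))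
          (project-⟪⟫ (trans (⟪⟫-sym w e) (e⊥ (suc zero))) x)

        cases : Q x′ ≢ 0# ⊎ Q e ≢ 0# ⊎ Q (x′ +ⱽ e) ≢ 0# → ∃[ u ] u ∈ v ⊥ × u ∈ y ⊥ × Q u ≢ 0#
        cases (inj₁ Q≢0)        = x′ , x′⊥v , x′⊥y , Q≢0
        cases (inj₂ (inj₁ Q≢0)) = e , e⊥ zero , e⊥y , Q≢0
        cases (inj₂ (inj₂ Q≢0)) = x′ +ⱽ e , +-⊥ v x′⊥v (e⊥ zero) , +-⊥ y x′⊥y e⊥y , Q≢0

  module _ {v w : Point} (hyperbolic : HyperbolicPair v w) where
    ∣v⊥∩sphere∣≤ : 3 ≤ d → ∀ r → ∣ fibre (v ⊥) Q r ∣ ℕ.* (q ℕ.* q) ≤ 2 ℕ.* q ℕ.^ d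
    ∣v⊥∩sphere∣≤ 3≤d r = begin
      m ℕ.* (q ℕ.* q)              ≡⟨ rearrange q m ⟩
      q ℕ.* m ℕ.* q                ≡⟨ cong (λ m → q ℕ.* m ℕ.* q) at-origin ⟨
      q ℕ.* ∣ S ∣ ℕ.* q
        ≤⟨ ℕ.*-monoˡ-≤ q (line-bound (v ⊥) e 0ⱽ r closed λ _ _ → Qe≢0 ∘ proj₁) ⟩
      2 ℕ.* ∣ v ⊥ ∣ ℕ.* q          ≡⟨ ℕ.*-assoc 2 ∣ v ⊥ ∣ q ⟩
      2 ℕ.* (∣ v ⊥ ∣ ℕ.* q)        ≡⟨ cong (2 ℕ.*_) (∣v⊥∣q hyperbolic) ⟩
      2 ℕ.* q ℕ.^ d ∎
      where
      open ℕ.≤-Reasoning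
      rearrange : ∀ q m → m ℕ.* (q ℕ.* q) ≡ q ℕ.* m ℕ.* q
      rearrange = solve-∀

      e : Point
      e = proj₁ (anisotropic-in-v⊥ hyperbolic 3≤d)

      e⊥ : e ∈ v ⊥
      e⊥ = proj₁ (proj₂ (anisotropic-in-v⊥ hyperbolic 3≤d))

      Qe≢0 : Q e ≢ 0#
      Qe≢0 = proj₂ (proj₂ (anisotropic-in-v⊥ hyperbolic 3≤d))

      m : ℕ
      m = ∣ fibre (v ⊥) Q r ∣

      S : Subset Point
      S = v ⊥ ∩ sphere 0ⱽ r

      at-origin : ∣ S ∣ ≡ m
      at-origin = ≐⇒∣∣≡ S (fibre (v ⊥) Q r)
        (λ x (x⊥ , eq) → x⊥ , trans (cong Q (sym (x-0 x))) eq) (λ x (x⊥ , eq) → x⊥ , trans (cong Q (x-0 x)) eq)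

      closed : ∀ s x → x ∈ v ⊥ → x +ⱽ s · e ∈ v ⊥
      closed s x x⊥ = trans (⟪⟫-+·ˡ x s e v) (trans (cong₂ (λ a b → a + s * b) x⊥ e⊥)
        (solve 1 (λ s → con (ℤ.+ 0) :+ s :* con (ℤ.+ 0) := con (ℤ.+ 0)) refl s))

    -- The nonzero values of Q share at least q ^ (d - 1) - 2 q ^ (d - 2) points of v⊥.
    abstract
      popular-radius : 3 ≤ d → 5 ≤ q → ∃[ R ] R ≢ 0# × q ℕ.^ d ≤ 2 ℕ.* (∣ fibre (v ⊥) Q R ∣ ℕ.* (q ℕ.* q))
      popular-radius 3≤d 5≤q
        with ∃? (λ R → ¬? (R ≟ 0#) ×-dec (q ℕ.^ d ℕ.≤? 2 ℕ.* (∣ fibre (v ⊥) Q R ∣ ℕ.* (q ℕ.* q))))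
      ... | yes found = found
      ... | no  none  = contradiction 5≤q (ℕ.≤⇒≯ (ℕ.*-cancelˡ-≤ (q ℕ.^ d) {{q^d≢0}}
                          (ℕ.+-cancelˡ-≤ (q ℕ.^ d ℕ.* q) _ _ counting)))
        where
        open ℕ.≤-Reasoning
        q^d≢0 : NonZero (q ℕ.^ d)
        q^d≢0 = ℕ.m^n≢0 q d {{nonZero}}

        zero-set : Subset Carrier
        zero-set = ⟨ (0# ≡_) ∣ (0# ≟_) ⟩

        m : Carrier → ℕ
        m R = ∣ fibre (v ⊥) Q R ∣

        rearrange₁ : ∀ q m → 2 ℕ.* q ℕ.* m ≡ 2 ℕ.* (m ℕ.* q)
        rearrange₁ = solve-∀

        rearrange₂ : ∀ m → 2 ℕ.* (2 ℕ.* m) ≡ 4 ℕ.* m ℕ.* 1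
        rearrange₂ = solve-∀

        rearrange₃ : ∀ m q → m ℕ.* q ℕ.* q ℕ.+ m ℕ.* q ℕ.* q ≡ 2 ℕ.* (q ℕ.* q) ℕ.* m
        rearrange₃ = solve-∀

        -- Suppose that no nonzero radius is popular. The radius 0, about which nothing is supposed,
        -- is covered by the line bound and costs the extra 4 q ^ d. Summing over R gives 2 q · q ^
        -- d ≤ q · q ^ d + 4 q ^ d, that is q ≤ 4.
        bound : ∀ R → 2 ℕ.* (q ℕ.* q) ℕ.* m R ≤ q ℕ.^ d ℕ.* 𝟙 (R ∈? full {Carrier}) ℕ.+ 4 ℕ.* q ℕ.^ d ℕ.* 𝟙 (R ∈? zero-set)
        bound R with 0# ≟ R
        ... | yes refl = begin
          2 ℕ.* (q ℕ.* q) ℕ.* m R             ≡⟨ rearrange₁ (q ℕ.* q) (m R) ⟩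
          2 ℕ.* (m R ℕ.* (q ℕ.* q))           ≤⟨ ℕ.*-monoʳ-≤ 2 (∣v⊥∩sphere∣≤ 3≤d R) ⟩
          2 ℕ.* (2 ℕ.* q ℕ.^ d)               ≡⟨ rearrange₂ (q ℕ.^ d) ⟩
          4 ℕ.* q ℕ.^ d ℕ.* 1                 ≤⟨ ℕ.m≤n+m (4 ℕ.* q ℕ.^ d ℕ.* 1) (q ℕ.^ d ℕ.* 1) ⟩
          q ℕ.^ d ℕ.* 1 ℕ.+ 4 ℕ.* q ℕ.^ d ℕ.* 1 ∎
        ... | no 0≢R = begin
          2 ℕ.* (q ℕ.* q) ℕ.* m R             ≡⟨ rearrange₁ (q ℕ.* q) (m R) ⟩
          2 ℕ.* (m R ℕ.* (q ℕ.* q))           ≤⟨ ℕ.≰⇒≥ (λ le → none (R , 0≢R ∘ sym , le)) ⟩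
          q ℕ.^ d                             ≡⟨ ℕ.*-identityʳ (q ℕ.^ d) ⟨
          q ℕ.^ d ℕ.* 1                       ≤⟨ ℕ.m≤m+n (q ℕ.^ d ℕ.* 1) (4 ℕ.* q ℕ.^ d ℕ.* 0) ⟩
          q ℕ.^ d ℕ.* 1 ℕ.+ 4 ℕ.* q ℕ.^ d ℕ.* 0 ∎

        counting : q ℕ.^ d ℕ.* q ℕ.+ q ℕ.^ d ℕ.* q ≤ q ℕ.^ d ℕ.* q ℕ.+ q ℕ.^ d ℕ.* 4
        counting = begin
          q ℕ.^ d ℕ.* q ℕ.+ q ℕ.^ d ℕ.* q
            ≡⟨ cong (λ m → m ℕ.* q ℕ.+ m ℕ.* q) (∣v⊥∣q hyperbolic) ⟨
          ∣ v ⊥ ∣ ℕ.* q ℕ.* q ℕ.+ ∣ v ⊥ ∣ ℕ.* q ℕ.* q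
            ≡⟨ rearrange₃ ∣ v ⊥ ∣ q ⟩
          2 ℕ.* (q ℕ.* q) ℕ.* ∣ v ⊥ ∣
            ≡⟨ cong (2 ℕ.* (q ℕ.* q) ℕ.*_) (∣∣≡∑fibres (v ⊥) Q) ⟩
          2 ℕ.* (q ℕ.* q) ℕ.* total (λ R → ∣ fibre (v ⊥) Q R ∣)
            ≡⟨ total-* {Carrier} (2 ℕ.* (q ℕ.* q)) m ⟨
          total (λ R → 2 ℕ.* (q ℕ.* q) ℕ.* ∣ fibre (v ⊥) Q R ∣)
            ≤⟨ sum-mono bound (elements {Carrier}) ⟩
          total (λ R → q ℕ.^ d ℕ.* 𝟙 (R ∈? full {Carrier}) ℕ.+ 4 ℕ.* q ℕ.^ d ℕ.* 𝟙 (R ∈? zero-set))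
            ≡⟨ sum-+ (λ R → q ℕ.^ d ℕ.* 𝟙 (R ∈? full {Carrier})) (λ R → 4 ℕ.* q ℕ.^ d ℕ.* 𝟙 (R ∈? zero-set)) (elements {Carrier}) ⟩
          total (λ R → q ℕ.^ d ℕ.* 𝟙 (R ∈? full {Carrier})) ℕ.+ total (λ R → 4 ℕ.* q ℕ.^ d ℕ.* 𝟙 (R ∈? zero-set))
            ≡⟨ cong₂ ℕ._+_ (trans (total-indicator (q ℕ.^ d) (full {Carrier})) (cong (q ℕ.^ d ℕ.*_) ∣full-Carrier∣))
                           (trans (total-* {Carrier} (4 ℕ.* q ℕ.^ d) (λ R → 𝟙 (R ∈? zero-set))) (cong (4 ℕ.* q ℕ.^ d ℕ.*_) (total-δ 0#))) ⟩
          q ℕ.^ d ℕ.* q ℕ.+ 4 ℕ.* q ℕ.^ d ℕ.* 1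
            ≡⟨ cong (q ℕ.^ d ℕ.* q ℕ.+_) (trans (ℕ.*-identityʳ (4 ℕ.* q ℕ.^ d)) (ℕ.*-comm 4 (q ℕ.^ d))) ⟩
          q ℕ.^ d ℕ.* q ℕ.+ q ℕ.^ d ℕ.* 4 ∎

-- Intersections of a block system with flats

module FlatBounds {q d} {V : QuadraticSpace q d} (q-odd : ¬ (2 ∣ q)) (B : BlockSystem V) (4≤d : 4 ≤ d) where
  open Geometry V
  open FieldProperties 𝔽
  open VectorIdentities 𝔽
  open QuadraticProperties V q-odd
  open IsotropicHyperplane V q-odd
  open BlockSystem B hiding (blocks; CrossBlocksVanish; ExactCentredBlocks)
  open BlockCounts q-odd B

  hyperbolic : HyperbolicPair v w
  hyperbolic = record { Qv≡0 = Qv≡0 ; ⟪w,v⟫≡1 = ⟪w,v⟫≡1 }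

  module _ (L : Flat) where
    open Flat L

    difference : ∀ {x y} → x ∈ points → y ∈ points → x -ⱽ y ∈ direction
    difference {x} {y} x∈ y∈ = subst (_∈ direction) (trans (sym (-ⱽ-as-+ⱽ (x -ⱽ base) (y -ⱽ base))) ([x-y]-[z-y] x base y))
      (+-closed _ _ x∈ (·-closed (- 1#) _ y∈))

    translate : ∀ {x e} s → x ∈ points → e ∈ direction → x +ⱽ s · e ∈ points
    translate {x} {e} s x∈ e∈ = subst (_∈ direction) (sym ([x+ay]-z s x e base)) (+-closed _ _ x∈ (·-closed s e e∈))

    slice : Carrier → Subset Point
    slice z = fibre points level z

    slice-difference : ∀ {z x y} → x ∈ slice z → y ∈ slice z → x -ⱽ y ∈ direction × x -ⱽ y ∈ v ⊥
    slice-difference {z} {x} {y} (x∈ , x-level) (y∈ , y-level) =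
      difference x∈ y∈ , trans (⟪⟫--ˡ x y v) (x≡y⇒x-y≡0 (trans x-level (sym y-level)))

    slice-translate : ∀ {z e} → e ∈ direction → e ∈ v ⊥ → ∀ s x → x ∈ slice z → x +ⱽ s · e ∈ slice z
    slice-translate {z} {e} e∈ e⊥ s x (x∈ , x-level) = translate s x∈ e∈ , (begin
      level (x +ⱽ s · e)       ≡⟨ ⟪⟫-+·ˡ x s e v ⟩
      level x + s * level e    ≡⟨ cong₂ (λ a b → a + s * b) x-level e⊥ ⟩
      z + s * 0#               ≡⟨ solve 2 (λ z s → z :+ s :* con (ℤ.+ 0) := z) refl z s ⟩
      z ∎)
      where open ≡-Reasoning

    multiple∈⇒≡ : ∀ {a b y} → y ∉ direction → (b - a) · y ∈ direction → a ≡ b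
    multiple∈⇒≡ {a} {b} {y} y∉ ∈D with (b - a) ≟ 0#
    ... | yes b-a≡0 = sym (x-y≡0⇒x≡y b-a≡0)
    ... | no  b-a≢0 = contradiction (subst (_∈ direction) (·-cancel b-a≢0 y) (·-closed _ _ ∈D)) y∉

    level-+· : ∀ x a {y} → y ∈ v ⊥ → level (x +ⱽ a · y) ≡ level x
    level-+· x a {y} y⊥ = trans (⟪⟫-+·ˡ x a y v) (trans (cong (λ b → level x + a * b) y⊥)
      (solve 2 (λ z s → z :+ s :* con (ℤ.+ 0) := z) refl (level x) a))

    -- A slice has codimension at least two: in x + a y + b w the level recovers b, and y lying
    -- outside the directions of the flat then recovers a.
    ∣slice∣≤ : ∀ {y} → y ∈ v ⊥ → y ∉ direction → ∀ z → ∣ slice z ∣ ℕ.* (q ℕ.* q) ≤ q ℕ.^ d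
    ∣slice∣≤ {y} y⊥ y∉ z = begin
      ∣ slice z ∣ ℕ.* (q ℕ.* q)
        ≡⟨ cong (λ a → ∣ slice z ∣ ℕ.* (a ℕ.* a)) ∣full-Carrier∣ ⟨
      ∣ slice z ∣ ℕ.* (∣ full {Carrier} ∣ ℕ.* ∣ full {Carrier} ∣)
        ≡⟨ cong (∣ slice z ∣ ℕ.*_) (∣⊗∣ (full {Carrier}) (full {Carrier})) ⟨
      ∣ slice z ∣ ℕ.* ∣ full {Carrier} ⊗ full {Carrier} ∣
        ≡⟨ ∣⊗∣ (slice z) (full {Carrier} ⊗ full {Carrier}) ⟨
      ∣ slice z ⊗ full {Carrier} ⊗ full {Carrier} ∣
        ≤⟨ injection⇒∣∣≤ (slice z ⊗ full {Carrier} ⊗ full {Carrier}) full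
            (λ (x , a , b) → (x +ⱽ a · y) +ⱽ b · w) (λ _ _ → tt)
            (λ { (x , a , b) (x′ , a′ , b′) (x∈ , _) (x′∈ , _) eq → injective x∈ x′∈ a a′ b b′ eq }) ⟩
      ∣ full {Point} ∣                                                  ≡⟨ ∣Point∣ ⟩
      q ℕ.^ d ∎
      where
      open ℕ.≤-Reasoning
      level-image : ∀ {x} → x ∈ slice z → ∀ a b → level ((x +ⱽ a · y) +ⱽ b · w) ≡ z + b
      level-image {x} x∈ a b = trans (level-+·w hyperbolic _ b) (cong (_+ b) (trans (level-+· x a y⊥) (proj₂ x∈)))

      injective : ∀ {x x′} → x ∈ slice z → x′ ∈ slice z → ∀ a a′ b b′ →
                  (x +ⱽ a · y) +ⱽ b · w ≡ (x′ +ⱽ a′ · y) +ⱽ b′ · w → (x , a , b) ≡ (x′ , a′ , b′)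
      injective {x} {x′} x∈ x′∈ a a′ b b′ eq = cong₂ _,_ x≡x′ (cong₂ _,_ a≡a′ b≡b′)
        where
        b≡b′ : b ≡ b′
        b≡b′ = +-cancelˡ z (trans (sym (level-image x∈ a b)) (trans (cong level eq) (level-image x′∈ a′ b′)))

        eq₁ : x +ⱽ a · y ≡ x′ +ⱽ a′ · y
        eq₁ = +·-cancel b≡b′ eq

        a≡a′ : a ≡ a′
        a≡a′ = multiple∈⇒≡ y∉ (subst (_∈ direction) (x+ay≡z+by⇒x-z eq₁) (proj₁ (slice-difference x∈ x′∈)))

        x≡x′ : x ≡ x′
        x≡x′ = +·-cancel a≡a′ eq₁

    Isotropic-directions : Set
    Isotropic-directions = ∀ e → e ∈ direction → e ∈ v ⊥ → Q e ≡ 0#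

    -- Polarisation within the directions lying in `v ⊥`, which are closed under addition.
    isotropic⇒⟪⟫≡0 : Isotropic-directions → ∀ {e f} → e ∈ direction → e ∈ v ⊥ → f ∈ direction → f ∈ v ⊥ → ⟪ e , f ⟫ ≡ 0#
    isotropic⇒⟪⟫≡0 isotropic {e} {f} e∈ e⊥ f∈ f⊥ = x≢0∧xy≡0⇒y≡0 2#≢0 (begin
      2# * ⟪ e , f ⟫
        ≡⟨ solve 1 (λ a → a := con (ℤ.+ 0) :+ a :+ con (ℤ.+ 0)) refl (2# * ⟪ e , f ⟫) ⟩
      0# + 2# * ⟪ e , f ⟫ + 0#
        ≡⟨ cong₂ (λ a b → a + 2# * ⟪ e , f ⟫ + b) (isotropic e e∈ e⊥) (isotropic f f∈ f⊥) ⟨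
      Q e + 2# * ⟪ e , f ⟫ + Q f       ≡⟨ Q-+ e f ⟨
      Q (e +ⱽ f)                       ≡⟨ isotropic (e +ⱽ f) (+-closed e f e∈ f∈) (+-⊥ v e⊥ f⊥) ⟩
      0# ∎)
      where open ≡-Reasoning

    -- Here the directions of the slice meet the span of w, y and u trivially.
    ∣isotropic-slice∣≤ : Isotropic-directions → ∀ {y} → y ∈ v ⊥ → Q y ≢ 0# →
                         (∀ e → e ∈ direction → e ∈ v ⊥ → ⟪ e , y ⟫ ≡ 0#) →
                         ∀ z → ∣ slice z ∣ ℕ.* (q ℕ.* (q ℕ.* q)) ≤ q ℕ.^ d
    ∣isotropic-slice∣≤ isotropic {y} y⊥v Qy≢0 D⊥y z = begin
      ∣ slice z ∣ ℕ.* (q ℕ.* (q ℕ.* q))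
        ≡⟨ cong (λ a → ∣ slice z ∣ ℕ.* (a ℕ.* (a ℕ.* a))) ∣full-Carrier∣ ⟨
      ∣ slice z ∣ ℕ.* (∣ 𝔽¹ ∣ ℕ.* (∣ 𝔽¹ ∣ ℕ.* ∣ 𝔽¹ ∣))
        ≡⟨ cong (λ m → ∣ slice z ∣ ℕ.* (∣ 𝔽¹ ∣ ℕ.* m)) (∣⊗∣ 𝔽¹ 𝔽¹) ⟨
      ∣ slice z ∣ ℕ.* (∣ 𝔽¹ ∣ ℕ.* ∣ 𝔽¹ ⊗ 𝔽¹ ∣)
        ≡⟨ cong (∣ slice z ∣ ℕ.*_) (∣⊗∣ 𝔽¹ (𝔽¹ ⊗ 𝔽¹)) ⟨
      ∣ slice z ∣ ℕ.* ∣ 𝔽¹ ⊗ 𝔽¹ ⊗ 𝔽¹ ∣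
        ≡⟨ ∣⊗∣ (slice z) (𝔽¹ ⊗ 𝔽¹ ⊗ 𝔽¹) ⟨
      ∣ slice z ⊗ 𝔽¹ ⊗ 𝔽¹ ⊗ 𝔽¹ ∣
        ≤⟨ injection⇒∣∣≤ (slice z ⊗ 𝔽¹ ⊗ 𝔽¹ ⊗ 𝔽¹) full
            (λ (x , a , b , c) → ((x +ⱽ a · u) +ⱽ b · y) +ⱽ c · w′) (λ _ _ → tt)
            (λ { (x , a , b , c) (x′ , a′ , b′ , c′) (x∈ , _) (x′∈ , _) eq → injective x∈ x′∈ a a′ b b′ c c′ eq }) ⟩
      ∣ full {Point} ∣                                                  ≡⟨ ∣Point∣ ⟩
      q ℕ.^ d ∎
      where
      open ℕ.≤-Reasoning
      𝔽¹ : Subset Carrier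
      𝔽¹ = full

      -- `anisotropic-in-v⊥∩y⊥` asks for a partner of v orthogonal to y, which the rejection
      -- provides while still pairing to 1 with v.
      w′ : Point
      w′ = reject y w

      hyperbolic′ : HyperbolicPair v w′
      hyperbolic′ = record { Qv≡0 = Qv≡0 ; ⟪w,v⟫≡1 = trans (reject-⟪⟫ y⊥v w) ⟪w,v⟫≡1 }

      anisotropic : ∃[ u ] u ∈ v ⊥ × u ∈ y ⊥ × Q u ≢ 0#
      anisotropic = anisotropic-in-v⊥∩y⊥ hyperbolic′ 4≤d y⊥v Qy≢0 (reject-⊥ Qy≢0 w)

      u : Point
      u = proj₁ anisotropic

      u⊥v : u ∈ v ⊥
      u⊥v = proj₁ (proj₂ anisotropic)

      u⊥y : u ∈ y ⊥
      u⊥y = proj₁ (proj₂ (proj₂ anisotropic))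

      Qu≢0 : Q u ≢ 0#
      Qu≢0 = proj₂ (proj₂ (proj₂ anisotropic))

      pairing-y : ∀ x a b → ⟪ (x +ⱽ a · u) +ⱽ b · y , y ⟫ ≡ ⟪ x , y ⟫ + b * Q y
      pairing-y x a b = trans (⟪⟫-+·ˡ _ b y y) (cong₂ (λ p r → p + b * r) (trans (⟪⟫-+·ˡ x a u y)
        (trans (cong (λ p → ⟪ x , y ⟫ + a * p) u⊥y) (solve 2 (λ p a → p :+ a :* con (ℤ.+ 0) := p) refl ⟪ x , y ⟫ a))) (⟪x,x⟫≡Qx y))

      level-image : ∀ {x} → x ∈ slice z → ∀ a b c → level (((x +ⱽ a · u) +ⱽ b · y) +ⱽ c · w′) ≡ z + c
      level-image {x} x∈ a b c = trans (level-+·w hyperbolic′ _ c)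
        (cong (_+ c) (trans (level-+· _ b y⊥v) (trans (level-+· x a u⊥v) (proj₂ x∈))))

      same-y : ∀ {x x′} → x ∈ slice z → x′ ∈ slice z → ⟪ x , y ⟫ ≡ ⟪ x′ , y ⟫
      same-y {x} {x′} x∈ x′∈ = x-y≡0⇒x≡y (trans (sym (⟪⟫--ˡ x x′ y))
        (D⊥y (x -ⱽ x′) (proj₁ (slice-difference x∈ x′∈)) (proj₂ (slice-difference x∈ x′∈))))

      -- Otherwise a nonzero multiple of u would be a direction of the slice, although Q u ≠ 0 and
      -- all these directions are isotropic.
      same-a : ∀ {x x′} → x ∈ slice z → x′ ∈ slice z → ∀ a a′ → x +ⱽ a · u ≡ x′ +ⱽ a′ · u → a ≡ a′
      same-a {x} {x′} x∈ x′∈ a a′ eq = decidable-stable (a ≟ a′) λ a≢a′ →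
        let a′-a≢0 = a≢a′ ∘ sym ∘ x-y≡0⇒x≡y in
        *-≢0 (*-≢0 a′-a≢0 a′-a≢0) Qu≢0 (trans (sym (homogeneous (a′ - a) u)) (trans
          (cong Q (sym (x+ay≡z+by⇒x-z eq)))
          (isotropic (x -ⱽ x′) (proj₁ (slice-difference x∈ x′∈)) (proj₂ (slice-difference x∈ x′∈)))))

      -- The coordinates come off from the outside: c by the level, b by pairing with y, a by the
      -- value of Q.
      injective : ∀ {x x′} → x ∈ slice z → x′ ∈ slice z → ∀ a a′ b b′ c c′ →
                  ((x +ⱽ a · u) +ⱽ b · y) +ⱽ c · w′ ≡ ((x′ +ⱽ a′ · u) +ⱽ b′ · y) +ⱽ c′ · w′ → (x , a , b , c) ≡ (x′ , a′ , b′ , c′)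
      injective {x} {x′} x∈ x′∈ a a′ b b′ c c′ eq = cong₂ _,_ x≡x′ (cong₂ _,_ a≡a′ (cong₂ _,_ b≡b′ c≡c′))
        where
        c≡c′ : c ≡ c′
        c≡c′ = +-cancelˡ z (trans (sym (level-image x∈ a b c)) (trans (cong level eq) (level-image x′∈ a′ b′ c′)))

        eq₁ : (x +ⱽ a · u) +ⱽ b · y ≡ (x′ +ⱽ a′ · u) +ⱽ b′ · y
        eq₁ = +·-cancel c≡c′ eq

        b≡b′ : b ≡ b′
        b≡b′ = *-cancelʳ Qy≢0 (+-cancelˡ ⟪ x , y ⟫ (trans (sym (pairing-y x a b))
          (trans (cong (λ p → ⟪ p , y ⟫) eq₁) (trans (pairing-y x′ a′ b′) (cong (_+ b′ * Q y) (sym (same-y x∈ x′∈)))))))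

        eq₂ : x +ⱽ a · u ≡ x′ +ⱽ a′ · u
        eq₂ = +·-cancel b≡b′ eq₁

        a≡a′ : a ≡ a′
        a≡a′ = same-a x∈ x′∈ a a′ eq₂

        x≡x′ : x ≡ x′
        x≡x′ = +·-cancel a≡a′ eq₂

    module _ {y₁ : Point} (y₁⊥ : y₁ ∈ v ⊥) (y₁∉ : y₁ ∉ direction) (z : Carrier) where
      private
        open ℕ.≤-Reasoning

        section : Subset Point
        section = slice z ∩ sphere (c z) R

        q³ : ℕ
        q³ = q ℕ.* (q ℕ.* q)

        rearrange : ∀ m q → m ℕ.* (q ℕ.* (q ℕ.* q)) ≡ (q ℕ.* m) ℕ.* (q ℕ.* q)
        rearrange = solve-∀

        along-line : ∀ e → e ∈ direction → e ∈ v ⊥ →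
                     (∀ x → x ∈ slice z → ¬ (Q e ≡ 0# × ⟪ x -ⱽ c z , e ⟫ ≡ 0#)) →
                     ∣ section ∣ ℕ.* q³ ≤ 2 ℕ.* q ℕ.^ d
        along-line e e∈ e⊥ nontrivial = begin
          ∣ section ∣ ℕ.* q³                       ≡⟨ rearrange ∣ section ∣ q ⟩
          (q ℕ.* ∣ section ∣) ℕ.* (q ℕ.* q)
            ≤⟨ ℕ.*-monoˡ-≤ (q ℕ.* q) (line-bound (slice z) e (c z) R (slice-translate e∈ e⊥) nontrivial) ⟩
          (2 ℕ.* ∣ slice z ∣) ℕ.* (q ℕ.* q)        ≡⟨ ℕ.*-assoc 2 ∣ slice z ∣ (q ℕ.* q) ⟩
          2 ℕ.* (∣ slice z ∣ ℕ.* (q ℕ.* q))        ≤⟨ ℕ.*-monoʳ-≤ 2 (∣slice∣≤ y₁⊥ y₁∉ z) ⟩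
          2 ℕ.* q ℕ.^ d ∎

        isotropic-case : Isotropic-directions → ∀ x → x ∈ section →
                         Dec (∃[ e ] (e ∈ direction × e ∈ v ⊥) × ⟪ x -ⱽ c z , e ⟫ ≢ 0#) →
                         ∣ section ∣ ℕ.* q³ ≤ 2 ℕ.* q ℕ.^ d
        isotropic-case isotropic x (x∈ , Qy≡R) (yes (e , (e∈ , e⊥) , ⟪y,e⟫≢0)) =
          along-line e e∈ e⊥ λ x′ x′∈ (_ , ⟪y′,e⟫≡0) → ⟪y,e⟫≢0 (trans (same-pairing x′ x′∈) ⟪y′,e⟫≡0)
          where
          -- The directions of the slice are mutually orthogonal, so the pairing with e is constant
          -- on it; one nonzero value excludes the degenerate case of `line-bound` at every point.
          same-pairing : ∀ x′ → x′ ∈ slice z → ⟪ x -ⱽ c z , e ⟫ ≡ ⟪ x′ -ⱽ c z , e ⟫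
          same-pairing x′ x′∈ = x-y≡0⇒x≡y (trans (sym (⟪⟫--ˡ (x -ⱽ c z) (x′ -ⱽ c z) e))
            (trans (cong (λ f → ⟪ f , e ⟫) ([x-y]-[z-y] x (c z) x′))
              (isotropic⇒⟪⟫≡0 isotropic (proj₁ (slice-difference x∈ x′∈)) (proj₂ (slice-difference x∈ x′∈)) e∈ e⊥)))
        -- Every direction is tangent here, so the sphere may contain the whole slice and lines save
        -- nothing. The third codimension of the slice compensates; it needs x - c z anisotropic,
        -- which holds because its value is R.
        isotropic-case isotropic x (x∈ , Qy≡R) (no none) = begin
          ∣ section ∣ ℕ.* q³     ≤⟨ ℕ.*-monoˡ-≤ q³ (⊆⇒∣∣≤ section (slice z) (λ _ → proj₁)) ⟩
          ∣ slice z ∣ ℕ.* q³     ≤⟨ ∣isotropic-slice∣≤ isotropic {x -ⱽ c z}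
                                      (trans (level-[x-c] x z) (x≡y⇒x-y≡0 (proj₂ x∈)))
                                      (R≢0 ∘ trans (sym Qy≡R))
                                      (λ e e∈ e⊥ → trans (⟪⟫-sym e _) (decidable-stable (⟪ x -ⱽ c z , e ⟫ ≟ 0#) λ neq → none (e , (e∈ , e⊥) , neq))) z ⟩
          q ℕ.^ d                ≤⟨ ℕ.m≤m+n (q ℕ.^ d) _ ⟩
          2 ℕ.* q ℕ.^ d ∎

        nonempty-case : ∀ x → x ∈ section → Dec (∃[ e ] (e ∈ direction × e ∈ v ⊥) × Q e ≢ 0#) →
                        ∣ section ∣ ℕ.* q³ ≤ 2 ℕ.* q ℕ.^ d
        nonempty-case x x∈ (yes (e , (e∈ , e⊥) , Qe≢0)) = along-line e e∈ e⊥ λ _ _ → Qe≢0 ∘ proj₁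
        nonempty-case x x∈ (no none) = isotropic-case
          (λ e e∈ e⊥ → decidable-stable (Q e ≟ 0#) λ Qe≢0 → none (e , (e∈ , e⊥) , Qe≢0)) x x∈
          (∃? λ e → ((e ∈? direction) ×-dec (e ∈? v ⊥)) ×-dec ¬? (⟪ x -ⱽ c z , e ⟫ ≟ 0#))

        all-cases : Dec (∃[ x ] x ∈ section) → ∣ section ∣ ℕ.* q³ ≤ 2 ℕ.* q ℕ.^ d
        all-cases (yes (x , x∈)) = nonempty-case x x∈ (∃? λ e → ((e ∈? direction) ×-dec (e ∈? v ⊥)) ×-dec ¬? (Q e ≟ 0#))
        all-cases (no empty)     = subst (λ m → m ℕ.* q³ ≤ 2 ℕ.* q ℕ.^ d)
          (sym (∅⇒∣∣≡0 section λ x x∈ → empty (x , x∈))) z≤n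

      ∣A∩L∣≤ : ∣ A z ∩ points ∣ ℕ.* (q ℕ.* (q ℕ.* q)) ≤ 2 ℕ.* q ℕ.^ d
      ∣A∩L∣≤ = ℕ.≤-trans
        (ℕ.*-monoˡ-≤ q³ (⊆⇒∣∣≤ (A z ∩ points) section (λ x (x∈A , x∈L) → (x∈L , level-A x∈A) , proj₂ x∈A)))
        (all-cases (∃? (_∈? section)))

    module _ (t≤q : t ≤ q) (popular : q ℕ.^ d ≤ 2 ℕ.* (n ℕ.* (q ℕ.* q))) (proper : Proper) where
      private
        open ℕ.≤-Reasoning

        instance
          q≢0 : NonZero q
          q≢0 = nonZero

        rearrange : ∀ m q → m ℕ.* (q ℕ.* (q ℕ.* q)) ≡ m ℕ.* q ℕ.* (q ℕ.* q)
        rearrange = solve-∀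

        rearrange₂ : ∀ n q → 2 ℕ.* (2 ℕ.* (n ℕ.* q)) ≡ 4 ℕ.* n ℕ.* q
        rearrange₂ = solve-∀

        rearrange₃ : ∀ k t q → k ℕ.* t ℕ.* q ≡ k ℕ.* q ℕ.* t
        rearrange₃ = solve-∀

        -- The fibre bound takes a natural number. Rounding 4 n / q down is harmless, as an integer
        -- count times q is compared with 4 n.
        k : ℕ
        k = (4 ℕ.* n) ℕ./ q

        -- Such a flat takes at most a share 4 / q of each block; t ≤ q weakens this to 4 / t, so
        -- that both kinds of flat obey one bound.
        transversal-case : ∀ {y₁} → y₁ ∈ v ⊥ → y₁ ∉ direction → ∣ P ∩ points ∣ ℕ.* t ≤ 4 ℕ.* ∣ P ∣
        transversal-case {y₁} y₁⊥ y₁∉ = begin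
          ∣ P ∩ points ∣ ℕ.* t     ≤⟨ ℕ.*-monoʳ-≤ ∣ P ∩ points ∣ t≤q ⟩
          ∣ P ∩ points ∣ ℕ.* q     ≤⟨ ℕ.*-monoˡ-≤ q (fibres≤⇒∣∣≤ (P ∩ points) Z level
                                        (λ { x ((z , z∈Z , x∈A) , _) → subst (_∈ Z) (sym (level-A x∈A)) z∈Z }) k λ z _ → per-level z) ⟩
          k ℕ.* t ℕ.* q            ≡⟨ rearrange₃ k t q ⟩
          k ℕ.* q ℕ.* t            ≤⟨ ℕ.*-monoˡ-≤ t (ℕ.m/n*n≤m (4 ℕ.* n) q) ⟩
          4 ℕ.* n ℕ.* t            ≡⟨ ℕ.*-assoc 4 n t ⟩
          4 ℕ.* (n ℕ.* t)          ≡⟨ cong (4 ℕ.*_) ∣P∣≡nt ⟨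
          4 ℕ.* ∣ P ∣ ∎
          where
          q²≢0 : NonZero (q ℕ.* q)
          q²≢0 = ℕ.m*n≢0 q q

          A∩L : ∀ z → ∣ A z ∩ points ∣ ℕ.* q ≤ 4 ℕ.* n
          A∩L z = ℕ.*-cancelʳ-≤ (∣ A z ∩ points ∣ ℕ.* q) (4 ℕ.* n) (q ℕ.* q) {{q²≢0}} (begin
            ∣ A z ∩ points ∣ ℕ.* q ℕ.* (q ℕ.* q)     ≡⟨ rearrange ∣ A z ∩ points ∣ q ⟨
            ∣ A z ∩ points ∣ ℕ.* (q ℕ.* (q ℕ.* q))   ≤⟨ ∣A∩L∣≤ y₁⊥ y₁∉ z ⟩
            2 ℕ.* q ℕ.^ d                            ≤⟨ ℕ.*-monoʳ-≤ 2 popular ⟩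
            2 ℕ.* (2 ℕ.* (n ℕ.* (q ℕ.* q)))          ≡⟨ rearrange₂ n (q ℕ.* q) ⟩
            4 ℕ.* n ℕ.* (q ℕ.* q) ∎)

          per-level : ∀ z → ∣ fibre (P ∩ points) level z ∣ ≤ k
          per-level z = begin
            ∣ fibre (P ∩ points) level z ∣
              ≤⟨ ⊆⇒∣∣≤ (fibre (P ∩ points) level z) (A z ∩ points)
                  (λ { x (((z′ , _ , x∈A) , x∈L) , refl) → subst (λ z → x ∈ A z) (sym (level-A x∈A)) x∈A , x∈L }) ⟩
            ∣ A z ∩ points ∣                         ≡⟨ ℕ.m*n/n≡m ∣ A z ∩ points ∣ q ⟨
            (∣ A z ∩ points ∣ ℕ.* q) ℕ./ q           ≤⟨ ℕ./-monoˡ-≤ q (A∩L z) ⟩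
            k ∎

        -- A flat whose direction contains v⊥ is a level set, so it meets a single block.
        parallel-case : (∀ y → y ∈ v ⊥ → y ∈ direction) → ∣ P ∩ points ∣ ℕ.* t ≤ 4 ℕ.* ∣ P ∣
        parallel-case v⊥⊆D = begin
          ∣ P ∩ points ∣ ℕ.* t       ≤⟨ ℕ.*-monoˡ-≤ t (⊆⇒∣∣≤ (P ∩ points) (A (level base))
                                         (λ { x ((z , _ , x∈A) , x∈L) → subst (λ z → x ∈ A z)
                                           (trans (sym (level-A x∈A)) (x-y≡0⇒x≡y (trans (sym (⟪⟫--ˡ x base v)) (D⊆v⊥ (x -ⱽ base) x∈L)))) x∈A })) ⟩
          ∣ A (level base) ∣ ℕ.* t   ≡⟨ cong (ℕ._* t) (∣A∣≡n (level base)) ⟩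
          n ℕ.* t                    ≡⟨ ∣P∣≡nt ⟨
          ∣ P ∣                      ≤⟨ ℕ.m≤n*m ∣ P ∣ 4 ⟩
          4 ℕ.* ∣ P ∣ ∎
          where
          -- A direction off `v ⊥` would, together with `v ⊥`, generate the whole space, against
          -- properness.
          D⊆v⊥ : ∀ e → e ∈ direction → e ∈ v ⊥
          D⊆v⊥ e e∈ = decidable-stable (level e ≟ 0#) λ e≢0 → proj₂ proper (everything e≢0 (proj₁ proper -ⱽ base))
            where
            everything : level e ≢ 0# → ∀ x → x ∈ direction
            everything e≢0 x = subst (_∈ direction) ([x-ay]+ay s x e)
              (+-closed _ _ (v⊥⊆D _ ⊥v) (·-closed s e e∈))
              where
              s : Carrier
              s = level x * level e ⁻¹

              ⊥v : level (x +ⱽ (- s) · e) ≡ 0#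
              ⊥v = trans (⟪⟫-+·ˡ x (- s) e v) (trans
                (solve 3 (λ a h b → a :+ :- (a :* h) :* b := a :- a :* (h :* b)) refl (level x) (level e ⁻¹) (level e))
                (trans (cong (λ r → level x - level x * r) (*-inverseˡ _ e≢0))
                  (solve 1 (λ a → a :- a :* con (ℤ.+ 1) := con (ℤ.+ 0)) refl (level x))))

      ∣P∩L∣t≤4∣P∣ : ∣ P ∩ points ∣ ℕ.* t ≤ 4 ℕ.* ∣ P ∣
      ∣P∩L∣t≤4∣P∣ = cases (∃? λ y → (y ∈? v ⊥) ×-dec ¬? (y ∈? direction))
        where
        cases : Dec (∃[ y ] y ∈ v ⊥ × y ∉ direction) → ∣ P ∩ points ∣ ℕ.* t ≤ 4 ℕ.* ∣ P ∣
        cases (yes (y , y⊥ , y∉)) = transversal-case y⊥ y∉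
        cases (no none)           = parallel-case λ y y⊥ → decidable-stable (y ∈? direction) λ y∉ → none (y , y⊥ , y∉)

    -- A vector y representing R is not a direction, as R ≠ 0, so translating the base by y leaves
    -- the flat.
    totally-singular⇒proper : TotallySingular → Proper
    totally-singular⇒proper singular = y +ⱽ base , λ y+base∈ →
      R≢0 (trans (sym (proj₂ (proj₂ represented))) (singular y (subst (_∈ direction) ([x+y]-y y base) y+base∈)))
      where
      y : Point
      y = proj₁ represented

-- Affine hyperplanes as proper flats

module HyperplaneFlats {q d} (V : QuadraticSpace q d) where
  open Geometry V
  open FieldProperties 𝔽
  open VectorIdentities 𝔽

  dot-+· : ∀ {m} a s (x y : Vec Carrier m) → dot a (x +ⱽ s · y) ≡ dot a x + s * dot a y
  dot-+· []       s []       []       = solve 1 (λ s → con (ℤ.+ 0) := con (ℤ.+ 0) :+ s :* con (ℤ.+ 0)) refl s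
  dot-+· (a ∷ as) s (x ∷ xs) (y ∷ ys) = trans (cong (a * (x + s * y) +_) (dot-+· as s xs ys))
    (solve 6 (λ a s x y p r → a :* (x :+ s :* y) :+ (p :+ s :* r) := a :* x :+ p :+ s :* (a :* y :+ r)) refl a s x y (dot as xs) (dot as ys))

  dot-zero : ∀ {m} (a : Vec Carrier m) → dot a 0ⱽ ≡ 0#
  dot-zero []       = refl
  dot-zero (a ∷ as) = trans (cong (a * 0# +_) (dot-zero as)) (solve 1 (λ a → a :* con (ℤ.+ 0) :+ con (ℤ.+ 0) := con (ℤ.+ 0)) refl a)

  dot-+ : ∀ {m} a (x y : Vec Carrier m) → dot a (x +ⱽ y) ≡ dot a x + dot a y
  dot-+ []       []       []       = sym (+-identityˡ 0#)
  dot-+ (a ∷ as) (x ∷ xs) (y ∷ ys) = trans (cong (a * (x + y) +_) (dot-+ as xs ys))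
    (solve 5 (λ a x y p r → a :* (x :+ y) :+ (p :+ r) := a :* x :+ p :+ (a :* y :+ r)) refl a x y (dot as xs) (dot as ys))

  dot-· : ∀ {m} a s (x : Vec Carrier m) → dot a (s · x) ≡ s * dot a x
  dot-· []       s []       = sym (zeroʳ s)
  dot-· (a ∷ as) s (x ∷ xs) = trans (cong (a * (s * x) +_) (dot-· as s xs))
    (solve 4 (λ a s x p → a :* (s :* x) :+ s :* p := s :* (a :* x :+ p)) refl a s x (dot as xs))

  dot-nondegenerate : ∀ {m} (a : Vec Carrier m) → (∀ x → dot a x ≡ 0#) → a ≡ 0ⱽ
  dot-nondegenerate []       _    = refl
  dot-nondegenerate (a ∷ as) a⊥ = cong₂ _∷_
    (trans (solve 1 (λ a → a := a :* con (ℤ.+ 1) :+ con (ℤ.+ 0)) refl a) (trans (cong (a * 1# +_) (sym (dot-zero as))) (a⊥ (1# ∷ 0ⱽ))))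
    (dot-nondegenerate as λ x → trans (solve 2 (λ a p → p := a :* con (ℤ.+ 0) :+ p) refl a (dot as x)) (a⊥ (0# ∷ x)))

  module _ (a : Point) (a≢0 : a ≢ 0ⱽ) (x₀ : Point) where
    hyperplane-flat : Flat
    hyperplane-flat = record
      { base      = x₀
      ; direction = hyperplane a 0#
      ; 0-closed  = dot-zero a
      ; +-closed  = λ x y x∈ y∈ → trans (dot-+ a x y) (trans (cong₂ _+_ x∈ y∈) (+-identityˡ 0#))
      ; ·-closed  = λ s x x∈ → trans (dot-· a s x) (trans (cong (s *_) x∈) (zeroʳ s))
      }

    hyperplane-proper : Flat.Proper hyperplane-flat
    hyperplane-proper = y +ⱽ x₀ , λ ∈L → ⟪a,y⟫≢0 (trans (cong (dot a) (sym ([x+y]-y y x₀))) ∈L)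
      where
      outside : Dec (∃[ y ] dot a y ≢ 0#) → ∃[ y ] dot a y ≢ 0#
      outside (yes found) = found
      outside (no none)   = contradiction
        (dot-nondegenerate a λ x → decidable-stable (dot a x ≟ 0#) λ neq → none (x , neq)) a≢0

      y : Point
      y = proj₁ (outside (∃? λ y → ¬? (dot a y ≟ 0#)))

      ⟪a,y⟫≢0 : dot a y ≢ 0#
      ⟪a,y⟫≢0 = proj₂ (outside (∃? λ y → ¬? (dot a y ≟ 0#)))

    hyperplane⊆flat : ∀ b → x₀ ∈ hyperplane a b → ∀ x → x ∈ hyperplane a b → x ∈ Flat.points hyperplane-flat
    hyperplane⊆flat b x₀∈ x x∈ = trans (cong (dot a) (-ⱽ-as-+ⱽ x x₀)) (trans (dot-+· a (- 1#) x x₀)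
      (trans (cong₂ (λ p r → p + - 1# * r) x∈ x₀∈) (solve 1 (λ b → b :+ (:- con (ℤ.+ 1)) :* b := con (ℤ.+ 0)) refl b)))

-- Auxiliary facts about rationals

<∣↥∣+1 : ∀ r → r ℚ.< suc ℤ.∣ ℚ.↥ r ∣ /1
<∣↥∣+1 r@(mkℚ i d-1 _) rewrite /1-canonical (suc ℤ.∣ i ∣) = ℚ.*<* (begin-strict
  i ℤ.* ℤ.+ 1                          ≡⟨ ℤ.*-identityʳ i ⟩
  i                                    ≤⟨ i≤∣i∣ i ⟩
  ℤ.+ ℤ.∣ i ∣                          <⟨ ℤ.+<+ (ℕ.n<1+n ℤ.∣ i ∣) ⟩
  ℤ.+ suc ℤ.∣ i ∣                      ≤⟨ ℤ.+≤+ (ℕ.m≤m*n (suc ℤ.∣ i ∣) (suc d-1)) ⟩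
  ℤ.+ (suc ℤ.∣ i ∣ ℕ.* suc d-1)        ≡⟨ ℤ.pos-* (suc ℤ.∣ i ∣) (suc d-1) ⟩
  ℤ.+ suc ℤ.∣ i ∣ ℤ.* ℤ.+ suc d-1 ∎)
  where
  open ℤ.≤-Reasoning
  i≤∣i∣ : ∀ i → i ℤ.≤ ℤ.+ ℤ.∣ i ∣
  i≤∣i∣ (ℤ.+ n)    = ℤ.≤-refl
  i≤∣i∣ ℤ.-[1+ n ] = ℤ.-≤+

abstract
  /1-reciprocal : ∀ n → ∃[ r ] 0 /1 ℚ.< r × suc n /1 ℚ.* r ≡ ℚ.1ℚ
  /1-reciprocal n = ℚ.1/ N , ℚ.positive⁻¹ (ℚ.1/ N) {{ℚ.1/pos⇒pos N {{N>0}}}} , ℚ.*-inverseʳ N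
    where
    N : ℚ
    N = suc n /1
    N>0 : ℚ.Positive N
    N>0 = ℚ.normalize-pos (suc n) 1
    instance
      N≢0 : ℚ.NonZero N
      N≢0 = ℚ.pos⇒nonZero N {{N>0}}

-- Needed for the square of `halfPower`. The sum is taken on unnormalised fractions because the
-- reduced form of e / 2 depends on the parity of e.
half+half : ∀ e → ℤ.+ e ℚ./ 2 ℚ.+ ℤ.+ e ℚ./ 2 ≡ e /1
half+half e = ℚ.toℚᵘ-injective (begin
  ℚ.toℚᵘ (ℤ.+ e ℚ./ 2 ℚ.+ ℤ.+ e ℚ./ 2)
    ≈⟨ ℚ.toℚᵘ-homo-+ (ℤ.+ e ℚ./ 2) (ℤ.+ e ℚ./ 2) ⟩
  ℚ.toℚᵘ (ℤ.+ e ℚ./ 2) ℚᵘ.+ ℚ.toℚᵘ (ℤ.+ e ℚ./ 2)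
    ≈⟨ ℚᵘ.+-cong (ℚ.toℚᵘ-fromℚᵘ (ℚᵘ.mkℚᵘ (ℤ.+ e) 1)) (ℚ.toℚᵘ-fromℚᵘ (ℚᵘ.mkℚᵘ (ℤ.+ e) 1)) ⟩
  ℚᵘ.mkℚᵘ (ℤ.+ e) 1 ℚᵘ.+ ℚᵘ.mkℚᵘ (ℤ.+ e) 1                   ≈⟨ ℚᵘ.*≡* doubled ⟩
  ℚᵘ.mkℚᵘ (ℤ.+ e) 0                                          ≈⟨ ℚ.toℚᵘ-fromℚᵘ (ℚᵘ.mkℚᵘ (ℤ.+ e) 0) ⟨
  ℚ.toℚᵘ (e /1) ∎)
  where
  open import Relation.Binary.Reasoning.Setoid ℚᵘ.≃-setoid
  doubled : (ℤ.+ e ℤ.* ℤ.+ 2 ℤ.+ ℤ.+ e ℤ.* ℤ.+ 2) ℤ.* ℤ.+ 1 ≡ ℤ.+ e ℤ.* ℤ.+ 4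
  doubled = trans (ℤ.*-identityʳ _) (sym (ℤ.*-distribˡ-+ (ℤ.+ e) (ℤ.+ 2) (ℤ.+ 2)))

-- Order, roots and powers of real numbers

module RealProperties {{𝓡 : RealNumbers}} where
  open RealNumbers 𝓡 public
    using (0ᴿ; _+ᴿ_; √; <-trans; <-irrefl; +-mono-<; *-positive; *-inverse; <-cotransitive; fromℕ-pos)
  open RealNumbers 𝓡 using
    ( commutativeRing; <-tight; <-resp-≈; ι-isRingHomomorphism; ι-mono-<; ℚ-dense; fromℕ-nonneg
    ; √-square; ^-cong; ^-identity; ^-+; ^-*; ^-mono)
  open CommutativeRing commutativeRing public
    using (setoid; +-cong; *-cong; +-congˡ; +-congʳ; *-congˡ; *-congʳ; *-identityˡ; *-identityʳ; *-comm; *-assoc; zeroˡ; zeroʳ; -‿cong)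
    renaming (refl to ≈-refl; sym to ≈-sym; trans to ≈-trans; reflexive to ≈-reflexive)
  open IntegerRingSolver commutativeRing public using (solve; con; _:=_; _:+_; _:*_; _:-_; :-_)
  private module ι = Algebra.Morphism.Structures.RingMorphisms.IsRingHomomorphism ι-isRingHomomorphism
  open Relation.Binary.Reasoning.Setoid setoid

  <-respʳ : ∀ {x y z : ℝ} → y ≈ᴿ z → x <ᴿ y → x <ᴿ z
  <-respʳ = proj₁ <-resp-≈

  <-respˡ : ∀ {x y z : ℝ} → y ≈ᴿ z → y <ᴿ x → z <ᴿ x
  <-respˡ = proj₂ <-resp-≈

  <⇒≤ : ∀ {x y : ℝ} → x <ᴿ y → x ≤ᴿ y
  <⇒≤ x<y y<x = <-irrefl ≈-refl (<-trans x<y y<x)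

  ≈⇒≤ : ∀ {x y : ℝ} → x ≈ᴿ y → x ≤ᴿ y
  ≈⇒≤ x≈y y<x = <-irrefl (≈-sym x≈y) y<x

  -- Since `≤ᴿ` is a negated strict inequality, comparison with z comes from cotransitivity;
  -- `≤-trans` is then a consequence.
  <-≤-trans : ∀ {x y z : ℝ} → x <ᴿ y → y ≤ᴿ z → x <ᴿ z
  <-≤-trans {z = z} x<y y≤z with <-cotransitive x<y z
  ... | inj₁ x<z = x<z
  ... | inj₂ z<y = contradiction z<y y≤z

  ≤-trans : ∀ {x y z : ℝ} → x ≤ᴿ y → y ≤ᴿ z → x ≤ᴿ z
  ≤-trans x≤y y≤z z<x = y≤z (<-≤-trans z<x x≤y)

  ≤-respʳ : ∀ {x y z : ℝ} → y ≈ᴿ z → x ≤ᴿ y → x ≤ᴿ z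
  ≤-respʳ y≈z x≤y = ≤-trans x≤y (≈⇒≤ y≈z)

  ≤-respˡ : ∀ {x y z : ℝ} → y ≈ᴿ z → y ≤ᴿ x → z ≤ᴿ x
  ≤-respˡ y≈z y≤x = ≤-trans (≈⇒≤ (≈-sym y≈z)) y≤x

  x<y⇒0<y-x : ∀ {x y : ℝ} → x <ᴿ y → 0ᴿ <ᴿ y -ᴿ x
  x<y⇒0<y-x {x} {y} x<y = <-respˡ (solve 1 (λ x → x :- x := con (ℤ.+ 0)) ≈-refl x) (+-mono-< (-ᴿ x) x<y)

  0<y-x⇒x<y : ∀ {x y : ℝ} → 0ᴿ <ᴿ y -ᴿ x → x <ᴿ y
  0<y-x⇒x<y {x} {y} 0<y-x = <-respˡ (solve 1 (λ x → con (ℤ.+ 0) :+ x := x) ≈-refl x)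
    (<-respʳ (solve 2 (λ x y → y :- x :+ x := y) ≈-refl x y) (+-mono-< x 0<y-x))

  *-monoˡ-< : ∀ {x y z : ℝ} → 0ᴿ <ᴿ z → x <ᴿ y → x *ᴿ z <ᴿ y *ᴿ z
  *-monoˡ-< {x} {y} {z} 0<z x<y = 0<y-x⇒x<y (<-respʳ
    (solve 3 (λ x y z → (y :- x) :* z := y :* z :- x :* z) ≈-refl x y z) (*-positive (x<y⇒0<y-x x<y) 0<z))

  ≤-difference : ∀ {x y u v : ℝ} → x -ᴿ y ≈ᴿ u -ᴿ v → u ≤ᴿ v → x ≤ᴿ y
  ≤-difference eq u≤v y<x = u≤v (0<y-x⇒x<y (<-respʳ eq (x<y⇒0<y-x y<x)))

  fromℕ-+ : ∀ m n → fromℕ (m ℕ.+ n) ≈ᴿ fromℕ m +ᴿ fromℕ n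
  fromℕ-+ m n = ≈-trans (≈-reflexive (cong ι (/1-+ m n))) (ι.+-homo (m /1) (n /1))

  fromℕ-* : ∀ m n → fromℕ (m ℕ.* n) ≈ᴿ fromℕ m *ᴿ fromℕ n
  fromℕ-* m n = ≈-trans (≈-reflexive (cong ι (/1-* m n))) (ι.*-homo (m /1) (n /1))

  fromℕ-0 : fromℕ 0 ≈ᴿ 0ᴿ
  fromℕ-0 = ι.0#-homo

  fromℕ-1 : fromℕ 1 ≈ᴿ 1ᴿ
  fromℕ-1 = ι.1#-homo

  fromℕ-mono-< : ∀ {m n} → m < n → fromℕ m <ᴿ fromℕ n
  fromℕ-mono-< m<n = ι-mono-< (/1-mono-< m<n)

  fromℕ-mono-≤ : ∀ {m n} → m ≤ n → fromℕ m ≤ᴿ fromℕ n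
  fromℕ-mono-≤ m≤n with ℕ.m≤n⇒m<n∨m≡n m≤n
  ... | inj₁ m<n  = <⇒≤ (fromℕ-mono-< m<n)
  ... | inj₂ refl = ≈⇒≤ ≈-refl

  0<fromℕ : ∀ {n} → 0 < n → 0ᴿ <ᴿ fromℕ n
  0<fromℕ 0<n = <-respˡ fromℕ-0 (fromℕ-mono-< 0<n)

  0<1 : 0ᴿ <ᴿ 1ᴿ
  0<1 = <-respʳ fromℕ-1 (0<fromℕ {1} (s≤s z≤n))

  abstract
    -- Density supplies a rational between x and 1 + x, and a rational lies below its numerator in
    -- absolute value plus one.
    archimedean : (x : ℝ) → ∃[ n ] x <ᴿ fromℕ n
    archimedean x with r , x<r , _ ← ℚ-dense {x} {1ᴿ +ᴿ x} (<-respˡ (solve 1 (λ x → con (ℤ.+ 0) :+ x := x) ≈-refl x) (+-mono-< x 0<1)) =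
      suc ℤ.∣ ℚ.↥ r ∣ , <-trans x<r (ι-mono-< (<∣↥∣+1 r))

  -- Were inv x below 1 / n for a bound n of x, the product x · inv x would be below 1.
  inv-pos : (x : ℝ⁺) → 0ᴿ <ᴿ inv x
  inv-pos x⁺@(x , 0<x) = positive (archimedean x)
    where
    positive : (∃[ n ] x <ᴿ fromℕ n) → 0ᴿ <ᴿ inv x⁺
    positive (n , x<n) = cases (<-cotransitive 0<r (inv x⁺))
      where
      r : ℝ
      r = ι (proj₁ (/1-reciprocal n))

      0<r : 0ᴿ <ᴿ r
      0<r = <-respˡ fromℕ-0 (ι-mono-< (proj₁ (proj₂ (/1-reciprocal n))))

      Nr≈1 : fromℕ (suc n) *ᴿ r ≈ᴿ 1ᴿ
      Nr≈1 = ≈-trans (≈-sym (ι.*-homo (suc n /1) (proj₁ (/1-reciprocal n))))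
        (≈-trans (≈-reflexive (cong ι (proj₂ (proj₂ (/1-reciprocal n))))) fromℕ-1)

      cases : 0ᴿ <ᴿ inv x⁺ ⊎ inv x⁺ <ᴿ r → 0ᴿ <ᴿ inv x⁺
      cases (inj₁ 0<inv) = 0<inv
      cases (inj₂ inv<r) = ⊥-elim (<-irrefl ≈-refl (<-trans
        (<-respˡ (≈-trans (*-comm (inv x⁺) x) (*-inverse x⁺)) (*-monoˡ-< 0<x inv<r))
        (<-respʳ Nr≈1 (<-respˡ (*-comm x r) (*-monoˡ-< 0<r (<-trans x<n (fromℕ-mono-< (ℕ.n<1+n n))))))))

  *-cancelʳ-< : ∀ {x y z : ℝ} → 0ᴿ <ᴿ z → x *ᴿ z <ᴿ y *ᴿ z → x <ᴿ y
  *-cancelʳ-< {x} {y} {z} 0<z xz<yz = <-respʳ (undo y) (<-respˡ (undo x) (*-monoˡ-< (inv-pos (z , 0<z)) xz<yz))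
    where
    undo : ∀ (x : ℝ) → x *ᴿ z *ᴿ inv (z , 0<z) ≈ᴿ x
    undo x = ≈-trans (*-assoc x z _) (≈-trans (*-congˡ (*-inverse (z , 0<z))) (*-identityʳ x))

  *-monoˡ-≤ : ∀ {x y z : ℝ} → 0ᴿ <ᴿ z → x ≤ᴿ y → x *ᴿ z ≤ᴿ y *ᴿ z
  *-monoˡ-≤ 0<z x≤y = x≤y ∘ *-cancelʳ-< 0<z

  *-cancelʳ-≤ : ∀ {x y z : ℝ} → 0ᴿ <ᴿ z → x *ᴿ z ≤ᴿ y *ᴿ z → x ≤ᴿ y
  *-cancelʳ-≤ 0<z xz≤yz = xz≤yz ∘ *-monoˡ-< 0<z

  *-mono-≤ : ∀ {x y u v : ℝ} → 0ᴿ <ᴿ u → 0ᴿ <ᴿ y → x ≤ᴿ y → u ≤ᴿ v → x *ᴿ u ≤ᴿ y *ᴿ v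
  *-mono-≤ {x} {y} {u} {v} 0<u 0<y x≤y u≤v = ≤-trans (*-monoˡ-≤ 0<u x≤y)
    (≤-respˡ (*-comm u y) (≤-respʳ (*-comm v y) (*-monoˡ-≤ 0<y u≤v)))

  *-cancelʳ-≈ : ∀ {x y z : ℝ} → 0ᴿ <ᴿ z → x *ᴿ z ≈ᴿ y *ᴿ z → x ≈ᴿ y
  *-cancelʳ-≈ 0<z eq = <-tight (*-cancelʳ-≤ 0<z (≈⇒≤ eq)) (*-cancelʳ-≤ 0<z (≈⇒≤ (≈-sym eq)))

  -- The passage by which comparisons with K_* and with square roots become comparisons of squares,
  -- hence of natural numbers.
  square-cancel-≤ : ∀ {x y : ℝ} → 0ᴿ <ᴿ y → x *ᴿ x ≤ᴿ y *ᴿ y → x ≤ᴿ y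
  square-cancel-≤ {x} {y} 0<y x²≤y² y<x = x²≤y²
    (<-trans (*-monoˡ-< 0<y y<x) (<-respˡ (*-comm y x) (*-monoˡ-< (<-trans 0<y y<x) y<x)))

  square-injective : ∀ {x y : ℝ} → 0ᴿ <ᴿ x → 0ᴿ <ᴿ y → x *ᴿ x ≈ᴿ y *ᴿ y → x ≈ᴿ y
  square-injective 0<x 0<y eq = <-tight (square-cancel-≤ 0<y (≈⇒≤ eq)) (square-cancel-≤ 0<x (≈⇒≤ (≈-sym eq)))

  √ℕ-square : ∀ n → √ℕ n *ᴿ √ℕ n ≈ᴿ fromℕ n
  √ℕ-square n = √-square (fromℕ n) (fromℕ-nonneg n)

  √ℕ-positive : ∀ {n} → 0 < n → 0ᴿ <ᴿ √ℕ n
  √ℕ-positive {suc n} _ = proj₂ (√ℕ⁺ (suc n))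

  /-≤ : ∀ {x z : ℝ} (y : ℝ⁺) → x ≤ᴿ z *ᴿ value y → x /ᴿ y ≤ᴿ z
  /-≤ {x} {z} y x≤zy = *-cancelʳ-≤ (proj₂ y) (≤-respˡ (≈-sym undo) x≤zy)
    where
    undo : x *ᴿ inv y *ᴿ value y ≈ᴿ x
    undo = ≈-trans (*-assoc x (inv y) (value y)) (≈-trans (*-congˡ (≈-trans (*-comm (inv y) (value y)) (*-inverse y))) (*-identityʳ x))

  -- Replaces a real tolerance by some 1 / n below it, after which shares are compared among natural
  -- numbers.
  reciprocal-bound : (x : ℝ⁺) → ∃[ n ] 0 < n × 1ᴿ ≤ᴿ value x *ᴿ fromℕ n
  reciprocal-bound x⁺@(x , 0<x) = suc n , s≤s z≤n , <⇒≤ (<-respˡ (≈-trans (*-comm (inv x⁺) x) (*-inverse x⁺))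
    (<-respʳ (*-comm (fromℕ (suc n)) x) (*-monoˡ-< 0<x (<-trans (proj₂ bound) (fromℕ-mono-< (ℕ.n<1+n n))))))
    where
    bound : ∃[ n ] inv x⁺ <ᴿ fromℕ n
    bound = archimedean (inv x⁺)

    n : ℕ
    n = proj₁ bound

  ^-zero : ∀ (x : ℝ⁺) → value (x ^ᴿ 0ᴿ) ≈ᴿ 1ᴿ
  ^-zero x = *-cancelʳ-≈ (proj₂ (x ^ᴿ 1ᴿ)) (≈-trans (≈-sym (^-+ x 0ᴿ 1ᴿ))
    (≈-trans (^-cong ≈-refl (solve 1 (λ a → con (ℤ.+ 0) :+ a := a) ≈-refl 1ᴿ)) (≈-sym (*-identityˡ _))))

  ^-suc : ∀ (x : ℝ⁺) n → value (x ^ᴿ fromℕ (suc n)) ≈ᴿ value x *ᴿ value (x ^ᴿ fromℕ n)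
  ^-suc x n = begin
    value (x ^ᴿ fromℕ (suc n))
      ≈⟨ ^-cong ≈-refl (≈-trans (fromℕ-+ 1 n) (+-congʳ fromℕ-1)) ⟩
    value (x ^ᴿ (1ᴿ +ᴿ fromℕ n))                   ≈⟨ ^-+ x 1ᴿ (fromℕ n) ⟩
    value (x ^ᴿ 1ᴿ) *ᴿ value (x ^ᴿ fromℕ n)        ≈⟨ *-congʳ (^-identity x) ⟩
    value x *ᴿ value (x ^ᴿ fromℕ n) ∎

  fromℕ-^ : ∀ (x : ℝ⁺) {k} → value x ≈ᴿ fromℕ k → ∀ n → value (x ^ᴿ fromℕ n) ≈ᴿ fromℕ (k ℕ.^ n)
  fromℕ-^ x x≈k zero = ≈-trans (^-cong ≈-refl fromℕ-0) (≈-trans (^-zero x) (≈-sym fromℕ-1))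
  fromℕ-^ x {k} x≈k (suc n) = begin
    value (x ^ᴿ fromℕ (suc n))              ≈⟨ ^-suc x n ⟩
    value x *ᴿ value (x ^ᴿ fromℕ n)         ≈⟨ *-cong x≈k (fromℕ-^ x x≈k n) ⟩
    fromℕ k *ᴿ fromℕ (k ℕ.^ n)              ≈⟨ fromℕ-* k (k ℕ.^ n) ⟨
    fromℕ (k ℕ.^ suc n) ∎

  ^-mono-base-≤ : ∀ (x : ℝ⁺) {k} → value x ≤ᴿ fromℕ k → 0 < k → ∀ n → value (x ^ᴿ fromℕ n) ≤ᴿ fromℕ (k ℕ.^ n)
  ^-mono-base-≤ x x≤k 0<k zero = ≈⇒≤ (≈-trans (^-cong ≈-refl fromℕ-0) (≈-trans (^-zero x) (≈-sym fromℕ-1)))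
  ^-mono-base-≤ x {k} x≤k 0<k (suc n) = ≤-respˡ (≈-sym (^-suc x n)) (≤-respʳ (≈-sym (fromℕ-* k (k ℕ.^ n)))
    (*-mono-≤ (proj₂ (x ^ᴿ fromℕ n)) (0<fromℕ 0<k) x≤k (^-mono-base-≤ x x≤k 0<k n)))

  ^-neg : ∀ (x : ℝ⁺) (a : ℝ) → value (x ^ᴿ (-ᴿ a)) *ᴿ value (x ^ᴿ a) ≈ᴿ 1ᴿ
  ^-neg x a = ≈-trans (≈-sym (^-+ x (-ᴿ a) a)) (≈-trans (^-cong ≈-refl (solve 1 (λ a → :- a :+ a := con (ℤ.+ 0)) ≈-refl a)) (^-zero x))

  halfPower-square : ∀ q d .{{_ : NonZero q}} → 1 ≤ d → halfPower q d *ᴿ halfPower q d ≈ᴿ fromℕ (q ℕ.^ (d ∸ 1))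
  halfPower-square q (suc e) _ = begin
    halfPower q (suc e) *ᴿ halfPower q (suc e)               ≈⟨ ^-+ (fromℕ⁺ q) (ι r) (ι r) ⟨
    value (fromℕ⁺ q ^ᴿ (ι r +ᴿ ι r))
      ≈⟨ ^-cong ≈-refl (≈-trans (≈-sym (ι.+-homo r r)) (≈-reflexive (cong ι (half+half e)))) ⟩
    value (fromℕ⁺ q ^ᴿ fromℕ e)                              ≈⟨ fromℕ-^ (fromℕ⁺ q) ≈-refl e ⟩
    fromℕ (q ℕ.^ e) ∎
    where
    r : ℚ
    r = ℤ.+ e ℚ./ 2

  halfPower-pos : ∀ q d .{{_ : NonZero q}} → 0ᴿ <ᴿ halfPower q d
  halfPower-pos q d = proj₂ (fromℕ⁺ q ^ᴿ ι ((ℤ.+ d ℤ.- ℤ.1ℤ) ℚ./ 2))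

  -- Real powers are only known to be monotone in the exponent for bases at least 1, so
  -- K ^ (- C) is compared through (4 K) ^ (- C) = 4 ^ (- C) K ^ (- C).
  power-bound : ∀ (C : ℝ) → ∃[ M ] 0 < M × (∀ (K : ℝ⁺) → 1ᴿ ≤ᴿ fromℕ 2 *ᴿ value K → value K ≤ᴿ fromℕ 2 →
                                      1ᴿ ≤ᴿ value (K ^ᴿ (-ᴿ C)) *ᴿ fromℕ M)
  power-bound C = M , 0<M , bound
    where
    m₁ m₂ m M : ℕ
    m₁ = proj₁ (archimedean C)
    m₂ = proj₁ (archimedean (-ᴿ C))
    m = m₁ ℕ.+ m₂
    -- Here m bounds both C and - C. From 1 ≤ 4 K ≤ 8 one gets (4 K) ^ (- C) ≥ (4 K) ^ (- m) ≥ 8 ^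
    -- (- m), and 4 ^ (- C) ≤ 4 ^ m; the quotient is K ^ (- C).
    M = 4 ℕ.^ m ℕ.* 8 ℕ.^ m

    0<M : 0 < M
    0<M = ℕ.*-mono-< {0} {4 ℕ.^ m} {0} {8 ℕ.^ m} (ℕ.m^n>0 4 m) (ℕ.m^n>0 8 m)

    -m≤-C : -ᴿ fromℕ m ≤ᴿ -ᴿ C
    -m≤-C -C<-m = ≤-trans (<⇒≤ (proj₂ (archimedean C))) (fromℕ-mono-≤ (ℕ.m≤m+n m₁ m₂))
      (0<y-x⇒x<y (<-respʳ (solve 2 (λ a b → :- a :- :- b := b :- a) ≈-refl (fromℕ m) C) (x<y⇒0<y-x -C<-m)))

    -C≤m : -ᴿ C ≤ᴿ fromℕ m
    -C≤m = ≤-trans (<⇒≤ (proj₂ (archimedean (-ᴿ C)))) (fromℕ-mono-≤ (ℕ.m≤n+m m₂ m₁))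

    bound : ∀ (K : ℝ⁺) → 1ᴿ ≤ᴿ fromℕ 2 *ᴿ value K → value K ≤ᴿ fromℕ 2 → 1ᴿ ≤ᴿ value (K ^ᴿ (-ᴿ C)) *ᴿ fromℕ M
    bound K 1≤2K K≤2 =
      ≤-respˡ (^-neg y (fromℕ m)) (≤-trans
        (*-mono-≤ (proj₂ (y ^ᴿ fromℕ m)) (proj₂ (y ^ᴿ (-ᴿ C))) (^-mono y 1≤y -m≤-C) (^-mono-base-≤ y y≤8 (s≤s z≤n) m))
        (≤-respˡ (≈-sym split) (≤-respʳ merge
          (*-monoˡ-≤ (*-positive (proj₂ (K ^ᴿ (-ᴿ C))) (0<fromℕ (ℕ.m^n>0 8 m)))
            (≤-respʳ (fromℕ-^ 4⁺ ≈-refl m) (^-mono 4⁺ 1≤4 -C≤m))))))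
      where
      4⁺ y : ℝ⁺
      4⁺ = fromℕ⁺ 4
      y = 4⁺ *⁺ K

      1≤4 : 1ᴿ ≤ᴿ fromℕ 4
      1≤4 = ≤-respˡ fromℕ-1 (fromℕ-mono-≤ {1} {4} (s≤s z≤n))

      1≤y : 1ᴿ ≤ᴿ value y
      1≤y = ≤-trans 1≤2K (*-monoˡ-≤ (proj₂ K) (fromℕ-mono-≤ {2} {4} (s≤s (s≤s z≤n))))

      y≤8 : value y ≤ᴿ fromℕ 8
      y≤8 = ≤-respˡ (*-comm (value K) (fromℕ 4)) (≤-respʳ (≈-sym (fromℕ-* 2 4)) (*-monoˡ-≤ (0<fromℕ {4} (s≤s z≤n)) K≤2))

      split : value (y ^ᴿ (-ᴿ C)) *ᴿ fromℕ (8 ℕ.^ m) ≈ᴿ value (4⁺ ^ᴿ (-ᴿ C)) *ᴿ (value (K ^ᴿ (-ᴿ C)) *ᴿ fromℕ (8 ℕ.^ m))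
      split = ≈-trans (*-congʳ (^-* 4⁺ K y (-ᴿ C) ≈-refl)) (*-assoc _ _ _)

      merge : fromℕ (4 ℕ.^ m) *ᴿ (value (K ^ᴿ (-ᴿ C)) *ᴿ fromℕ (8 ℕ.^ m)) ≈ᴿ value (K ^ᴿ (-ᴿ C)) *ᴿ fromℕ M
      merge = ≈-trans (solve 3 (λ a k b → a :* (k :* b) := k :* (a :* b)) ≈-refl _ _ _) (*-congˡ (≈-sym (fromℕ-* (4 ℕ.^ m) (8 ℕ.^ m))))

  ratio-below : ∀ {ε : ℝ} {x W p} → 0 < W → 0 < p → 1ᴿ ≤ᴿ ε *ᴿ fromℕ W → x ℕ.* W < p → fromℕ x <ᴿ ε *ᴿ fromℕ p
  ratio-below {ε} {x} {W} {p} 0<W 0<p 1≤εW xW<p = *-cancelʳ-< (0<fromℕ 0<W) (<-respˡ (fromℕ-* x W) (<-≤-trans (fromℕ-mono-< xW<p)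
    (≤-respˡ (*-identityˡ (fromℕ p)) (≤-respʳ (solve 3 (λ e w p → e :* w :* p := e :* p :* w) ≈-refl ε (fromℕ W) (fromℕ p))
      (*-monoˡ-≤ (0<fromℕ 0<p) 1≤εW)))))

  module _ (K : ℝ⁺) {h : ℝ} {H N m : ℕ} (h²≈H : h *ᴿ h ≈ᴿ fromℕ H) (m≈KhN : fromℕ m ≈ᴿ value K *ᴿ h *ᴿ √ℕ N) where
    -- Squaring removes both roots from the equation defining K_*. In use, H is q ^ (d - 1), N is
    -- |P| |𝒮| and m is the surplus.
    star-square : value K *ᴿ value K *ᴿ fromℕ (H ℕ.* N) ≈ᴿ fromℕ (m ℕ.* m)
    star-square = begin
      value K *ᴿ value K *ᴿ fromℕ (H ℕ.* N)
        ≈⟨ *-congˡ (fromℕ-* H N) ⟩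
      value K *ᴿ value K *ᴿ (fromℕ H *ᴿ fromℕ N)
        ≈⟨ *-congˡ (*-cong h²≈H (√ℕ-square N)) ⟨
      value K *ᴿ value K *ᴿ (h *ᴿ h *ᴿ (√ℕ N *ᴿ √ℕ N))
        ≈⟨ solve 3 (λ k h s → k :* k :* (h :* h :* (s :* s)) := (k :* h :* s) :* (k :* h :* s)) ≈-refl (value K) h (√ℕ N) ⟩
      (value K *ᴿ h *ᴿ √ℕ N) *ᴿ (value K *ᴿ h *ᴿ √ℕ N)
        ≈⟨ *-cong m≈KhN m≈KhN ⟨
      fromℕ m *ᴿ fromℕ m                                                       ≈⟨ fromℕ-* m m ⟨
      fromℕ (m ℕ.* m) ∎

  module _ (K : ℝ⁺) {a b : ℕ} (0<b : 0 < b) (K²b≈a : value K *ᴿ value K *ᴿ fromℕ b ≈ᴿ fromℕ a) where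
    ≤*K² : ∀ x s → x ℕ.* b ≤ s ℕ.* a → fromℕ x ≤ᴿ fromℕ s *ᴿ (value K *ᴿ value K)
    ≤*K² x s xb≤sa = *-cancelʳ-≤ (0<fromℕ 0<b) (≤-respˡ (fromℕ-* x b) (≤-respʳ
      (≈-trans (fromℕ-* s a) (≈-trans (*-congˡ (≈-sym K²b≈a)) (≈-sym (*-assoc _ _ _)))) (fromℕ-mono-≤ xb≤sa)))

    K²≤ : ∀ x → a ≤ x ℕ.* b → value K *ᴿ value K ≤ᴿ fromℕ x
    K²≤ x a≤xb = *-cancelʳ-≤ (0<fromℕ 0<b) (≤-respˡ (≈-sym K²b≈a) (≤-respʳ (fromℕ-* x b) (fromℕ-mono-≤ a≤xb)))

    1≤2K : b ≤ 4 ℕ.* a → 1ᴿ ≤ᴿ fromℕ 2 *ᴿ value K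
    1≤2K b≤4a = square-cancel-≤ (*-positive (0<fromℕ {2} (s≤s z≤n)) (proj₂ K))
      (≤-respˡ (≈-trans fromℕ-1 (≈-sym (*-identityˡ 1ᴿ))) (≤-respʳ four (≤*K² 1 4 (subst (_≤ 4 ℕ.* a) (sym (ℕ.*-identityˡ b)) b≤4a))))
      where
      four : fromℕ 4 *ᴿ (value K *ᴿ value K) ≈ᴿ fromℕ 2 *ᴿ value K *ᴿ (fromℕ 2 *ᴿ value K)
      four = ≈-trans (*-congʳ (fromℕ-* 2 2)) (solve 2 (λ w k → w :* w :* (k :* k) := w :* k :* (w :* k)) ≈-refl (fromℕ 2) (value K))

    K≤2 : a ≤ 4 ℕ.* b → value K ≤ᴿ fromℕ 2
    K≤2 a≤4b = square-cancel-≤ (0<fromℕ {2} (s≤s z≤n)) (≤-respʳ (fromℕ-* 2 2) (K²≤ 4 a≤4b))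

-- Inequalities between the parameters

module _ where
  open ℕ.≤-Reasoning

  q²≤2[q-1]² : ∀ q → 4 ≤ q → q ℕ.* q ≤ 2 ℕ.* ((q ∸ 1) ℕ.* (q ∸ 1))
  -- After q = 4 + k the difference of the two sides is 2 + 4 k + k², with no negative coefficient.
  q²≤2[q-1]² q 4≤q with k , refl ← ℕ.m≤n⇒∃[o]m+o≡n 4≤q = begin
    (4 ℕ.+ k) ℕ.* (4 ℕ.+ k)
      ≤⟨ ℕ.m≤m+n _ (2 ℕ.+ 4 ℕ.* k ℕ.+ k ℕ.* k) ⟩
    (4 ℕ.+ k) ℕ.* (4 ℕ.+ k) ℕ.+ (2 ℕ.+ 4 ℕ.* k ℕ.+ k ℕ.* k)           ≡⟨ expand k ⟩
    2 ℕ.* ((3 ℕ.+ k) ℕ.* (3 ℕ.+ k)) ∎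
    where
    expand : ∀ k → (4 ℕ.+ k) ℕ.* (4 ℕ.+ k) ℕ.+ (2 ℕ.+ 4 ℕ.* k ℕ.+ k ℕ.* k) ≡ 2 ℕ.* ((3 ℕ.+ k) ℕ.* (3 ℕ.+ k))
    expand = solve-∀

  -- In the next lemmas H stands for q ^ (d - 1) and r for q - 1.
  spread-lower : ∀ H n t q r → H ≤ 2 ℕ.* (n ℕ.* q) → q ℕ.* q ≤ 2 ℕ.* (r ℕ.* r) →
                 H ℕ.* (n ℕ.* t ℕ.* (q ℕ.* t)) ≤ 4 ℕ.* (n ℕ.* t ℕ.* r ℕ.* (n ℕ.* t ℕ.* r))
  spread-lower H n t q r H≤ q²≤ = begin
    -- One factor 2 is lost to the choice of radius and one to q - 1 in place of q; together they
    -- are the 4 in 4 K_*² ≥ 1.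
    H ℕ.* (n ℕ.* t ℕ.* (q ℕ.* t))                             ≤⟨ ℕ.*-monoˡ-≤ _ H≤ ⟩
    2 ℕ.* (n ℕ.* q) ℕ.* (n ℕ.* t ℕ.* (q ℕ.* t))               ≡⟨ collect n t q ⟩
    2 ℕ.* (n ℕ.* t ℕ.* (n ℕ.* t)) ℕ.* (q ℕ.* q)
      ≤⟨ ℕ.*-monoʳ-≤ (2 ℕ.* (n ℕ.* t ℕ.* (n ℕ.* t))) q²≤ ⟩
    2 ℕ.* (n ℕ.* t ℕ.* (n ℕ.* t)) ℕ.* (2 ℕ.* (r ℕ.* r))       ≡⟨ collect′ n t r ⟩
    4 ℕ.* (n ℕ.* t ℕ.* r ℕ.* (n ℕ.* t ℕ.* r)) ∎
    where
    collect : ∀ n t q → 2 ℕ.* (n ℕ.* q) ℕ.* (n ℕ.* t ℕ.* (q ℕ.* t)) ≡ 2 ℕ.* (n ℕ.* t ℕ.* (n ℕ.* t)) ℕ.* (q ℕ.* q)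
    collect = solve-∀
    collect′ : ∀ n t r → 2 ℕ.* (n ℕ.* t ℕ.* (n ℕ.* t)) ℕ.* (2 ℕ.* (r ℕ.* r)) ≡ 4 ℕ.* (n ℕ.* t ℕ.* r ℕ.* (n ℕ.* t ℕ.* r))
    collect′ = solve-∀

  spread-upper : ∀ H n t q r → n ℕ.* q ≤ 2 ℕ.* H → r ≤ q →
                 n ℕ.* t ℕ.* r ℕ.* (n ℕ.* t ℕ.* r) ≤ 4 ℕ.* (H ℕ.* (n ℕ.* t ℕ.* (q ℕ.* t)))
  spread-upper H n t q r nq≤ r≤q = begin
    n ℕ.* t ℕ.* r ℕ.* (n ℕ.* t ℕ.* r)
      ≤⟨ ℕ.*-mono-≤ (ℕ.*-monoʳ-≤ (n ℕ.* t) r≤q) (ℕ.*-monoʳ-≤ (n ℕ.* t) r≤q) ⟩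
    n ℕ.* t ℕ.* q ℕ.* (n ℕ.* t ℕ.* q)                         ≡⟨ collect n t q ⟩
    n ℕ.* q ℕ.* (n ℕ.* t ℕ.* (q ℕ.* t))                       ≤⟨ ℕ.*-monoˡ-≤ _ nq≤ ⟩
    2 ℕ.* H ℕ.* (n ℕ.* t ℕ.* (q ℕ.* t))
      -- Raised from 2 to 4 so that the bound on K_*² is the square of an integer.
      ≤⟨ ℕ.*-monoˡ-≤ _ (ℕ.*-monoˡ-≤ H (s≤s (s≤s (z≤n {2})))) ⟩
    4 ℕ.* H ℕ.* (n ℕ.* t ℕ.* (q ℕ.* t))                       ≡⟨ ℕ.*-assoc 4 H _ ⟩
    4 ℕ.* (H ℕ.* (n ℕ.* t ℕ.* (q ℕ.* t))) ∎
    where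
    collect : ∀ n t q → n ℕ.* t ℕ.* q ℕ.* (n ℕ.* t ℕ.* q) ≡ n ℕ.* q ℕ.* (n ℕ.* t ℕ.* (q ℕ.* t))
    collect = solve-∀

  -- From K_* ≥ 1/2 one has 4 q / K_*² ≤ 16 q, hence the demand for 16 blocks.
  window-lower : ∀ a b q t → 16 ≤ t → b ≤ 4 ℕ.* a → 4 ℕ.* q ℕ.* b ≤ q ℕ.* t ℕ.* a
  window-lower a b q t 16≤t b≤4a = begin
    4 ℕ.* q ℕ.* b             ≤⟨ ℕ.*-monoʳ-≤ (4 ℕ.* q) b≤4a ⟩
    4 ℕ.* q ℕ.* (4 ℕ.* a)     ≡⟨ collect a q ⟩
    q ℕ.* a ℕ.* 16            ≤⟨ ℕ.*-monoʳ-≤ (q ℕ.* a) 16≤t ⟩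
    q ℕ.* a ℕ.* t             ≡⟨ collect′ a q t ⟩
    q ℕ.* t ℕ.* a ∎
    where
    collect : ∀ a q → 4 ℕ.* q ℕ.* (4 ℕ.* a) ≡ q ℕ.* a ℕ.* 16
    collect = solve-∀
    collect′ : ∀ a q t → q ℕ.* a ℕ.* t ≡ q ℕ.* t ℕ.* a
    collect′ = solve-∀

  -- With p = |P| and s = |𝒮|, K_*² = p r² / (H s). The lower end 4 p / (K_*² H) of the moderate
  -- window is then 4 s / r², which is at most s once r ≥ 2.
  moderate-lower : ∀ H p s r → 4 ≤ r ℕ.* r → 4 ℕ.* p ℕ.* (H ℕ.* (p ℕ.* s)) ≤ s ℕ.* H ℕ.* (p ℕ.* r ℕ.* (p ℕ.* r))
  moderate-lower H p s r 4≤r² = begin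
    4 ℕ.* p ℕ.* (H ℕ.* (p ℕ.* s))             ≡⟨ collect H p s ⟩
    s ℕ.* H ℕ.* p ℕ.* p ℕ.* 4                 ≤⟨ ℕ.*-monoʳ-≤ (s ℕ.* H ℕ.* p ℕ.* p) 4≤r² ⟩
    s ℕ.* H ℕ.* p ℕ.* p ℕ.* (r ℕ.* r)         ≡⟨ collect′ H p s r ⟩
    s ℕ.* H ℕ.* (p ℕ.* r ℕ.* (p ℕ.* r)) ∎
    where
    collect : ∀ H p s → 4 ℕ.* p ℕ.* (H ℕ.* (p ℕ.* s)) ≡ s ℕ.* H ℕ.* p ℕ.* p ℕ.* 4
    collect = solve-∀
    collect′ : ∀ H p s r → s ℕ.* H ℕ.* p ℕ.* p ℕ.* (r ℕ.* r) ≡ s ℕ.* H ℕ.* (p ℕ.* r ℕ.* (p ℕ.* r))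
    collect′ = solve-∀

  -- For the same value of K_*², the inequality s² ≤ K_*² H amounts to s³ ≤ p r².
  window-upper : ∀ H p s r → s ℕ.* s ℕ.* s ≤ p ℕ.* (r ℕ.* r) → s ℕ.* s ℕ.* (H ℕ.* (p ℕ.* s)) ≤ H ℕ.* (p ℕ.* r ℕ.* (p ℕ.* r))
  window-upper H p s r s³≤ = begin
    s ℕ.* s ℕ.* (H ℕ.* (p ℕ.* s))             ≡⟨ collect H p s ⟩
    H ℕ.* p ℕ.* (s ℕ.* s ℕ.* s)               ≤⟨ ℕ.*-monoʳ-≤ (H ℕ.* p) s³≤ ⟩
    H ℕ.* p ℕ.* (p ℕ.* (r ℕ.* r))             ≡⟨ collect′ H p r ⟩
    H ℕ.* (p ℕ.* r ℕ.* (p ℕ.* r)) ∎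
    where
    collect : ∀ H p s → s ℕ.* s ℕ.* (H ℕ.* (p ℕ.* s)) ≡ H ℕ.* p ℕ.* (s ℕ.* s ℕ.* s)
    collect = solve-∀
    collect′ : ∀ H p r → H ℕ.* p ℕ.* (p ℕ.* (r ℕ.* r)) ≡ H ℕ.* (p ℕ.* r ℕ.* (p ℕ.* r))
    collect′ = solve-∀

  -- The upper window for C₁ = 1, and the place where d ≥ 4 enters, as q³ ≤ H. The condition 4 t² ≤
  -- q absorbs exactly the two factors 2 lost in n and in q - 1.
  spheres-cubed : ∀ H n t q r → 4 ℕ.* (t ℕ.* t) ≤ q → q ℕ.* q ℕ.* q ≤ H → H ≤ 2 ℕ.* (n ℕ.* q) → q ℕ.* q ≤ 2 ℕ.* (r ℕ.* r) →
                  q ℕ.* t ℕ.* (q ℕ.* t) ℕ.* (q ℕ.* t) ≤ n ℕ.* t ℕ.* (r ℕ.* r)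
  spheres-cubed H n t q r 4t²≤q q³≤H H≤ q²≤ = ℕ.*-cancelˡ-≤ 4 (begin
    4 ℕ.* (q ℕ.* t ℕ.* (q ℕ.* t) ℕ.* (q ℕ.* t))       ≡⟨ collect t q ⟩
    4 ℕ.* (t ℕ.* t) ℕ.* (q ℕ.* q ℕ.* q) ℕ.* t
      ≤⟨ ℕ.*-monoˡ-≤ t (ℕ.*-mono-≤ 4t²≤q (ℕ.≤-trans q³≤H H≤)) ⟩
    q ℕ.* (2 ℕ.* (n ℕ.* q)) ℕ.* t                     ≡⟨ collect′ n t q ⟩
    2 ℕ.* (n ℕ.* t) ℕ.* (q ℕ.* q)                     ≤⟨ ℕ.*-monoʳ-≤ (2 ℕ.* (n ℕ.* t)) q²≤ ⟩
    2 ℕ.* (n ℕ.* t) ℕ.* (2 ℕ.* (r ℕ.* r))             ≡⟨ collect″ n t r ⟩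
    4 ℕ.* (n ℕ.* t ℕ.* (r ℕ.* r)) ∎)
    where
    collect : ∀ t q → 4 ℕ.* (q ℕ.* t ℕ.* (q ℕ.* t) ℕ.* (q ℕ.* t)) ≡ 4 ℕ.* (t ℕ.* t) ℕ.* (q ℕ.* q ℕ.* q) ℕ.* t
    collect = solve-∀
    collect′ : ∀ n t q → q ℕ.* (2 ℕ.* (n ℕ.* q)) ℕ.* t ≡ 2 ℕ.* (n ℕ.* t) ℕ.* (q ℕ.* q)
    collect′ = solve-∀
    collect″ : ∀ n t r → 2 ℕ.* (n ℕ.* t) ℕ.* (2 ℕ.* (r ℕ.* r)) ≡ 4 ℕ.* (n ℕ.* t ℕ.* (r ℕ.* r))
    collect″ = solve-∀

  small-share : ∀ {x t p W} → x ℕ.* t ≤ 4 ℕ.* p → 4 ℕ.* W < t → 0 < p → x ℕ.* W < p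
  small-share {zero}      _      _     0<p = 0<p
  small-share {x@(suc _)} {t} {p} {W} xt≤4p 4W<t _ = ℕ.*-cancelˡ-< 4 _ _ (begin-strict
    4 ℕ.* (x ℕ.* W)     ≡⟨ collect x W ⟩
    x ℕ.* (4 ℕ.* W)     <⟨ ℕ.*-monoʳ-< x 4W<t ⟩
    x ℕ.* t             ≤⟨ xt≤4p ⟩
    4 ℕ.* p ∎)
    where
    collect : ∀ x W → 4 ℕ.* (x ℕ.* W) ≡ x ℕ.* (4 ℕ.* W)
    collect = solve-∀

-- The integer part of √q / 2, by induction on q: t increases when 4 (t + 1)² is reached.
block-number : ∀ q → ∃[ t ] 4 ℕ.* (t ℕ.* t) ≤ q × q < 4 ℕ.* (suc t ℕ.* suc t)
block-number zero    = 0 , z≤n , s≤s z≤n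
block-number (suc q) with t , 4t²≤q , q< ← block-number q with ℕ.m≤n⇒m<n∨m≡n q<
... | inj₁ 1+q<  = t , ℕ.m≤n⇒m≤1+n 4t²≤q , 1+q<
... | inj₂ 1+q≡  = suc t , ℕ.≤-reflexive (sym 1+q≡) ,
  subst (_< 4 ℕ.* (suc (suc t) ℕ.* suc (suc t))) (sym 1+q≡)
    (ℕ.*-monoʳ-< 4 (ℕ.*-mono-< (ℕ.n<1+n (suc t)) (ℕ.n<1+n (suc t))))

4T²≤q⇒T≤t : ∀ {T q} → 4 ℕ.* (T ℕ.* T) ≤ q → T ≤ proj₁ (block-number q)
4T²≤q⇒T≤t {T} {q} 4T²≤q = ℕ.≮⇒≥ λ t<T → ℕ.<⇒≱ (proj₂ (proj₂ (block-number q)))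
  (ℕ.≤-trans (ℕ.*-monoʳ-≤ 4 (ℕ.*-mono-≤ t<T t<T)) 4T²≤q)

block-number≤ : ∀ q → proj₁ (block-number q) ≤ q
block-number≤ q = ℕ.≤-trans (t≤4t² _) (proj₁ (proj₂ (block-number q)))
  where
  t≤4t² : ∀ t → t ≤ 4 ℕ.* (t ℕ.* t)
  t≤4t² zero      = z≤n
  t≤4t² t@(suc _) = ℕ.≤-trans (ℕ.m≤m*n t t) (ℕ.m≤n*m (t ℕ.* t) 4)

-- Subsets of the field of prescribed size

finite-Fin : ∀ n → Finite (Fin n)
finite-Fin n = record
  { elements = allFin n
  ; complete = ∈-allFin
  ; unique   = Unique.allFin⁺ n
  ; _≟_      = Fin._≟_
  }

module InitialSegment {q} (𝔽 : FiniteField q) where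
  open FiniteField 𝔽
  open Inverse enumeration using (to; from; strictlyInverseˡ; strictlyInverseʳ)

  -- Only the size of the set of levels matters to the estimates, so the first t elements of the
  -- enumeration serve.
  initial : ℕ → Subset Carrier
  initial t = ⟨ (λ x → toℕ (to x) < t) ∣ (λ x → toℕ (to x) ℕ.<? t) ⟩

  ∣initial∣ : ∀ {t} → t ≤ q → ∣ initial t ∣ ≡ t
  ∣initial∣ {t} t≤q = begin
    ∣ initial t ∣
      ≡⟨ bijection⇒∣∣≡ (full {Fin t}) (initial t) (from ∘ (λ i → inject≤ i t≤q))
          (λ i _ → subst (_< t) (sym (rank i)) (Fin.toℕ<n i))
          (λ i j _ _ eq → Fin.inject≤-injective t≤q t≤q i j (from-injective eq))
          (λ x x< → fromℕ< x< , tt , surjective x x<) ⟨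
    ∣ full {Fin t} ∣                             ≡⟨ ∣full∣ {Fin t} ⟩
    length (allFin t)                            ≡⟨ length-tabulate id ⟩
    t ∎
    where
    open ≡-Reasoning
    instance
      finite-Fin-t : Finite (Fin t)
      finite-Fin-t = finite-Fin t

    from-injective : ∀ {i j} → from i ≡ from j → i ≡ j
    from-injective {i} {j} eq = trans (sym (strictlyInverseˡ i)) (trans (cong to eq) (strictlyInverseˡ j))

    rank : ∀ i → toℕ (to (from (inject≤ i t≤q))) ≡ toℕ i
    rank i = trans (cong toℕ (strictlyInverseˡ _)) (Fin.toℕ-inject≤ i t≤q)

    surjective : ∀ x (x< : toℕ (to x) < t) → from (inject≤ (fromℕ< x<) t≤q) ≡ x
    surjective x x< = trans (cong from (Fin.toℕ-injective (trans (Fin.toℕ-inject≤ _ t≤q) (Fin.toℕ-fromℕ< x<)))) (strictlyInverseʳ x)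

-- Block systems in dimension at least four

module _ {q d} (V : QuadraticSpace q d) where
  open Geometry V

  -- The bounds say q ^ (d - 2) / 2 ≤ n ≤ 2 q ^ (d - 2), with the exponent d - 2 cleared.
  record Growing (B : BlockSystem V) : Set where
    field
      blocks≡ : blocks B ≡ proj₁ (block-number q)
      n-lower : q ℕ.^ d ≤ 2 ℕ.* (∣ BlockSystem.X_R B ∣ ℕ.* (q ℕ.* q))
      n-upper : ∣ BlockSystem.X_R B ∣ ℕ.* (q ℕ.* q) ≤ 2 ℕ.* q ℕ.^ d

  abstract
    -- The threshold is 1024 = 4 · 16², from which on there are at least 16 blocks.
    growing-system : ¬ (2 ∣ q) → 4 ≤ d → 1024 ≤ q → Σ (BlockSystem V) Growing
    growing-system q-odd 4≤d 1024≤q = record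
        { v = v ; w = w ; v≢0 = v≢0 ; Qv≡0 = Qv≡0 ; ⟪w,v⟫≡1 = ⟪w,v⟫≡1
        ; R = R ; R≢0 = R≢0
        ; represented = 0<∣∣⇒∈ (fibre (v ⊥) Q R) (ℕ.n≢0⇒n>0 n≢0)
        ; Z = initial t
        ; Z-nonempty = 0<∣∣⇒∈ (initial t) (subst (0 <_) (sym ∣Z∣≡t) (ℕ.≤-trans (s≤s z≤n) (4T²≤q⇒T≤t {1} (ℕ.≤-trans (s≤s (s≤s (s≤s (s≤s z≤n)))) 1024≤q))))
        } , record
      { blocks≡ = ∣Z∣≡t
      ; n-lower = popular
      ; n-upper = ∣v⊥∩sphere∣≤ hyperbolic 3≤d R
      }
      where
      open QuadraticProperties V q-odd
      open IsotropicHyperplane V q-odd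
      open InitialSegment 𝔽

      3≤d : 3 ≤ d
      3≤d = ℕ.≤-trans (ℕ.n≤1+n 3) 4≤d

      t : ℕ
      t = proj₁ (block-number q)

      ∣Z∣≡t : ∣ initial t ∣ ≡ t
      ∣Z∣≡t = ∣initial∣ (block-number≤ q)

      v : Point
      v = proj₁ (isotropic-vector 3≤d)

      v≢0 : v ≢ 0ⱽ
      v≢0 = proj₁ (proj₂ (isotropic-vector 3≤d))

      Qv≡0 : Q v ≡ 0#
      Qv≡0 = proj₂ (proj₂ (isotropic-vector 3≤d))

      w : Point
      w = proj₁ (dual-vector v≢0)

      ⟪w,v⟫≡1 : ⟪ w , v ⟫ ≡ 1#
      ⟪w,v⟫≡1 = proj₂ (dual-vector v≢0)

      hyperbolic : HyperbolicPair v w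
      hyperbolic = record { Qv≡0 = Qv≡0 ; ⟪w,v⟫≡1 = ⟪w,v⟫≡1 }

      radius-choice : ∃[ R ] R ≢ 0# × q ℕ.^ d ≤ 2 ℕ.* (∣ fibre (v ⊥) Q R ∣ ℕ.* (q ℕ.* q))
      radius-choice = popular-radius hyperbolic 3≤d (ℕ.≤-trans (ℕ.m≤m+n 5 1019) 1024≤q)

      R : Carrier
      R = proj₁ radius-choice

      R≢0 : R ≢ 0#
      R≢0 = proj₁ (proj₂ radius-choice)

      popular : q ℕ.^ d ≤ 2 ℕ.* (∣ fibre (v ⊥) Q R ∣ ℕ.* (q ℕ.* q))
      popular = proj₂ (proj₂ radius-choice)

      n≢0 : ∣ fibre (v ⊥) Q R ∣ ≢ 0
      n≢0 n≡0 = ℕ.<⇒≱ (ℕ.m^n>0 q {{nonZero}} d) (subst (λ n → q ℕ.^ d ≤ 2 ℕ.* (n ℕ.* (q ℕ.* q))) n≡0 popular)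

-- The constant K_* and the windows

module StarFacts {{𝓡 : RealNumbers}} {q d} {V : QuadraticSpace q d} (q-odd : ¬ (2 ∣ q)) (1≤d : 1 ≤ d) (B : BlockSystem V) where
  open Geometry V
  open BlockSystem B hiding (blocks; CrossBlocksVanish; ExactCentredBlocks)
  open BlockCounts q-odd B
  open QuadraticProperties V q-odd using (1<q)
  open RealProperties

  private instance
    q≢0 : NonZero q
    q≢0 = nonZero

  -- K_*² is a / b: a is the square of the surplus m, and b is q ^ (d - 1) |P| |𝒮| written in n, t
  -- and q.
  H r p s m a b : ℕ
  H = q ℕ.^ (d ∸ 1)
  r = q ∸ 1
  p = ∣ P ∣
  s = ∣ 𝒮 ∣
  m = n ℕ.* t ℕ.* r
  a = n ℕ.* t ℕ.* r ℕ.* (n ℕ.* t ℕ.* r)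
  b = H ℕ.* (n ℕ.* t ℕ.* (q ℕ.* t))

  ps≡ : p ℕ.* s ≡ n ℕ.* t ℕ.* (q ℕ.* t)
  ps≡ = cong₂ ℕ._*_ ∣P∣≡nt ∣𝒮∣≡qt

  0<q : 0 < q
  0<q = ℕ.<⇒≤ 1<q

  0<r : 0 < r
  0<r = ℕ.m<n⇒0<n∸m 1<q

  0<* : ∀ {x y} → 0 < x → 0 < y → 0 < x ℕ.* y
  0<* {suc _} {suc _} _ _ = s≤s z≤n

  0<nt : 0 < n ℕ.* t
  0<nt = 0<* 0<n 0<t

  0<p : 0 < p
  0<p = subst (0 <_) (sym ∣P∣≡nt) 0<nt

  0<ps : 0 < p ℕ.* s
  0<ps = subst (0 <_) (sym ps≡) (0<* 0<nt (0<* 0<q 0<t))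

  q^d≡qH : q ℕ.^ d ≡ q ℕ.* H
  q^d≡qH = cong (q ℕ.^_) (sym (ℕ.m+[n∸m]≡n 1≤d))

  0<H : 0 < H
  0<H = ℕ.m^n>0 q (d ∸ 1)

  0<b : 0 < b
  0<b = 0<* 0<H (0<* 0<nt (0<* 0<q 0<t))

  h : ℝ
  h = halfPower q d

  0<h : 0ᴿ <ᴿ h
  0<h = halfPower-pos q d

  σ≡m : σ P 𝒮 ≡ m /1
  σ≡m = trans σ-total (cong _/1 (rearrange n t r))
    where
    rearrange : ∀ n t r → t ℕ.* (n ℕ.* r) ≡ n ℕ.* t ℕ.* r
    rearrange = solve-∀

  star-constant : Σ[ K ∈ ℝ⁺ ] StarConstant B K
  star-constant = (fromℕ m *ᴿ inv h√⁺ , *-positive (0<fromℕ (0<* 0<nt 0<r)) (inv-pos h√⁺)) ,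
    ≈-trans (≈-reflexive (cong ι σ≡m)) (≈-sym (≈-trans (*-assoc _ h (√ℕ (p ℕ.* s)))
      (≈-trans (*-assoc (fromℕ m) (inv h√⁺) (value h√⁺))
        (≈-trans (*-congˡ (≈-trans (*-comm (inv h√⁺) (value h√⁺)) (*-inverse h√⁺))) (*-identityʳ (fromℕ m))))))
    where
    h√⁺ : ℝ⁺
    h√⁺ = h *ᴿ √ℕ (p ℕ.* s) , *-positive 0<h (√ℕ-positive 0<ps)

  module _ (K : ℝ⁺) (star : StarConstant B K) where
    star-equation : fromℕ m ≈ᴿ value K *ᴿ h *ᴿ √ℕ (p ℕ.* s)
    star-equation = ≈-trans (≈-reflexive (cong ι (sym σ≡m))) star

    K²b≈a : value K *ᴿ value K *ᴿ fromℕ b ≈ᴿ fromℕ a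
    K²b≈a = ≈-trans (*-congˡ (≈-reflexive (cong (λ N → fromℕ (H ℕ.* N)) (sym ps≡))))
      (star-square K {h} {H} {p ℕ.* s} {m} (halfPower-square q d 1≤d) star-equation)

    window-lower-bound : 4 ℕ.* q ℕ.* b ≤ q ℕ.* t ℕ.* a → WindowLower B K
    window-lower-bound le = /-≤ (K *⁺ K) (≤*K² K {a} {b} 0<b K²b≈a (4 ℕ.* q) s
      (subst (λ s → 4 ℕ.* q ℕ.* b ≤ s ℕ.* a) (sym ∣𝒮∣≡qt) le))

  module _ (n-lower : q ℕ.^ d ≤ 2 ℕ.* (n ℕ.* (q ℕ.* q))) (n-upper : n ℕ.* (q ℕ.* q) ≤ 2 ℕ.* q ℕ.^ d) (4≤q : 4 ≤ q) where
    H≤2nq : H ≤ 2 ℕ.* (n ℕ.* q)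
    H≤2nq = ℕ.*-cancelˡ-≤ q (subst₂ _≤_ q^d≡qH (rearrange n q) n-lower)
      where
      rearrange : ∀ n q → 2 ℕ.* (n ℕ.* (q ℕ.* q)) ≡ q ℕ.* (2 ℕ.* (n ℕ.* q))
      rearrange = solve-∀

    nq≤2H : n ℕ.* q ≤ 2 ℕ.* H
    nq≤2H = ℕ.*-cancelˡ-≤ q (subst₂ _≤_ (rearrange n q) (trans (cong (2 ℕ.*_) q^d≡qH) (rearrange′ H q)) n-upper)
      where
      rearrange : ∀ n q → n ℕ.* (q ℕ.* q) ≡ q ℕ.* (n ℕ.* q)
      rearrange = solve-∀
      rearrange′ : ∀ H q → 2 ℕ.* (q ℕ.* H) ≡ q ℕ.* (2 ℕ.* H)
      rearrange′ = solve-∀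

    b≤4a : b ≤ 4 ℕ.* a
    b≤4a = spread-lower H n t q r H≤2nq (q²≤2[q-1]² q 4≤q)

    a≤4b : a ≤ 4 ℕ.* b
    a≤4b = spread-upper H n t q r nq≤2H (ℕ.m∸n≤m q 1)

    module _ (K : ℝ⁺) (star : StarConstant B K) where
      K-lower : 1ᴿ ≤ᴿ fromℕ 2 *ᴿ value K
      K-lower = 1≤2K K {a} {b} 0<b (K²b≈a K star) b≤4a

      K-upper : value K ≤ᴿ fromℕ 2
      K-upper = K≤2 K {a} {b} 0<b (K²b≈a K star) a≤4b

      sphere-count : 4 ℕ.* (t ℕ.* t) ≤ q → q ℕ.* q ℕ.* q ≤ H → fromℕ s ≤ᴿ value K *ᴿ h
      sphere-count 4t²≤q q³≤H = square-cancel-≤ (*-positive (proj₂ K) 0<h)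
        (≤-respˡ (fromℕ-* s s) (≤-respʳ square (subst (λ s → fromℕ (s ℕ.* s) ≤ᴿ fromℕ H *ᴿ (value K *ᴿ value K)) (sym ∣𝒮∣≡qt)
          (≤*K² K {a} {b} 0<b (K²b≈a K star) (q ℕ.* t ℕ.* (q ℕ.* t)) H
            (window-upper H (n ℕ.* t) (q ℕ.* t) r (spheres-cubed H n t q r 4t²≤q q³≤H H≤2nq (q²≤2[q-1]² q 4≤q)))))))
        where
        square : fromℕ H *ᴿ (value K *ᴿ value K) ≈ᴿ value K *ᴿ h *ᴿ (value K *ᴿ h)
        square = ≈-trans (*-congʳ (≈-sym (halfPower-square q d 1≤d)))
          (solve 2 (λ k h → h :* h :* (k :* k) := k :* h :* (k :* h)) ≈-refl (value K) h)

      window : (C₁ : ℝ) → 1ᴿ ≤ᴿ C₁ → 16 ≤ t → 4 ℕ.* (t ℕ.* t) ≤ q → q ℕ.* q ℕ.* q ≤ H → Window B C₁ K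
      window C₁ 1≤C₁ 16≤t 4t²≤q q³≤H = window-lower-bound K star (window-lower a b q t 16≤t b≤4a) ,
        ≤-trans (sphere-count 4t²≤q q³≤H) (≤-respˡ (*-identityˡ _) (≤-respʳ (≈-sym (*-assoc C₁ (value K) h))
          (*-monoˡ-≤ (*-positive (proj₂ K) 0<h) 1≤C₁)))

      moderate-window : fromℕ (4 ℕ.* p) /ᴿ (K *⁺ K *⁺ fromℕ⁺ H {{ℕ.m^n≢0 q (d ∸ 1)}}) ≤ᴿ fromℕ s
      moderate-window = /-≤ (K *⁺ K *⁺ fromℕ⁺ H {{ℕ.m^n≢0 q (d ∸ 1)}}) (≤-respʳ regroup
        (≤*K² K {a} {b} 0<b (K²b≈a K star) (4 ℕ.* p) (s ℕ.* H)
          (subst₂ (λ p s → 4 ℕ.* p ℕ.* b ≤ s ℕ.* H ℕ.* a) (sym ∣P∣≡nt) (sym ∣𝒮∣≡qt)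
            (moderate-lower H (n ℕ.* t) (q ℕ.* t) r (ℕ.*-mono-≤ {2} {r} {2} {r} 2≤r 2≤r)))))
        where
        2≤r : 2 ≤ r
        2≤r = ℕ.∸-monoˡ-≤ 1 (ℕ.≤-trans (ℕ.n≤1+n 3) 4≤q)

        regroup : fromℕ (s ℕ.* H) *ᴿ (value K *ᴿ value K) ≈ᴿ fromℕ s *ᴿ (value K *ᴿ value K *ᴿ fromℕ H)
        regroup = ≈-trans (*-congʳ (fromℕ-* s H)) (solve 3 (λ s h k → s :* h :* k := s :* (k :* h)) ≈-refl (fromℕ s) (fromℕ H) (value K *ᴿ value K))

-- Estimates for the growing systems

module GrowingFacts {{𝓡 : RealNumbers}} {q d} (V : QuadraticSpace q d)
                    (q-odd : ¬ (2 ∣ q)) (4≤d : 4 ≤ d) (1024≤q : 1024 ≤ q)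
                    (B : BlockSystem V) (growing : Growing V B) where
  open Geometry V
  open Growing growing
  open BlockSystem B hiding (blocks; CrossBlocksVanish; ExactCentredBlocks)
  open BlockCounts q-odd B
  open FlatBounds q-odd B 4≤d
  open HyperplaneFlats V
  open StarFacts q-odd (ℕ.≤-trans (s≤s z≤n) 4≤d) B
  open RealProperties

  4≤q : 4 ≤ q
  4≤q = ℕ.≤-trans (ℕ.m≤m+n 4 1020) 1024≤q

  T≤t : ∀ {T} → 4 ℕ.* (T ℕ.* T) ≤ q → T ≤ t
  T≤t 4T²≤q = subst (_ ≤_) (sym blocks≡) (4T²≤q⇒T≤t 4T²≤q)

  4t²≤q : 4 ℕ.* (t ℕ.* t) ≤ q
  4t²≤q = subst (λ t → 4 ℕ.* (t ℕ.* t) ≤ q) (sym blocks≡) (proj₁ (proj₂ (block-number q)))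

  t≤q : t ≤ q
  t≤q = subst (_≤ q) (sym blocks≡) (block-number≤ q)

  q³≤H : q ℕ.* q ℕ.* q ≤ H
  q³≤H = subst (_≤ H) (rearrange q) (ℕ.^-monoʳ-≤ q {{nonZero}} (ℕ.∸-monoˡ-≤ 1 4≤d))
    where
    rearrange : ∀ q → q ℕ.* (q ℕ.* (q ℕ.* 1)) ≡ q ℕ.* q ℕ.* q
    rearrange = solve-∀

  flat-bound : (L : Flat) → Flat.Proper L → ∣ P ∩ Flat.points L ∣ ℕ.* t ≤ 4 ℕ.* p
  flat-bound L = ∣P∩L∣t≤4∣P∣ L t≤q n-lower

  hyperplane-bound : ∀ a b → a ≢ 0ⱽ → ∣ P ∩ hyperplane a b ∣ ℕ.* t ≤ 4 ℕ.* p
  hyperplane-bound a b a≢0 = cases (∃? (_∈? (P ∩ hyperplane a b)))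
    where
    cases : Dec (∃[ x ] x ∈ P ∩ hyperplane a b) → ∣ P ∩ hyperplane a b ∣ ℕ.* t ≤ 4 ℕ.* p
    -- A hyperplane is turned into a flat by basing it at one of its points in P, so an empty
    -- intersection is settled separately.
    cases (no empty) = subst (λ m → m ℕ.* t ≤ 4 ℕ.* p) (sym (∅⇒∣∣≡0 (P ∩ hyperplane a b) λ x x∈ → empty (x , x∈))) z≤n
    cases (yes (x₀ , _ , x₀∈)) = ℕ.≤-trans
      (ℕ.*-monoˡ-≤ t (⊆⇒∣∣≤ (P ∩ hyperplane a b) (P ∩ Flat.points (hyperplane-flat a a≢0 x₀))
        λ x (x∈P , x∈H) → x∈P , hyperplane⊆flat a a≢0 x₀ b x₀∈ x x∈H))
      (flat-bound (hyperplane-flat a a≢0 x₀) (hyperplane-proper a a≢0 x₀))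

  max-hyperplane-bound : maxHyperplane P ℕ.* t ≤ 4 ℕ.* p
  max-hyperplane-bound = ℕ.≤-trans (ℕ.*-monoˡ-≤ t
    -- The argument `z≤n` covers the default value 0 of the maximum; the common bound is 4 p / t
    -- rounded down.
    (max≤v⁺ {4 ℕ.* p ℕ./ t} z≤n (All.map⁺ (All.map (λ { {a , b} a≢0 → ≤/t (hyperplane-bound a b a≢0) })
      (All.all-filter (λ (a , b) → ¬? (a ≟ 0ⱽ)) (Finite.elements finite-×))))))
    (ℕ.m/n*n≤m (4 ℕ.* p) t)
    where
    instance
      t≢0 : NonZero t
      t≢0 = ℕ.>-nonZero 0<t

    ≤/t : ∀ {x} → x ℕ.* t ≤ 4 ℕ.* p → x ≤ 4 ℕ.* p ℕ./ t
    ≤/t {x} xt≤4p = subst (_≤ 4 ℕ.* p ℕ./ t) (ℕ.m*n/n≡m x t) (ℕ./-monoˡ-≤ t xt≤4p)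

  share-below : ∀ {ε : ℝ} {x} W → 0 < W → 1ᴿ ≤ᴿ ε *ᴿ fromℕ W → suc (4 ℕ.* W) ≤ t → x ℕ.* t ≤ 4 ℕ.* p → fromℕ x <ᴿ ε *ᴿ fromℕ p
  share-below {x = x} W 0<W 1≤εW 4W<t xt≤4p = ratio-below {x = x} 0<W 0<p 1≤εW (small-share {x} {t} {p} {W} xt≤4p 4W<t 0<p)

  exact-blocks : ExactCentredBlocks B
  exact-blocks = exact-centred-blocks

  16≤t : 16 ≤ t
  16≤t = T≤t {16} 1024≤q

  K-window : (C₁ : ℝ) → 1ᴿ ≤ᴿ C₁ → ∀ K → StarConstant B K → Window B C₁ K
  K-window C₁ 1≤C₁ K star = window n-lower n-upper 4≤q K star C₁ 1≤C₁ 16≤t 4t²≤q q³≤H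

  -- As K_* stays between 1/2 and 2, the factor c K_* ^ (- C) is at least 1 / (W M) for every q,
  -- whereas a hyperplane has a share of at most 4 / t.
  hyperplanes-below : (c⁺ : ℝ⁺) (C : ℝ) → ∀ W M → 0 < W → 0 < M → 1ᴿ ≤ᴿ value c⁺ *ᴿ fromℕ W →
    (∀ (K : ℝ⁺) → 1ᴿ ≤ᴿ fromℕ 2 *ᴿ value K → value K ≤ᴿ fromℕ 2 → 1ᴿ ≤ᴿ value (K ^ᴿ (-ᴿ C)) *ᴿ fromℕ M) →
    suc (4 ℕ.* (W ℕ.* M)) ≤ t → (K : ℝ⁺) → StarConstant B K → HyperplanesBelow B c⁺ C K
  hyperplanes-below c⁺ C W M 0<W 0<M 1≤cW 1≤K⁻ᶜM 4WM<t K star a b a≢0 =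
    share-below {x = ∣ P ∩ hyperplane a b ∣} (W ℕ.* M) (0<* 0<W 0<M) 1≤ε[WM] 4WM<t (hyperplane-bound a b a≢0)
    where
    k : ℝ
    k = value (K ^ᴿ (-ᴿ C))

    1≤ε[WM] : 1ᴿ ≤ᴿ value c⁺ *ᴿ k *ᴿ fromℕ (W ℕ.* M)
    1≤ε[WM] = ≤-respˡ (*-identityˡ 1ᴿ) (≤-respʳ
      (≈-trans (solve 4 (λ c w k m → c :* w :* (k :* m) := c :* k :* (w :* m)) ≈-refl (value c⁺) (fromℕ W) k (fromℕ M)) (*-congˡ (≈-sym (fromℕ-* W M))))
      (*-mono-≤ 0<1 (*-positive (proj₂ c⁺) (0<fromℕ 0<W)) 1≤cW (1≤K⁻ᶜM K (K-lower n-lower n-upper 4≤q K star) (K-upper n-lower n-upper 4≤q K star))))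

  good-constant : (C₁ : ℝ) → 1ᴿ ≤ᴿ C₁ → Σ[ K ∈ ℝ⁺ ] StarConstant B K × Window B C₁ K
  good-constant C₁ 1≤C₁ = proj₁ star-constant , proj₂ star-constant , K-window C₁ 1≤C₁ (proj₁ star-constant) (proj₂ star-constant)

  max-hyperplane-below : (ε : ℝ⁺) → ∀ W → 0 < W → 1ᴿ ≤ᴿ value ε *ᴿ fromℕ W → suc (4 ℕ.* W) ≤ t → MaxHyperplaneRatioBelow B ε
  max-hyperplane-below ε W 0<W 1≤εW 4W<t = share-below {x = maxHyperplane P} W 0<W 1≤εW 4W<t max-hyperplane-bound

  proper-flats-below : (δ : ℝ⁺) → ∀ W → 0 < W → 1ᴿ ≤ᴿ value δ *ᴿ fromℕ W → suc (4 ℕ.* W) ≤ t → ProperFlatsBelow B δ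
  proper-flats-below δ W 0<W 1≤δW 4W<t L proper = <⇒≤ (share-below {x = ∣ P ∩ Flat.points L ∣} W 0<W 1≤δW 4W<t (flat-bound L proper))

  flats-below : (δ : ℝ⁺) → ∀ W → 0 < W → 1ᴿ ≤ᴿ value δ *ᴿ fromℕ W → suc (4 ℕ.* W) ≤ t →
                ProperFlatsBelow B δ × TotallySingularFlatsBelow B δ
  flats-below δ W 0<W 1≤δW 4W<t = proper-flats-below δ W 0<W 1≤δW 4W<t ,
    λ L singular → proper-flats-below δ W 0<W 1≤δW 4W<t L (totally-singular⇒proper L singular)

  -- The system is itself the counterexample: for K = K_* the surplus condition is an equality. The
  -- lower end of the moderate window involves |P| instead of q and is verified separately.
  refute-lower-bound : (C₁ : ℝ) → 1ᴿ ≤ᴿ C₁ → (c : ℝ⁺) (C : ℝ) → ((K : ℝ⁺) → StarConstant B K → HyperplanesBelow B c C K) →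
                       ¬ LowerBoundFollows V C₁ c C
  refute-lower-bound C₁ 1≤C₁ c C below follows = contradicted (follows P 𝒮 K one-radius (≈⇒≤ (≈-sym star))
    (moderate-window n-lower n-upper 4≤q K star , proj₂ (K-window C₁ 1≤C₁ K star)))
    where
    K : ℝ⁺
    K = proj₁ star-constant
    star : StarConstant B K
    star = proj₂ star-constant
    contradicted : ¬ (∃₂ λ a b → a ≢ 0ⱽ × Surplus.threshold V c C K P ≤ᴿ fromℕ ∣ P ∩ hyperplane a b ∣)
    contradicted (a , b , a≢0 , threshold≤) = threshold≤ (below K star a b a≢0)

-- The family depends on d alone; C₁ and the tolerances enter only through the estimates.
growing-family : ∀ {d} → 4 ≤ d → Family d
growing-family 4≤d = 1024 , λ q 1024≤q opp V → proj₁ (growing-system V (proj₁ opp) 4≤d 1024≤q)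

module _ {{𝓡 : RealNumbers}} {d} (4≤d : 4 ≤ d) where
  open RealProperties using (power-bound; reciprocal-bound)

  module Chosen {q} (1024≤q : 1024 ≤ q) (opp : OddPrimePower q) (V : QuadraticSpace q d) where
    open GrowingFacts V (proj₁ opp) 4≤d 1024≤q (proj₂ (growing-family 4≤d) q 1024≤q opp V) (proj₂ (growing-system V (proj₁ opp) 4≤d 1024≤q)) public

  growing-blocks : ∀ T → Eventually (growing-family 4≤d) (λ B → T ≤ blocks B)
  growing-blocks T = 4 ℕ.* (T ℕ.* T) , λ q 1024≤q opp V N≤q → Chosen.T≤t 1024≤q opp V {T} N≤q

  growing-window : (C₁ : ℝ) → 1ᴿ ≤ᴿ C₁ →
    Always (growing-family 4≤d) (λ B → ExactCentredBlocks B × OneRadius B × (Σ[ K ∈ ℝ⁺ ] StarConstant B K × Window B C₁ K))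
  growing-window C₁ 1≤C₁ q 1024≤q opp V = Chosen.exact-blocks 1024≤q opp V ,
    BlockCounts.one-radius (proj₁ opp) (proj₂ (growing-family 4≤d) q 1024≤q opp V) , Chosen.good-constant 1024≤q opp V C₁ 1≤C₁

  max-hyperplane-share : (ε : ℝ⁺) → Eventually (growing-family 4≤d) (λ B → MaxHyperplaneRatioBelow B ε)
  -- From q ≥ 4 (4 W + 1)² on, t exceeds 4 W, so the share 4 / t falls below 1 / W ≤ ε.
  max-hyperplane-share ε = 4 ℕ.* (suc (4 ℕ.* W) ℕ.* suc (4 ℕ.* W)) , λ q 1024≤q opp V N≤q →
    Chosen.max-hyperplane-below 1024≤q opp V ε W (proj₁ (proj₂ (reciprocal-bound ε))) (proj₂ (proj₂ (reciprocal-bound ε))) (Chosen.T≤t 1024≤q opp V {suc (4 ℕ.* W)} N≤q)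
    where
    W : ℕ
    W = proj₁ (reciprocal-bound ε)

  proper-flat-share : (δ : ℝ⁺) → Eventually (growing-family 4≤d) (λ B → ProperFlatsBelow B δ × TotallySingularFlatsBelow B δ)
  proper-flat-share δ = 4 ℕ.* (suc (4 ℕ.* W) ℕ.* suc (4 ℕ.* W)) , λ q 1024≤q opp V N≤q →
    Chosen.flats-below 1024≤q opp V δ W (proj₁ (proj₂ (reciprocal-bound δ))) (proj₂ (proj₂ (reciprocal-bound δ))) (Chosen.T≤t 1024≤q opp V {suc (4 ℕ.* W)} N≤q)
    where
    W : ℕ
    W = proj₁ (reciprocal-bound δ)

  module _ (c : ℝ⁺) (C : ℝ) where
    private
      W M T : ℕ
      W = proj₁ (reciprocal-bound c)
      M = proj₁ (power-bound C)
      T = suc (4 ℕ.* (W ℕ.* M))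

    hyperplane-shares : Eventually (growing-family 4≤d) (λ B → (K : ℝ⁺) → StarConstant B K → HyperplanesBelow B c C K)
    hyperplane-shares = 4 ℕ.* (T ℕ.* T) , λ q 1024≤q opp V N≤q →
      Chosen.hyperplanes-below 1024≤q opp V c C W M (proj₁ (proj₂ (reciprocal-bound c))) (proj₁ (proj₂ (power-bound C)))
        (proj₂ (proj₂ (reciprocal-bound c))) (proj₂ (proj₂ (power-bound C))) (Chosen.T≤t 1024≤q opp V {T} N≤q)

    lower-bound-fails : (C₁ : ℝ) → 1ᴿ ≤ᴿ C₁ → ForAllLarge d (λ V → ¬ LowerBoundFollows V C₁ c C)
    lower-bound-fails C₁ 1≤C₁ = 1024 ℕ.+ 4 ℕ.* (T ℕ.* T) , λ q N≤q opp V →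
      let 1024≤q = ℕ.≤-trans (ℕ.m≤m+n 1024 (4 ℕ.* (T ℕ.* T))) N≤q in
      Chosen.refute-lower-bound 1024≤q opp V C₁ 1≤C₁ c C
        (proj₂ hyperplane-shares q 1024≤q opp V (ℕ.≤-trans (ℕ.m≤n+m (4 ℕ.* (T ℕ.* T)) 1024) N≤q))

-- Block systems in dimension three

1/t*[tx]≡x : ∀ t x .{{_ : NonZero t}} → ℤ.+ 1 ℚ./ t ℚ.* (t ℕ.* x) /1 ≡ x /1
1/t*[tx]≡x (suc t) x = ℚ.toℚᵘ-injective (begin
  ℚ.toℚᵘ (ℤ.+ 1 ℚ./ suc t ℚ.* (suc t ℕ.* x) /1)
    ≈⟨ ℚ.toℚᵘ-homo-* (ℤ.+ 1 ℚ./ suc t) ((suc t ℕ.* x) /1) ⟩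
  ℚ.toℚᵘ (ℤ.+ 1 ℚ./ suc t) ℚᵘ.* ℚ.toℚᵘ ((suc t ℕ.* x) /1)
    ≈⟨ ℚᵘ.*-cong (ℚ.toℚᵘ-fromℚᵘ (ℚᵘ.mkℚᵘ (ℤ.+ 1) t)) (ℚ.toℚᵘ-fromℚᵘ (ℚᵘ.mkℚᵘ (ℤ.+ (suc t ℕ.* x)) 0)) ⟩
  ℚᵘ.mkℚᵘ (ℤ.+ 1) t ℚᵘ.* ℚᵘ.mkℚᵘ (ℤ.+ (suc t ℕ.* x)) 0                   ≈⟨ ℚᵘ.*≡* cross ⟩
  ℚᵘ.mkℚᵘ (ℤ.+ x) 0
    ≈⟨ ℚ.toℚᵘ-fromℚᵘ (ℚᵘ.mkℚᵘ (ℤ.+ x) 0) ⟨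
  ℚ.toℚᵘ (x /1) ∎)
  where
  open import Relation.Binary.Reasoning.Setoid ℚᵘ.≃-setoid
  cross : ℤ.+ 1 ℤ.* ℤ.+ (suc t ℕ.* x) ℤ.* ℤ.+ 1 ≡ ℤ.+ x ℤ.* ℤ.+ (suc t ℕ.* 1)
  cross = trans (ℤ.*-identityʳ _) (trans (ℤ.*-identityˡ _) (trans (ℤ.pos-* (suc t) x) (trans (ℤ.*-comm (ℤ.+ suc t) (ℤ.+ x))
    (cong (λ k → ℤ.+ x ℤ.* ℤ.+ k) (sym (ℕ.*-identityʳ (suc t)))))))

module HyperbolicCompletion {q} (V : QuadraticSpace q 3) (q-odd : ¬ (2 ∣ q)) where
  open Geometry V
  open FieldProperties 𝔽
  open VectorIdentities 𝔽
  open QuadraticProperties V q-odd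
  open IsotropicHyperplane V q-odd

  module _ {v w y : Point} (hyperbolic : HyperbolicPair v w) (y⊥v : y ∈ v ⊥) (Qy≢0 : Q y ≢ 0#) where
    open HyperbolicPair hyperbolic
    open ≡-Reasoning

    w′ : Point
    w′ = reject y w

    w′⊥y : ⟪ w′ , y ⟫ ≡ 0#
    w′⊥y = reject-⊥ Qy≢0 w

    ⟪v,w′⟫≡1 : ⟪ v , w′ ⟫ ≡ 1#
    ⟪v,w′⟫≡1 = trans (⟪⟫-sym v w′) (trans (reject-⟪⟫ y⊥v w) ⟪w,v⟫≡1)

    ⟪v,v⟫≡0 : ⟪ v , v ⟫ ≡ 0#
    ⟪v,v⟫≡0 = trans (⟪x,x⟫≡Qx v) Qv≡0

    combination : Point → Carrier × Carrier × Carrier × Carrier → Point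
    combination x (a , b , c , e) = (((0ⱽ +ⱽ e · x) +ⱽ c · w′) +ⱽ b · y) +ⱽ a · v

    ⟪combination⟫ : ∀ x a b c e u → ⟪ combination x (a , b , c , e) , u ⟫ ≡ e * ⟪ x , u ⟫ + c * ⟪ w′ , u ⟫ + b * ⟪ y , u ⟫ + a * ⟪ v , u ⟫
    ⟪combination⟫ x a b c e u = trans (⟪⟫-+·ˡ _ a v u) (cong (_+ a * ⟪ v , u ⟫) (trans (⟪⟫-+·ˡ _ b y u) (cong (_+ b * ⟪ y , u ⟫)
      (trans (⟪⟫-+·ˡ _ c w′ u) (cong (_+ c * ⟪ w′ , u ⟫) (trans (⟪⟫-+·ˡ 0ⱽ e x u) (trans (cong (_+ e * ⟪ x , u ⟫) (⟪⟫-zeroˡ u)) (+-identityˡ _))))))))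

    -- A nonzero such x would give four independent vectors in dimension three.
    orthogonal⇒≡0 : ∀ x → x ∈ v ⊥ → x ∈ y ⊥ → x ∈ w′ ⊥ → x ≡ 0ⱽ
    orthogonal⇒≡0 x x⊥v x⊥y x⊥w′ = decidable-stable (x ≟ 0ⱽ) λ x≢0 → ℕ.<⇒≱ q³<q⁴ (count x≢0)
      where
      𝔽¹ : Subset Carrier
      𝔽¹ = full

      -- Pairing a combination with v, y and w′ returns c, b Q y and c ⟪ w′ , w′ ⟫ + a. These
      -- determine c, b and a, and what remains is e x = e′ x.
      coordinate-c : ∀ a b c e → ⟪ combination x (a , b , c , e) , v ⟫ ≡ c
      coordinate-c a b c e = begin
        ⟪ combination x (a , b , c , e) , v ⟫
          ≡⟨ ⟪combination⟫ x a b c e v ⟩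
        e * ⟪ x , v ⟫ + c * ⟪ w′ , v ⟫ + b * ⟪ y , v ⟫ + a * ⟪ v , v ⟫
          ≡⟨ cong₂ _+_ (cong₂ _+_ (cong₂ (λ p r → e * p + c * r) x⊥v (trans (⟪⟫-sym w′ v) ⟪v,w′⟫≡1)) (cong (b *_) y⊥v)) (cong (a *_) ⟪v,v⟫≡0) ⟩
        e * 0# + c * 1# + b * 0# + a * 0#
          ≡⟨ solve 4 (λ a b c e → e :* con (ℤ.+ 0) :+ c :* con (ℤ.+ 1) :+ b :* con (ℤ.+ 0) :+ a :* con (ℤ.+ 0) := c) refl a b c e ⟩
        c ∎

      coordinate-b : ∀ a b c e → ⟪ combination x (a , b , c , e) , y ⟫ ≡ b * Q y
      coordinate-b a b c e = begin
        ⟪ combination x (a , b , c , e) , y ⟫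
          ≡⟨ ⟪combination⟫ x a b c e y ⟩
        e * ⟪ x , y ⟫ + c * ⟪ w′ , y ⟫ + b * ⟪ y , y ⟫ + a * ⟪ v , y ⟫
          ≡⟨ cong₂ _+_ (cong₂ _+_ (cong₂ (λ p r → e * p + c * r) x⊥y w′⊥y) (cong (b *_) (⟪x,x⟫≡Qx y))) (cong (a *_) (trans (⟪⟫-sym v y) y⊥v)) ⟩
        e * 0# + c * 0# + b * Q y + a * 0#
          ≡⟨ solve 4 (λ a b c e → e :* con (ℤ.+ 0) :+ c :* con (ℤ.+ 0) :+ b :+ a :* con (ℤ.+ 0) := b) refl a (b * Q y) c e ⟩
        b * Q y ∎

      coordinate-a : ∀ a b c e → ⟪ combination x (a , b , c , e) , w′ ⟫ ≡ c * ⟪ w′ , w′ ⟫ + a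
      coordinate-a a b c e = begin
        ⟪ combination x (a , b , c , e) , w′ ⟫
          ≡⟨ ⟪combination⟫ x a b c e w′ ⟩
        e * ⟪ x , w′ ⟫ + c * ⟪ w′ , w′ ⟫ + b * ⟪ y , w′ ⟫ + a * ⟪ v , w′ ⟫
          ≡⟨ cong₂ _+_ (cong₂ _+_ (cong (λ p → e * p + c * ⟪ w′ , w′ ⟫) x⊥w′) (cong (b *_) (trans (⟪⟫-sym y w′) w′⊥y))) (cong (a *_) ⟪v,w′⟫≡1) ⟩
        e * 0# + c * ⟪ w′ , w′ ⟫ + b * 0# + a * 1#
          ≡⟨ solve 4 (λ a b c e → e :* con (ℤ.+ 0) :+ c :+ b :* con (ℤ.+ 0) :+ a :* con (ℤ.+ 1) := c :+ a) refl a b (c * ⟪ w′ , w′ ⟫) e ⟩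
        c * ⟪ w′ , w′ ⟫ + a ∎

      injective : x ≢ 0ⱽ → ∀ a b c e a′ b′ c′ e′ → combination x (a , b , c , e) ≡ combination x (a′ , b′ , c′ , e′) →
                  (a , b , c , e) ≡ (a′ , b′ , c′ , e′)
      injective x≢0 a b c e a′ b′ c′ e′ eq = cong₂ _,_ a≡ (cong₂ _,_ b≡ (cong₂ _,_ c≡ e≡))
        where
        c≡ : c ≡ c′
        c≡ = trans (sym (coordinate-c a b c e)) (trans (cong (λ p → ⟪ p , v ⟫) eq) (coordinate-c a′ b′ c′ e′))

        b≡ : b ≡ b′
        b≡ = *-cancelʳ Qy≢0 (trans (sym (coordinate-b a b c e)) (trans (cong (λ p → ⟪ p , y ⟫) eq) (coordinate-b a′ b′ c′ e′)))

        a≡ : a ≡ a′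
        a≡ = +-cancelˡ (c * ⟪ w′ , w′ ⟫) (trans (sym (coordinate-a a b c e)) (trans (cong (λ p → ⟪ p , w′ ⟫) eq)
          (trans (coordinate-a a′ b′ c′ e′) (cong (λ c → c * ⟪ w′ , w′ ⟫ + a′) (sym c≡)))))

        ex≡e′x : 0ⱽ +ⱽ e · x ≡ 0ⱽ +ⱽ e′ · x
        ex≡e′x = +·-cancel c≡ (+·-cancel b≡ (+·-cancel a≡ eq))

        e≡ : e ≡ e′
        e≡ = decidable-stable (e ≟ e′) λ e≢e′ → x≢0 (begin
          x                                ≡⟨ ·-cancel (e≢e′ ∘ sym ∘ x-y≡0⇒x≡y) x ⟨
          (e′ - e) ⁻¹ · (e′ - e) · x
            ≡⟨ cong ((e′ - e) ⁻¹ ·_) (trans (sym (x+ay≡z+by⇒x-z ex≡e′x)) (x-x 0ⱽ)) ⟩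
          (e′ - e) ⁻¹ · 0ⱽ                 ≡⟨ a·0 ((e′ - e) ⁻¹) ⟩
          0ⱽ ∎)

      count : x ≢ 0ⱽ → q ℕ.* (q ℕ.* (q ℕ.* q)) ≤ q ℕ.^ 3
      count x≢0 = subst₂ _≤_
        (trans (∣⊗∣ 𝔽¹ (𝔽¹ ⊗ 𝔽¹ ⊗ 𝔽¹)) (cong₂ ℕ._*_ ∣full-Carrier∣ (trans (∣⊗∣ 𝔽¹ (𝔽¹ ⊗ 𝔽¹)) (cong₂ ℕ._*_ ∣full-Carrier∣
          (trans (∣⊗∣ 𝔽¹ 𝔽¹) (cong₂ ℕ._*_ ∣full-Carrier∣ ∣full-Carrier∣))))))
        ∣Point∣
        (injection⇒∣∣≤ (𝔽¹ ⊗ 𝔽¹ ⊗ 𝔽¹ ⊗ 𝔽¹) full (combination x) (λ _ _ → tt)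
          λ (a , b , c , e) (a′ , b′ , c′ , e′) _ _ eq → injective x≢0 a b c e a′ b′ c′ e′ eq)

      q³<q⁴ : q ℕ.^ 3 < q ℕ.* (q ℕ.* (q ℕ.* q))
      q³<q⁴ = ℕ.*-monoʳ-< q {{nonZero}} (ℕ.*-monoʳ-< q {{nonZero}} (ℕ.*-monoʳ-< q {{nonZero}} 1<q))

    -- The square roots of 1, in the form to which the bound for `roots` applies; 1 ≠ - 1 makes them
    -- exactly two.
    signs : Subset Carrier
    signs = roots 1# 0# (- 1#)

    sign⇔ : ∀ b → b * b - 1# ≡ 1# * (b * b) + 0# * b + - 1#
    sign⇔ b = solve 1 (λ b → b :* b :- con (ℤ.+ 1) := con (ℤ.+ 1) :* (b :* b) :+ con (ℤ.+ 0) :* b :+ :- con (ℤ.+ 1)) refl b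

    ∣signs∣≡2 : ∣ signs ∣ ≡ 2
    ∣signs∣≡2 = ℕ.≤-antisym (∣roots∣≤2 1# 0# (- 1#) (λ (1≡0 , _) → 0≢1 (sym 1≡0)))
      (2≤∣∣ signs {x = 1#} {y = - 1#}
        (solve 0 (con (ℤ.+ 1) :* (con (ℤ.+ 1) :* con (ℤ.+ 1)) :+ con (ℤ.+ 0) :* con (ℤ.+ 1) :+ :- con (ℤ.+ 1) := con (ℤ.+ 0)) refl)
        (solve 0 (con (ℤ.+ 1) :* (:- con (ℤ.+ 1) :* :- con (ℤ.+ 1)) :+ con (ℤ.+ 0) :* :- con (ℤ.+ 1) :+ :- con (ℤ.+ 1) := con (ℤ.+ 0)) refl)
        λ 1≡-1 → 2#≢0 (trans (cong (1# +_) 1≡-1) (-‿inverseʳ 1#)))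

    point : Carrier × Carrier → Point
    point (a , b) = (0ⱽ +ⱽ a · v) +ⱽ b · y

    ⟪0+av⟫ : ∀ a u → ⟪ 0ⱽ +ⱽ a · v , u ⟫ ≡ a * ⟪ v , u ⟫
    ⟪0+av⟫ a u = trans (⟪⟫-+·ˡ 0ⱽ a v u) (trans (cong (_+ a * ⟪ v , u ⟫) (⟪⟫-zeroˡ u)) (+-identityˡ _))

    ⟪point⟫ : ∀ a b u → ⟪ point (a , b) , u ⟫ ≡ a * ⟪ v , u ⟫ + b * ⟪ y , u ⟫
    ⟪point⟫ a b u = trans (⟪⟫-+·ˡ _ b y u) (cong (_+ b * ⟪ y , u ⟫) (⟪0+av⟫ a u))

    point-⊥ : ∀ a b → point (a , b) ∈ v ⊥
    point-⊥ a b = trans (⟪point⟫ a b v) (trans (cong₂ (λ p r → a * p + b * r) ⟪v,v⟫≡0 y⊥v)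
      (solve 2 (λ a b → a :* con (ℤ.+ 0) :+ b :* con (ℤ.+ 0) := con (ℤ.+ 0)) refl a b))

    Q-point : ∀ a b → Q (point (a , b)) ≡ b * b * Q y
    Q-point a b = begin
      Q (point (a , b))
        ≡⟨ ⟪x,x⟫≡Qx (point (a , b)) ⟨
      ⟪ point (a , b) , point (a , b) ⟫
        ≡⟨ ⟪point⟫ a b (point (a , b)) ⟩
      a * ⟪ v , point (a , b) ⟫ + b * ⟪ y , point (a , b) ⟫
        ≡⟨ cong₂ (λ p r → a * p + b * r) (trans (⟪⟫-sym v _) (point-⊥ a b))
            (trans (⟪⟫-sym y _) (⟪point⟫ a b y)) ⟩
      a * 0# + b * (a * ⟪ v , y ⟫ + b * ⟪ y , y ⟫)
        ≡⟨ cong₂ (λ p r → a * 0# + b * (a * p + b * r)) (trans (⟪⟫-sym v y) y⊥v) (⟪x,x⟫≡Qx y) ⟩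
      a * 0# + b * (a * 0# + b * Q y)
        ≡⟨ solve 3 (λ a b r → a :* con (ℤ.+ 0) :+ b :* (a :* con (ℤ.+ 0) :+ b :* r) := b :* b :* r) refl a b (Q y) ⟩
      b * b * Q y ∎

    ∣v⊥∩Q⁻¹[Qy]∣ : ∣ fibre (v ⊥) Q (Q y) ∣ ≡ 2 ℕ.* q
    ∣v⊥∩Q⁻¹[Qy]∣ = begin
      ∣ fibre (v ⊥) Q (Q y) ∣
        ≡⟨ bijection⇒∣∣≡ (full {Carrier} ⊗ signs) (fibre (v ⊥) Q (Q y)) point
            (λ (a , b) (_ , b∈) → point-⊥ a b , on-sphere a b b∈)
            (λ (a , b) (a′ , b′) _ _ eq → injective a b a′ b′ eq)
            (λ x (x⊥ , Qx) → (⟪ x , w′ ⟫ , ⟪ x , y ⟫ * Q y ⁻¹) , (tt , sign x x⊥ Qx) , decomposition x x⊥) ⟨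
      ∣ full {Carrier} ⊗ signs ∣              ≡⟨ ∣⊗∣ (full {Carrier}) signs ⟩
      ∣ full {Carrier} ∣ ℕ.* ∣ signs ∣        ≡⟨ cong₂ ℕ._*_ ∣full-Carrier∣ ∣signs∣≡2 ⟩
      q ℕ.* 2                                 ≡⟨ ℕ.*-comm q 2 ⟩
      2 ℕ.* q ∎
      where
      on-sphere : ∀ a b → b ∈ signs → Q (point (a , b)) ≡ Q y
      on-sphere a b b∈ = trans (Q-point a b) (trans (cong (_* Q y) (x-y≡0⇒x≡y (trans (sign⇔ b) b∈))) (*-identityˡ (Q y)))

      pairing-y : ∀ a b → ⟪ point (a , b) , y ⟫ ≡ b * Q y
      pairing-y a b = trans (⟪point⟫ a b y) (trans (cong₂ (λ p r → a * p + b * r) (trans (⟪⟫-sym v y) y⊥v) (⟪x,x⟫≡Qx y))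
        (solve 2 (λ a b → a :* con (ℤ.+ 0) :+ b := b) refl a (b * Q y)))

      pairing-w′ : ∀ a b → ⟪ point (a , b) , w′ ⟫ ≡ a
      pairing-w′ a b = trans (⟪point⟫ a b w′) (trans (cong₂ (λ p r → a * p + b * r) ⟪v,w′⟫≡1 (trans (⟪⟫-sym y w′) w′⊥y))
        (solve 2 (λ a b → a :* con (ℤ.+ 1) :+ b :* con (ℤ.+ 0) := a) refl a b))

      injective : ∀ a b a′ b′ → point (a , b) ≡ point (a′ , b′) → (a , b) ≡ (a′ , b′)
      injective a b a′ b′ eq = cong₂ _,_
        (trans (sym (pairing-w′ a b)) (trans (cong (λ p → ⟪ p , w′ ⟫) eq) (pairing-w′ a′ b′)))
        (*-cancelʳ Qy≢0 (trans (sym (pairing-y a b)) (trans (cong (λ p → ⟪ p , y ⟫) eq) (pairing-y a′ b′))))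

      decomposition : ∀ x → x ∈ v ⊥ → point (⟪ x , w′ ⟫ , ⟪ x , y ⟫ * Q y ⁻¹) ≡ x
      decomposition x x⊥ = begin
        (0ⱽ +ⱽ α · v) +ⱽ β · y
          ≡⟨ cong (λ o → (o +ⱽ α · v) +ⱽ β · y) (orthogonal⇒≡0 residue residue⊥v residue⊥y residue⊥w′) ⟨
        (residue +ⱽ α · v) +ⱽ β · y       ≡⟨ cong (_+ⱽ β · y) ([x-ay]+ay α (reject y x) v) ⟩
        reject y x +ⱽ β · y               ≡⟨ [x-ay]+ay β x y ⟩
        x ∎
        where
        α β : Carrier
        α = ⟪ x , w′ ⟫
        β = ⟪ x , y ⟫ * Q y ⁻¹

        -- What is left of x after removing its components along y and v is orthogonal to v, y and
        -- w′, hence zero.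
        residue : Point
        residue = reject y x +ⱽ (- α) · v

        residue⊥v : residue ∈ v ⊥
        residue⊥v = trans (⟪⟫-+·ˡ (reject y x) (- α) v v) (trans (cong₂ (λ p r → p + - α * r) (trans (reject-⟪⟫ y⊥v x) x⊥) ⟪v,v⟫≡0)
          (solve 1 (λ a → con (ℤ.+ 0) :+ :- a :* con (ℤ.+ 0) := con (ℤ.+ 0)) refl α))

        residue⊥y : residue ∈ y ⊥
        residue⊥y = trans (⟪⟫-+·ˡ (reject y x) (- α) v y) (trans (cong₂ (λ p r → p + - α * r) (reject-⊥ Qy≢0 x) (trans (⟪⟫-sym v y) y⊥v))
          (solve 1 (λ a → con (ℤ.+ 0) :+ :- a :* con (ℤ.+ 0) := con (ℤ.+ 0)) refl α))

        residue⊥w′ : residue ∈ w′ ⊥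
        residue⊥w′ = trans (⟪⟫-+·ˡ (reject y x) (- α) v w′) (trans (cong₂ (λ p r → p + - α * r) (reject-⟪⟫ (trans (⟪⟫-sym y w′) w′⊥y) x) ⟪v,w′⟫≡1)
          (solve 1 (λ a → a :+ :- a :* con (ℤ.+ 1) := con (ℤ.+ 0)) refl α))

      sign : ∀ x → x ∈ v ⊥ → Q x ≡ Q y → ⟪ x , y ⟫ * Q y ⁻¹ ∈ signs
      sign x x⊥ Qx≡Qy = trans (sym (sign⇔ β)) (x≡y⇒x-y≡0 (*-cancelʳ Qy≢0 (begin
        β * β * Q y                   ≡⟨ Q-point ⟪ x , w′ ⟫ β ⟨
        Q (point (⟪ x , w′ ⟫ , β))    ≡⟨ cong Q (decomposition x x⊥) ⟩
        Q x                           ≡⟨ Qx≡Qy ⟩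
        Q y                           ≡⟨ *-identityˡ (Q y) ⟨
        1# * Q y ∎)))
        where
        β : Carrier
        β = ⟪ x , y ⟫ * Q y ⁻¹

module _ {q d} (V : QuadraticSpace q d) where
  open Geometry V

  record Ternary (t : ℕ) (B : BlockSystem V) : Set where
    field
      blocks≡t : blocks B ≡ t
      n≡2q     : ∣ BlockSystem.X_R B ∣ ≡ 2 ℕ.* q

module _ {q} (V : QuadraticSpace q 3) where
  open Geometry V

  abstract
    -- R is chosen as a value Q y, so that Q (a v + b y) = b² Q y equals R exactly for b = 1 and b =
    -- - 1.
    ternary-system : ¬ (2 ∣ q) → ∀ t → 0 < t → t ≤ q → Σ (BlockSystem V) (Ternary V t)
    ternary-system q-odd t 0<t t≤q = record
        { v = v ; w = w ; v≢0 = v≢0 ; Qv≡0 = Qv≡0 ; ⟪w,v⟫≡1 = ⟪w,v⟫≡1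
        ; R = Q y ; R≢0 = Qy≢0
        ; represented = y , y⊥v , refl
        ; Z = initial t
        ; Z-nonempty = 0<∣∣⇒∈ (initial t) (subst (0 <_) (sym (∣initial∣ t≤q)) 0<t)
        } , record
      { blocks≡t = ∣initial∣ t≤q
      ; n≡2q     = ∣v⊥∩Q⁻¹[Qy]∣ hyperbolic y⊥v Qy≢0
      }
      where
      open QuadraticProperties V q-odd
      open IsotropicHyperplane V q-odd
      open HyperbolicCompletion V q-odd
      open InitialSegment 𝔽

      v : Point
      v = proj₁ (isotropic-vector ℕ.≤-refl)

      v≢0 : v ≢ 0ⱽ
      v≢0 = proj₁ (proj₂ (isotropic-vector ℕ.≤-refl))

      Qv≡0 : Q v ≡ 0#
      Qv≡0 = proj₂ (proj₂ (isotropic-vector ℕ.≤-refl))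

      w : Point
      w = proj₁ (dual-vector v≢0)

      ⟪w,v⟫≡1 : ⟪ w , v ⟫ ≡ 1#
      ⟪w,v⟫≡1 = proj₂ (dual-vector v≢0)

      hyperbolic : HyperbolicPair v w
      hyperbolic = record { Qv≡0 = Qv≡0 ; ⟪w,v⟫≡1 = ⟪w,v⟫≡1 }

      y : Point
      y = proj₁ (anisotropic-in-v⊥ hyperbolic ℕ.≤-refl)

      y⊥v : y ∈ v ⊥
      y⊥v = proj₁ (proj₂ (anisotropic-in-v⊥ hyperbolic ℕ.≤-refl))

      Qy≢0 : Q y ≢ 0#
      Qy≢0 = proj₂ (proj₂ (anisotropic-in-v⊥ hyperbolic ℕ.≤-refl))

-- With t = 2 this fails for every positive q; with t = 3 it holds from q = 6 on, the difference of
-- the two sides being 3 + 6 k + k² for q = 6 + k.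
2q²≤t[q-1]² : ∀ q t → 6 ≤ q → 3 ≤ t → 2 ℕ.* (q ℕ.* q) ≤ t ℕ.* ((q ∸ 1) ℕ.* (q ∸ 1))
2q²≤t[q-1]² q t 6≤q 3≤t with k , refl ← ℕ.m≤n⇒∃[o]m+o≡n 6≤q = begin
  2 ℕ.* ((6 ℕ.+ k) ℕ.* (6 ℕ.+ k))
    ≤⟨ ℕ.m≤m+n _ (3 ℕ.+ 6 ℕ.* k ℕ.+ k ℕ.* k) ⟩
  2 ℕ.* ((6 ℕ.+ k) ℕ.* (6 ℕ.+ k)) ℕ.+ (3 ℕ.+ 6 ℕ.* k ℕ.+ k ℕ.* k)           ≡⟨ expand k ⟩
  3 ℕ.* ((5 ℕ.+ k) ℕ.* (5 ℕ.+ k))                                           ≤⟨ ℕ.*-monoˡ-≤ _ 3≤t ⟩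
  t ℕ.* ((5 ℕ.+ k) ℕ.* (5 ℕ.+ k)) ∎
  where
  open ℕ.≤-Reasoning
  expand : ∀ k → 2 ℕ.* ((6 ℕ.+ k) ℕ.* (6 ℕ.+ k)) ℕ.+ (3 ℕ.+ 6 ℕ.* k ℕ.+ k ℕ.* k) ≡ 3 ℕ.* ((5 ℕ.+ k) ℕ.* (5 ℕ.+ k))
  expand = solve-∀

-- For n = 2 q and H = q² one has K_*² = 2 r² / q², so 4 q / K_*² ≤ q t reduces to the hypothesis.
ternary-window-lower : ∀ q t r → 2 ℕ.* (q ℕ.* q) ≤ t ℕ.* (r ℕ.* r) →
  4 ℕ.* q ℕ.* (q ℕ.^ 2 ℕ.* (2 ℕ.* q ℕ.* t ℕ.* (q ℕ.* t))) ≤ q ℕ.* t ℕ.* (2 ℕ.* q ℕ.* t ℕ.* r ℕ.* (2 ℕ.* q ℕ.* t ℕ.* r))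
ternary-window-lower q t r le = begin
  4 ℕ.* q ℕ.* (q ℕ.* (q ℕ.* 1) ℕ.* (2 ℕ.* q ℕ.* t ℕ.* (q ℕ.* t)))      ≡⟨ collect q t ⟩
  4 ℕ.* (q ℕ.* q ℕ.* q ℕ.* t ℕ.* t) ℕ.* (2 ℕ.* (q ℕ.* q))
    ≤⟨ ℕ.*-monoʳ-≤ (4 ℕ.* (q ℕ.* q ℕ.* q ℕ.* t ℕ.* t)) le ⟩
  4 ℕ.* (q ℕ.* q ℕ.* q ℕ.* t ℕ.* t) ℕ.* (t ℕ.* (r ℕ.* r))              ≡⟨ collect′ q t r ⟩
  q ℕ.* t ℕ.* (2 ℕ.* q ℕ.* t ℕ.* r ℕ.* (2 ℕ.* q ℕ.* t ℕ.* r)) ∎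
  where
  open ℕ.≤-Reasoning
  collect : ∀ q t → 4 ℕ.* q ℕ.* (q ℕ.* (q ℕ.* 1) ℕ.* (2 ℕ.* q ℕ.* t ℕ.* (q ℕ.* t))) ≡ 4 ℕ.* (q ℕ.* q ℕ.* q ℕ.* t ℕ.* t) ℕ.* (2 ℕ.* (q ℕ.* q))
  collect = solve-∀
  collect′ : ∀ q t r → 4 ℕ.* (q ℕ.* q ℕ.* q ℕ.* t ℕ.* t) ℕ.* (t ℕ.* (r ℕ.* r)) ≡ q ℕ.* t ℕ.* (2 ℕ.* q ℕ.* t ℕ.* r ℕ.* (2 ℕ.* q ℕ.* t ℕ.* r))
  collect′ = solve-∀

-- A variable dimension d ≡ 3 keeps vector types and powers from unfolding.
module TernaryFacts {{𝓡 : RealNumbers}} {q d} (V : QuadraticSpace q d) (d≡3 : d ≡ 3) (q-odd : ¬ (2 ∣ q)) (6≤q : 6 ≤ q)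
                    (t₀ : ℕ) (3≤t₀ : 3 ≤ t₀) (B : BlockSystem V) (ternary : Ternary V t₀ B) where
  open Geometry V using (nonZero)
  open Ternary ternary
  open BlockSystem B using (P; 𝒮; A; 𝒮[_]; Z)
  open BlockCounts q-odd B
  open StarFacts q-odd (subst (1 ≤_) (sym d≡3) (s≤s z≤n)) B
  open RealProperties
  open Relation.Binary.Reasoning.Setoid setoid

  private instance
    q≢0 : NonZero q
    q≢0 = nonZero

  √2 : ℝ
  √2 = √ℕ 2

  0<√2 : 0ᴿ <ᴿ √2
  0<√2 = √ℕ-positive {2} (s≤s z≤n)

  fromℕq : fromℕ q ≈ᴿ 1ᴿ +ᴿ fromℕ r
  fromℕq = ≈-trans (≈-reflexive (cong fromℕ (sym (ℕ.m+[n∸m]≡n 0<q)))) (≈-trans (fromℕ-+ 1 r) (+-congʳ fromℕ-1))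

  H≡q² : H ≡ q ℕ.^ 2
  H≡q² = cong (λ d → q ℕ.^ (d ∸ 1)) d≡3

  h≈q : h ≈ᴿ fromℕ q
  h≈q = square-injective 0<h (0<fromℕ 0<q) (≈-trans (halfPower-square q d (subst (1 ≤_) (sym d≡3) (s≤s z≤n)))
    (≈-trans (≈-reflexive (cong fromℕ (trans H≡q² (cong (q ℕ.*_) (ℕ.*-identityʳ q))))) (fromℕ-* q q)))

  √ps≈ : √ℕ (p ℕ.* s) ≈ᴿ √2 *ᴿ fromℕ (q ℕ.* t)
  √ps≈ = square-injective (√ℕ-positive 0<ps) (*-positive 0<√2 (0<fromℕ (0<* 0<q 0<t))) (begin
    √ℕ (p ℕ.* s) *ᴿ √ℕ (p ℕ.* s)                             ≈⟨ √ℕ-square (p ℕ.* s) ⟩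
    fromℕ (p ℕ.* s)
      ≈⟨ ≈-reflexive (cong fromℕ (trans ps≡ (trans (cong (λ n → n ℕ.* t ℕ.* (q ℕ.* t)) n≡2q) (rearrange q t)))) ⟩
    fromℕ (2 ℕ.* (q ℕ.* t ℕ.* (q ℕ.* t)))
      ≈⟨ ≈-trans (fromℕ-* 2 (q ℕ.* t ℕ.* (q ℕ.* t))) (*-congˡ (fromℕ-* (q ℕ.* t) (q ℕ.* t))) ⟩
    fromℕ 2 *ᴿ (fromℕ (q ℕ.* t) *ᴿ fromℕ (q ℕ.* t))          ≈⟨ *-congʳ (√ℕ-square 2) ⟨
    √2 *ᴿ √2 *ᴿ (fromℕ (q ℕ.* t) *ᴿ fromℕ (q ℕ.* t))
      ≈⟨ solve 2 (λ w x → w :* w :* (x :* x) := w :* x :* (w :* x)) ≈-refl √2 (fromℕ (q ℕ.* t)) ⟩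
    √2 *ᴿ fromℕ (q ℕ.* t) *ᴿ (√2 *ᴿ fromℕ (q ℕ.* t)) ∎)
    where
    rearrange : ∀ q t → 2 ℕ.* q ℕ.* t ℕ.* (q ℕ.* t) ≡ 2 ℕ.* (q ℕ.* t ℕ.* (q ℕ.* t))
    rearrange = solve-∀

  module _ (K : ℝ⁺) (star : StarConstant B K) where
    -- The equation for K_* without division, from which both its value and the upper window are
    -- read off.
    Kq√2 : value K *ᴿ (fromℕ q *ᴿ √2) ≈ᴿ fromℕ 2 *ᴿ fromℕ r
    Kq√2 = *-cancelʳ-≈ (0<fromℕ (0<* 0<q 0<t)) (begin
      value K *ᴿ (fromℕ q *ᴿ √2) *ᴿ fromℕ (q ℕ.* t)
        ≈⟨ solve 4 (λ k q w x → k :* (q :* w) :* x := k :* q :* (w :* x)) ≈-refl (value K) (fromℕ q) √2 (fromℕ (q ℕ.* t)) ⟩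
      value K *ᴿ fromℕ q *ᴿ (√2 *ᴿ fromℕ (q ℕ.* t))          ≈⟨ *-cong (*-congˡ h≈q) √ps≈ ⟨
      value K *ᴿ h *ᴿ √ℕ (p ℕ.* s)                           ≈⟨ star-equation K star ⟨
      fromℕ m
        ≈⟨ ≈-reflexive (cong fromℕ (trans (cong (λ n → n ℕ.* t ℕ.* r) n≡2q) (rearrange q t r))) ⟩
      fromℕ (2 ℕ.* r ℕ.* (q ℕ.* t))
        ≈⟨ ≈-trans (fromℕ-* (2 ℕ.* r) (q ℕ.* t)) (*-congʳ (fromℕ-* 2 r)) ⟩
      fromℕ 2 *ᴿ fromℕ r *ᴿ fromℕ (q ℕ.* t) ∎)
      where
      rearrange : ∀ q t r → 2 ℕ.* q ℕ.* t ℕ.* r ≡ 2 ℕ.* r ℕ.* (q ℕ.* t)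
      rearrange = solve-∀

    ternary-value : TernaryValue B K
    ternary-value = *-cancelʳ-≈ (*-positive (0<fromℕ 0<q) 0<√2) (begin
      value K *ᴿ (fromℕ q *ᴿ √2)                                       ≈⟨ Kq√2 ⟩
      fromℕ 2 *ᴿ fromℕ r
        ≈⟨ *-cong (√ℕ-square 2) (solve 2 (λ o r → o :+ r :- o := r) ≈-refl 1ᴿ (fromℕ r)) ⟨
      √2 *ᴿ √2 *ᴿ (1ᴿ +ᴿ fromℕ r -ᴿ 1ᴿ)
        ≈⟨ *-congˡ (+-cong fromℕq (-‿cong (*-inverse (fromℕ⁺ q)))) ⟨
      √2 *ᴿ √2 *ᴿ (fromℕ q -ᴿ fromℕ q *ᴿ inv (fromℕ⁺ q))
        ≈⟨ solve 3 (λ w q i → w :* w :* (q :- q :* i) := (con (ℤ.+ 1) :- i) :* w :* (q :* w)) ≈-refl √2 (fromℕ q) (inv (fromℕ⁺ q)) ⟩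
      (1ᴿ -ᴿ inv (fromℕ⁺ q)) *ᴿ √2 *ᴿ (fromℕ q *ᴿ √2) ∎)

    module _ (C₁ : ℝ) (large : C₁ *ᴿ √2 ≤ᴿ fromℕ q *ᴿ (C₁ *ᴿ √2 -ᴿ fromℕ t₀)) where
      C₁Kq : C₁ *ᴿ value K *ᴿ fromℕ q ≈ᴿ C₁ *ᴿ √2 *ᴿ fromℕ r
      C₁Kq = *-cancelʳ-≈ 0<√2 (begin
        C₁ *ᴿ value K *ᴿ fromℕ q *ᴿ √2
          ≈⟨ solve 4 (λ c k q w → c :* k :* q :* w := c :* (k :* (q :* w))) ≈-refl C₁ (value K) (fromℕ q) √2 ⟩
        C₁ *ᴿ (value K *ᴿ (fromℕ q *ᴿ √2))
          ≈⟨ *-congˡ (≈-trans Kq√2 (*-congʳ (≈-sym (√ℕ-square 2)))) ⟩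
        C₁ *ᴿ (√2 *ᴿ √2 *ᴿ fromℕ r)
          ≈⟨ solve 3 (λ c w r → c :* (w :* w :* r) := c :* w :* r :* w) ≈-refl C₁ √2 (fromℕ r) ⟩
        C₁ *ᴿ √2 *ᴿ fromℕ r *ᴿ √2 ∎)

      -- Since C₁ K_* q = C₁ √2 (q - 1), the upper bound rearranges to `large`, in which q
      -- multiplies the fixed gap C₁ √2 - t.
      ternary-window : TernaryWindow B t₀ C₁ K
      ternary-window = window-lower-bound K star lower , trans ∣𝒮∣≡qt (trans (ℕ.*-comm q t) (cong (ℕ._* q) blocks≡t)) ,
        ≤-respʳ (≈-sym C₁Kq) (≤-difference (begin
          fromℕ (t₀ ℕ.* q) -ᴿ C₁ *ᴿ √2 *ᴿ fromℕ r
            ≈⟨ +-congʳ (≈-trans (fromℕ-* t₀ q) (*-congˡ fromℕq)) ⟩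
          fromℕ t₀ *ᴿ (1ᴿ +ᴿ fromℕ r) -ᴿ C₁ *ᴿ √2 *ᴿ fromℕ r
            ≈⟨ solve 3 (λ t s r → t :* (con (ℤ.+ 1) :+ r) :- s :* r := s :- (con (ℤ.+ 1) :+ r) :* (s :- t)) ≈-refl (fromℕ t₀) (C₁ *ᴿ √2) (fromℕ r) ⟩
          C₁ *ᴿ √2 -ᴿ (1ᴿ +ᴿ fromℕ r) *ᴿ (C₁ *ᴿ √2 -ᴿ fromℕ t₀)
            ≈⟨ +-congˡ (-‿cong (*-congʳ fromℕq)) ⟨
          C₁ *ᴿ √2 -ᴿ fromℕ q *ᴿ (C₁ *ᴿ √2 -ᴿ fromℕ t₀)                        ∎) large)
        where
        lower : 4 ℕ.* q ℕ.* b ≤ q ℕ.* t ℕ.* a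
        lower = subst₂ (λ H n → 4 ℕ.* q ℕ.* (H ℕ.* (n ℕ.* t ℕ.* (q ℕ.* t))) ≤ q ℕ.* t ℕ.* (n ℕ.* t ℕ.* r ℕ.* (n ℕ.* t ℕ.* r))) (sym H≡q²) (sym n≡2q)
          (ternary-window-lower q t r (2q²≤t[q-1]² q t 6≤q (subst (3 ≤_) (sym blocks≡t) 3≤t₀)))

  equal-shares : .{{_ : NonZero t₀}} → EqualShares B t₀
  equal-shares z _ = trans (σ-diagonal z) (sym (trans
    (cong (ℤ.+ 1 ℚ./ t₀ ℚ.*_) (trans σ-total (cong (λ t → (t ℕ.* surplus) /1) blocks≡t))) (1/t*[tx]≡x t₀ surplus)))

  cross-blocks-vanish : CrossBlocksVanish B
  cross-blocks-vanish b z _ _ b≢z = σ-cross b≢z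

  ternary-claims : .{{_ : NonZero t₀}} → (C₁ : ℝ) → C₁ *ᴿ √2 ≤ᴿ fromℕ q *ᴿ (C₁ *ᴿ √2 -ᴿ fromℕ t₀) →
    blocks B ≡ t₀
    × ExactCentredBlocks B
    × OneRadius B
    × (Σ[ K ∈ ℝ⁺ ] StarConstant B K × TernaryValue B K × TernaryWindow B t₀ C₁ K)
    × EqualShares B t₀
    × CrossBlocksVanish B
  ternary-claims C₁ large = blocks≡t , exact-centred-blocks , one-radius ,
    (proj₁ star-constant , proj₂ star-constant , ternary-value (proj₁ star-constant) (proj₂ star-constant) ,
      ternary-window (proj₁ star-constant) (proj₂ star-constant) C₁ large) ,
    equal-shares , cross-blocks-vanish

module _ {{𝓡 : RealNumbers}} where
  open RealProperties

  -- The strict hypothesis on C₁ makes the gap `η` positive, and every q beyond C₁ √2 / η qualifies.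
  eventually-large : ∀ (C₁ : ℝ) t → fromℕ t /ᴿ √ℕ⁺ 2 <ᴿ C₁ →
                     ∃[ N ] ∀ q → N ≤ q → C₁ *ᴿ √ℕ 2 ≤ᴿ fromℕ q *ᴿ (C₁ *ᴿ √ℕ 2 -ᴿ fromℕ t)
  eventually-large C₁ t t/√2<C₁ = proj₁ bound , λ q N≤q → ≤-respˡ undo (*-monoˡ-≤ (proj₂ η)
    (<⇒≤ (<-≤-trans (proj₂ bound) (fromℕ-mono-≤ N≤q))))
    where
    s : ℝ
    s = C₁ *ᴿ √ℕ 2

    t<s : fromℕ t <ᴿ s
    t<s = <-respˡ (≈-trans (*-assoc (fromℕ t) (inv (√ℕ⁺ 2)) (√ℕ 2))
      (≈-trans (*-congˡ (≈-trans (*-comm (inv (√ℕ⁺ 2)) (√ℕ 2)) (*-inverse (√ℕ⁺ 2)))) (*-identityʳ (fromℕ t))))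
      (*-monoˡ-< (proj₂ (√ℕ⁺ 2)) t/√2<C₁)

    η : ℝ⁺
    η = s -ᴿ fromℕ t , x<y⇒0<y-x t<s

    bound : ∃[ N ] s *ᴿ inv η <ᴿ fromℕ N
    bound = archimedean (s *ᴿ inv η)

    undo : s *ᴿ inv η *ᴿ value η ≈ᴿ s
    undo = ≈-trans (*-assoc s (inv η) (value η)) (≈-trans (*-congˡ (≈-trans (*-comm (inv η) (value η)) (*-inverse η))) (*-identityʳ s))

  ternary-part : (t : ℕ) .{{_ : NonZero t}} → 3 ≤ t → (C₁ : ℝ) → fromℕ t /ᴿ √ℕ⁺ 2 <ᴿ C₁ →
    ForAllLarge 3 (λ V → Σ[ B ∈ BlockSystem V ]
      ( blocks B ≡ t
      × ExactCentredBlocks B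
      × OneRadius B
      × (Σ[ K ∈ ℝ⁺ ] StarConstant B K × TernaryValue B K × TernaryWindow B t C₁ K)
      × EqualShares B t
      × CrossBlocksVanish B))
  ternary-part t 3≤t C₁ t/√2<C₁ = N , λ q N≤q opp V →
    let system = ternary-system V (proj₁ opp) t (ℕ.≤-trans (s≤s z≤n) 3≤t) (ℕ.≤-trans (ℕ.≤-trans (ℕ.m≤n+m t 6) (ℕ.m≤m+n (6 ℕ.+ t) N₁)) N≤q) in
    proj₁ system , TernaryFacts.ternary-claims V refl (proj₁ opp) (ℕ.≤-trans (ℕ.≤-trans (ℕ.m≤m+n 6 t) (ℕ.m≤m+n (6 ℕ.+ t) N₁)) N≤q) t 3≤t
      (proj₁ system) (proj₂ system) C₁ (proj₂ (eventually-large C₁ t t/√2<C₁) q (ℕ.≤-trans (ℕ.m≤n+m N₁ (6 ℕ.+ t)) N≤q))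
    where
    N₁ N : ℕ
    N₁ = proj₁ (eventually-large C₁ t t/√2<C₁)
    -- The three summands secure the lower window, the room for t levels in the field, and the upper
    -- window.
    N = 6 ℕ.+ t ℕ.+ N₁

corollary4p2 : {{𝓡 : RealNumbers}} →
    ((d : ℕ) → 4 ≤ d → (C₁ : ℝ) → 1ᴿ ≤ᴿ C₁ →
    Σ[ 𝓑 ∈ Family d ]
    ( Always 𝓑 (λ B → ExactCentredBlocks B × OneRadius B
    × (Σ[ K ∈ ℝ⁺ ] StarConstant B K × Window B C₁ K))
    × ((ε : ℝ⁺) → Eventually 𝓑 (λ B → MaxHyperplaneRatioBelow B ε))
    × ((T : ℕ) → Eventually 𝓑 (λ B → T ≤ blocks B))
    × ((c : ℝ⁺) (C : ℝ) → Eventually 𝓑 (λ B →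
    (K : ℝ⁺) → StarConstant B K → HyperplanesBelow B c C K))
    × ((c : ℝ⁺) (C : ℝ) → ForAllLarge d (λ V → ¬ LowerBoundFollows V C₁ c C))
    × ((δ : ℝ⁺) → Eventually 𝓑 (λ B →
    ProperFlatsBelow B δ × TotallySingularFlatsBelow B δ))))
    ×
    ((t : ℕ) .{{_ : NonZero t}} → 3 ≤ t → (C₁ : ℝ) → fromℕ t /ᴿ √ℕ⁺ 2 <ᴿ C₁ →
    ForAllLarge 3 (λ V → Σ[ B ∈ BlockSystem V ]
    ( blocks B ≡ t
    × ExactCentredBlocks B
    × OneRadius B
    × (Σ[ K ∈ ℝ⁺ ] StarConstant B K × TernaryValue B K × TernaryWindow B t C₁ K)
    × EqualShares B t
    × CrossBlocksVanish B)))
corollary4p2 {{𝓡}} = (λ d 4≤d C₁ 1≤C₁ →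
    growing-family 4≤d , growing-window {{𝓡}} 4≤d C₁ 1≤C₁ , max-hyperplane-share {{𝓡}} 4≤d , growing-blocks {{𝓡}} 4≤d ,
    hyperplane-shares {{𝓡}} 4≤d , (λ c C → lower-bound-fails {{𝓡}} 4≤d c C C₁ 1≤C₁) , proper-flat-share {{𝓡}} 4≤d)
  , ternary-part {{𝓡}}
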